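{- Let $b$ be a connected locally finite weighted graph over an at most countable set $V$ with values in an ordered field $\mathbb K$, let $\pi=\pi_V^b$ be the associated real transition matrix (with $U=V$), and let $C\subseteq V$ be an essential component (with respect to $V$). (a) $C$ is recurrent if and only if $G(a)=\infty$ for some $a\in C$, equivalently for all $a\in C$. (b) $C$ is transient if and only if $G(a)<\infty$ for some $a\in C$, equivalently for all $a\in C$.
   Context: Let $(\mathbb K,\succ)$ be an ordered field and $\mathbb K^+=\{k\succ 0\}$; $\mathbb Q^+$ are the positive rationals. For $k_1,k_2\in\mathbb K^+$ write $k_1\simeq k_2$ if $c_1\prec k_1/k_2\prec c_2$ for some $c_1,c_2\in\mathbb Q^+$. Weighted graph: a symmetric map $b:V\times V\to\mathbb K^+\cup\{0\}$ with $b(x,x)=0$; $x\sim y$ means $b(x,y)\succ 0$. A path is a finite sequence $x_0\sim x_1\sim\dots\sim x_n$ ($n=0$ allowed). Connected: any two vertices are joined by a path. Locally finite: every vertex has finitely many neighbors. A subset is connected if the restriction of $b$ to it is connected. Put $b(x)=\sum_{y\in V}b(x,y)$ and $p(x,y)=b(x,y)/b(x)$ ($b(x)\succ0$ is automatic when $V$ has at least two elements). Real part: for $k\in\mathbb K$ with $|k|\prec c$ for some $c\in\mathbb Q^+$, $\rho(k)$ is the unique real number such that $|k-\rho(k)|$ is smaller than every positive rational in an ordered field containing $\mathbb K$ and $\mathbb R$; equivalently $\rho(k)=\sup_{\mathbb R}\{q\in\mathbb Q: q\preceq k\}$. $\pi_V^b(x,y)=\rho(p(x,y))$ for $x,y\in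 V$; this is a real transition matrix. A vertex $x$ is recurrent if the Markov chain $(X_n)$ with transition matrix $\pi_V^b$ started at $x$ satisfies $\mathbb P[X_n=x\text{ for infinitely many }n]=1$, and transient otherwise. A component is called recurrent (transient) if its vertices are recurrent (transient); all vertices of a component have the same type. A strongly connected component (with respect to $V$) is a maximal subset $C\subseteq V$ such that for any $x,y\in C$ there is a path $x=x_0\sim\dots\sim x_n=y$ in $V$ with $b(x)\simeq b(x_i,x_{i+1})\simeq b(y)$ for all $i=0,\dots,n-1$. It is essential if for every $x\in C$ and every path $x=x_0\sim\dots\sim x_n=y$ in $V$ with $b(x_i,x_{i+1})\simeq b(x_i)$ for all $i=0,\dots,n-1$ one has $b(x)\simeq b(y)$. Capacity: $\Delta f(x)=\frac1{b(x)}\sum_{y}b(x,y)(f(x)-f(y))$ for $f:V\to\mathbb K$. For finite connected $K\subseteq V$ and $a\in K$ there is a unique $v:V\to\mathbb K$ with $\Delta v=0$ on $K\setminus\{a\}$, $v(a)=1$, $v=0$ on $V\setminus K$; it satisfies $0\preceq v\preceq 1$. Put $\operatorname{cap}_K(a)=b(a)\Delta v(a)$. Then $0\preceq\operatorname{cap}_K(a)/b(a)\preceq1$, and $G_K(a)=1/\rho\big(\operatorname{cap}_K(a)/b(a)\big)\in[1,\infty]$ with $1/0=\infty$. For an exhaustion $(K_n)$ of $V$ (increasing sequence of finite connected sets with union $V$) with $a\in K_0$, $G(a)=\limsup_{n\to\infty}G_{K_n}(a)\in[1,\infty]$ (the sequence is monotone increasing, so this is a limit). -}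

module Defs where

open import Level using (Level; suc)
open import Algebra.Bundles using (CommutativeRing)
import Algebra.Definitions.RawMonoid as RawMonoidDefinitions
open import Axiom.ExcludedMiddle using (ExcludedMiddle)
open import Data.Integer.Base using (ℤ; +_; -[1+_])
open import Data.List.Base using (List; []; _∷_)
open import Data.List.Membership.Propositional using () renaming (_∈_ to _∈ˡ_)
open import Data.List.Relation.Unary.Unique.Propositional using (Unique)
open import Data.Nat.Base as ℕ using (ℕ)
open import Data.Product.Base using (∃; ∃₂; _×_; _,_)
open import Data.Rational.Base as ℚ using (ℚ; 0ℚ; ↥_; ↧ₙ_)
open import Data.Unit.Polymorphic.Base using (⊤)
open import Function.Base using (flip)
open import Function.Bundles using (_↣_; _⇔_)
open import Relation.Binary.Core using (Rel)
open import Relation.Binary.Construct.Closure.ReflexiveTransitive using (Star)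
import Relation.Binary.Construct.Add.Supremum.NonStrict as AddSupremumNonStrict
import Relation.Binary.Construct.Add.Supremum.Strict as AddSupremumStrict
import Relation.Binary.Construct.StrictToNonStrict as StrictToNonStrict
open import Relation.Binary.PropositionalEquality.Core using (_≡_; _≢_)
open import Relation.Binary.Structures using (IsStrictTotalOrder)
open import Relation.Nullary.Construct.Add.Supremum using (_⁺; [_]; ⊤⁺)
open import Relation.Nullary.Decidable.Core using (yes; no)
open import Relation.Nullary.Negation.Core using (¬_)
open import Relation.Unary using (Pred; _∈_; _∉_; _⊆_; _≐_; _⊥_; ∁; ⋃; Satisfiable)

private
  variable
    a ℓ : Level

IsSup : {A : Set a} → Rel A ℓ → ∀ {s} → Pred A s → Pred A _
IsSup _≤_ S x = (∀ y → y ∈ S → y ≤ x) × (∀ u → (∀ y → y ∈ S → y ≤ u) → x ≤ u)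

IsInf : {A : Set a} → Rel A ℓ → ∀ {s} → Pred A s → Pred A _
IsInf _≤_ = IsSup (flip _≤_)

-- Definite description: an element satisfying P if there is one (and an
-- irrelevant default value otherwise).  It is applied only to properties whose
-- solution is unique up to the relevant equality.
the : ExcludedMiddle ℓ → {A : Set ℓ} → A → Pred A ℓ → A
the em default P with em {∃ P}
... | yes (x , _) = x
... | no  _       = default

record OrderedField (ℓ : Level) : Set (suc ℓ) where
  infix  4 _<_
  infix  8 _⁻¹
  field
    commutativeRing : CommutativeRing ℓ ℓ

  open CommutativeRing commutativeRing public

  field
    0≉1                : ¬ 0# ≈ 1#
    -- The value of 0# ⁻¹ is unspecified.
    _⁻¹                : Carrier → Carrier
    ⁻¹-cong            : ∀ {x y} → x ≈ y → x ⁻¹ ≈ y ⁻¹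
    *-inverseʳ         : ∀ x → ¬ x ≈ 0# → x * x ⁻¹ ≈ 1#
    _<_                : Rel Carrier ℓ
    isStrictTotalOrder : IsStrictTotalOrder _≈_ _<_
    +-monoʳ-<          : ∀ z {x y} → x < y → z + x < z + y
    *-pos              : ∀ {x y} → 0# < x → 0# < y → 0# < x * y

  open IsStrictTotalOrder isStrictTotalOrder public using (compare; _≟_; _<?_)
  open StrictToNonStrict _≈_ _<_ public using (_≤_)

  open RawMonoidDefinitions +-rawMonoid using () renaming (_×_ to _·_)

  fromℤ : ℤ → Carrier
  fromℤ (+ n)    = n · 1#
  fromℤ -[1+ n ] = - (ℕ.suc n · 1#)

  fromℚ : ℚ → Carrier
  fromℚ q = fromℤ (↥ q) * (↧ₙ q · 1#) ⁻¹

  ∑ : {A : Set ℓ} → List A → (A → Carrier) → Carrier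
  ∑ []       f = 0#
  ∑ (x ∷ xs) f = f x + ∑ xs f

  partialSum : (ℕ → Carrier) → ℕ → Carrier
  partialSum f ℕ.zero    = 0#
  partialSum f (ℕ.suc n) = partialSum f n + f n

  _ConvergesTo_ : (ℕ → Carrier) → Carrier → Set ℓ
  s ConvergesTo l = ∀ ε → 0# < ε →
    ∃ λ N → ∀ n → N ℕ.≤ n → s n < l + ε × l < s n + ε

-- The real numbers, characterised up to unique isomorphism.
record CompleteOrderedField (ℓ : Level) : Set (suc ℓ) where
  field
    orderedField : OrderedField ℓ

  open OrderedField orderedField public

  field
    complete : (S : Pred Carrier ℓ) → Satisfiable S →
               (∃ λ u → ∀ x → x ∈ S → x ≤ u) → ∃ (IsSup _≤_ S)

AtMostCountable : Set ℓ → Set ℓ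
AtMostCountable V = V ↣ ℕ

HasTwoElements : Set ℓ → Set ℓ
HasTwoElements V = ∃₂ λ (x y : V) → x ≢ y

record WeightedGraph (𝕂 : OrderedField ℓ) (V : Set ℓ) : Set ℓ where
  open OrderedField 𝕂
  infix 4 _∼_
  field
    b           : V → V → Carrier
    nonNegative : ∀ x y → 0# ≤ b x y
    symmetric   : ∀ x y → b x y ≈ b y x
    loopless    : ∀ x → b x x ≈ 0#

  _∼_ : Rel V ℓ
  x ∼ y = 0# < b x y

module _ {𝕂 : OrderedField ℓ} {V : Set ℓ} (Γ : WeightedGraph 𝕂 V) where
  open WeightedGraph Γ

  Connected : Set ℓ
  Connected = ∀ x y → Star _∼_ x y

  ConnectedSubset : Pred V ℓ → Set ℓ
  ConnectedSubset K =
    ∀ x y → x ∈ K → y ∈ K → Star (λ u w → u ∈ K × w ∈ K × u ∼ w) x y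

  LocallyFinite : Set ℓ
  LocallyFinite =
    ∀ x → ∃ λ (ys : List V) → Unique ys × (∀ y → (y ∈ˡ ys) ⇔ (x ∼ y))

FiniteSubset : {V : Set ℓ} → Pred V ℓ → Set ℓ
FiniteSubset K = ∃ λ xs → ∀ x → x ∈ K → x ∈ˡ xs

record Exhaustion {𝕂 : OrderedField ℓ} {V : Set ℓ}
                  (Γ : WeightedGraph 𝕂 V) (o : V) : Set (suc ℓ) where
  field
    set        : ℕ → Pred V ℓ
    finite     : ∀ n → FiniteSubset (set n)
    connected  : ∀ n → ConnectedSubset Γ (set n)
    increasing : ∀ n → set n ⊆ set (ℕ.suc n)
    covers     : ∀ x → ∃ λ n → x ∈ set n
    base       : o ∈ set 0

-- The measure is a total function on subsets, but it is constrained (and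
-- meaningful) on events only.
record ProbabilitySpace (ℝ : CompleteOrderedField ℓ) : Set (suc (suc ℓ)) where
  open CompleteOrderedField ℝ
  field
    Ω         : Set ℓ
    IsEvent   : Pred Ω ℓ → Set (suc ℓ)
    whole     : IsEvent (λ _ → ⊤)
    ∁-event   : ∀ {A} → IsEvent A → IsEvent (∁ A)
    ⋃-event   : ∀ {A : ℕ → Pred Ω ℓ} → (∀ i → IsEvent (A i)) → IsEvent (⋃ ℕ A)
    ≐-event   : ∀ {A B} → A ≐ B → IsEvent A → IsEvent B

    ℙ           : Pred Ω ℓ → Carrier
    ℙ-resp-≐    : ∀ {A B} → IsEvent A → A ≐ B → ℙ A ≈ ℙ B
    ℙ-nonNeg    : ∀ {A} → IsEvent A → 0# ≤ ℙ A
    ℙ-whole     : ℙ (λ _ → ⊤) ≈ 1#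
    ℙ-σadditive : ∀ {A : ℕ → Pred Ω ℓ} → (∀ i → IsEvent (A i)) →
                  (∀ i j → i ≢ j → A i ⊥ A j) →
                  partialSum (λ i → ℙ (A i)) ConvergesTo ℙ (⋃ ℕ A)

-- A Markov chain with state space V (with the σ-algebra generated by points),
-- transition matrix π, started at x.
record MarkovChain (ℝ : CompleteOrderedField ℓ) {V : Set ℓ}
                   (π : V → V → CompleteOrderedField.Carrier ℝ) (x : V)
                   : Set (suc (suc ℓ)) where
  open CompleteOrderedField ℝ
  field
    space : ProbabilitySpace ℝ

  open ProbabilitySpace space public

  field
    X          : ℕ → Ω → V
    measurable : ∀ n y → IsEvent (λ ω → X n ω ≡ y)

  -- The event X₀ = s₀, …, Xₙ = sₙ.
  History : ℕ → (ℕ → V) → Pred Ω ℓ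
  History n s ω = ∀ i → i ℕ.≤ n → X i ω ≡ s i

  field
    initial : ℙ (λ ω → X 0 ω ≡ x) ≈ 1#
    -- Both sides vanish when the history has probability zero, so this is the
    -- Markov property ℙ[Xₙ₊₁ = sₙ₊₁ | X₀ = s₀, …, Xₙ = sₙ] = π(sₙ, sₙ₊₁).
    markov  : ∀ n s → ℙ (History (ℕ.suc n) s) ≈ ℙ (History n s) * π (s n) (s (ℕ.suc n))

  InfinitelyOften : V → Pred Ω ℓ
  InfinitelyOften y ω = ∀ N → ∃ λ n → N ℕ.≤ n × X n ω ≡ y

module Network
  {ℓ : Level} (em : ExcludedMiddle ℓ)
  (𝕂 : OrderedField ℓ) (ℝ : CompleteOrderedField ℓ)
  {V : Set ℓ} (Γ : WeightedGraph 𝕂 V) (lf : LocallyFinite Γ)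
  where

  private
    module K = OrderedField 𝕂
    module R = CompleteOrderedField ℝ

  open WeightedGraph Γ

  infix 4 _≃_
  _≃_ : Rel K.Carrier ℓ
  k₁ ≃ k₂ = ∃₂ λ c₁ c₂ → 0ℚ ℚ.< c₁ × 0ℚ ℚ.< c₂ ×
    K.fromℚ c₁ K.< k₁ K.* k₂ K.⁻¹ × k₁ K.* k₂ K.⁻¹ K.< K.fromℚ c₂

  ρ : K.Carrier → R.Carrier
  ρ k = the em R.0#
    (IsSup R._≤_ (λ r → ∃ λ q → r R.≈ R.fromℚ q × K.fromℚ q K.≤ k))

  neighbours : V → List V
  neighbours x with lf x
  ... | ys , _ = ys

  -- Sums over all of V reduce to sums over neighbours, as b x vanishes elsewhere.
  deg : V → K.Carrier
  deg x = K.∑ (neighbours x) (b x)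

  p : V → V → K.Carrier
  p x y = b x y K.* deg x K.⁻¹

  π : V → V → R.Carrier
  π x y = ρ (p x y)

  Δ : (V → K.Carrier) → V → K.Carrier
  Δ f x = deg x K.⁻¹ K.* K.∑ (neighbours x) (λ y → b x y K.* (f x K.- f y))

  StronglyConnected : Pred V ℓ → Set ℓ
  StronglyConnected C = ∀ x y → x ∈ C → y ∈ C →
    Star (λ u w → u ∼ w × deg x ≃ b u w × b u w ≃ deg y) x y

  IsStronglyConnectedComponent : Pred V ℓ → Set (suc ℓ)
  IsStronglyConnectedComponent C = StronglyConnected C ×
    ((D : Pred V ℓ) → StronglyConnected D → C ⊆ D → D ⊆ C)

  IsEssential : Pred V ℓ → Set ℓ
  IsEssential C = ∀ x y → x ∈ C →
    Star (λ u w → u ∼ w × b u w ≃ deg u) x y → deg x ≃ deg y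

  IsPotential : Pred V ℓ → V → Pred (V → K.Carrier) ℓ
  IsPotential S o v =
    (∀ x → x ∈ S → x ≢ o → Δ v x K.≈ K.0#) × v o K.≈ K.1# × (∀ x → x ∉ S → v x K.≈ K.0#)

  cap : Pred V ℓ → V → K.Carrier
  cap S o = deg o K.* Δ (the em (λ _ → K.0#) (IsPotential S o)) o

  ℝ∞ : Set ℓ
  ℝ∞ = R.Carrier ⁺

  ∞ : ℝ∞
  ∞ = ⊤⁺

  open AddSupremumNonStrict R._≤_ public using () renaming (_≤⁺_ to _≤∞_)
  open AddSupremumStrict R._<_ public using () renaming (_<⁺_ to _<∞_)

  reciprocal : R.Carrier → ℝ∞
  reciprocal r with r R.≟ R.0#
  ... | yes _ = ∞
  ... | no  _ = [ r R.⁻¹ ]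

  -- The infimum over n of the suprema of the tails (g m)_{m ≥ n}.
  limsup : (ℕ → ℝ∞) → ℝ∞
  limsup g = the em ∞
    (IsInf _≤∞_ (λ s → ∃ λ n → IsSup _≤∞_ (λ t → ∃ λ m → n ℕ.≤ m × t ≡ g m) s))

  G[_] : Pred V ℓ → V → ℝ∞
  G[ S ] o = reciprocal (ρ (cap S o K.* deg o K.⁻¹))

  G∞ : (o : V) → Exhaustion Γ o → ℝ∞
  G∞ o E = limsup (λ n → G[ Exhaustion.set E n ] o)

  -- The types of vertices and components, relative to a realisation of the
  -- chain with transition matrix π for each starting vertex.
  module _ (chain : ∀ x → MarkovChain ℝ π x) where

    RecurrentVertex : Pred V ℓ
    RecurrentVertex x = ℙ (InfinitelyOften x) R.≈ R.1#
      where open MarkovChain (chain x)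

    TransientVertex : Pred V ℓ
    TransientVertex = ∁ RecurrentVertex

    Recurrent : Pred V ℓ → Set ℓ
    Recurrent C = ∀ x → x ∈ C → RecurrentVertex x

    Transient : Pred V ℓ → Set ℓ
    Transient C = ∀ x → x ∈ C → TransientVertex x

{-# OPTIONS --safe #-}

-- Steps of positive real probability lead from an essential component C into C,
-- and any two vertices of C are joined by such steps.  Let h a x be the
-- probability that the chain started at x ∈ C ever visits a.  Both properties of a
-- are equivalent to h a ≡ 1 on C.  By the Markov property, recurrence says that a
-- is hit almost surely from every vertex reachable from a.  The real part of the
-- equilibrium potential of K_n is at most h a by the maximum principle, and it
-- exceeds the probability of hitting a within k steps once K_n is large; hence
-- 1 / G(a) = 1 − ∑ π(a,y) h a y, the probability of never returning to a.  Finally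
-- h c is superharmonic, which carries h a ≡ 1 over to the other vertices c of C.
module Submission where

open import Defs
open import Level as Level using (Level)
import Algebra.Properties.AbelianGroup as AbelianGroupProperties
import Algebra.Properties.Ring as RingProperties
import Algebra.Properties.Semiring.Mult as SemiringMult
import Algebra.Properties.Semiring.Mult.TCOptimised as SemiringMultTCO
import Algebra.Solver.Ring as RingSolver
open import Algebra.Solver.Ring.AlmostCommutativeRing using (fromCommutativeRing; _-Raw-AlmostCommutative⟶_)
open import Axiom.DoubleNegationElimination using (em⇒dne)
open import Axiom.ExcludedMiddle using (ExcludedMiddle)
open import Data.Empty using (⊥-elim)
open import Data.Integer.Base as ℤ using (ℤ; +_; -[1+_]; _⊖_)
import Data.Integer.GCD as ℤ
import Data.Integer.Properties as ℤ
open import Data.List.Base using (List; []; _∷_; filter; deduplicate)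
open import Data.List.Membership.Propositional using () renaming (_∈_ to _∈ˡ_)
open import Data.List.Membership.Propositional.Properties using (∈-filter⁺; ∈-filter⁻; ∈-deduplicate⁺)
open import Data.List.Relation.Unary.All as All using ()
open import Data.List.Relation.Unary.AllPairs using ([]; _∷_)
open import Data.List.Relation.Unary.Any using (here; there; _─_)
open import Data.List.Relation.Unary.Unique.Propositional using (Unique)
open import Data.List.Relation.Unary.Unique.Propositional.Properties using (filter⁺)
import Data.List.Relation.Unary.Unique.DecPropositional.Properties as DecUnique
open import Data.Maybe.Base using (just; nothing)
open import Data.Nat.Base as ℕ using (ℕ; zero; suc)
import Data.Nat.Properties as ℕ
open import Data.Product.Base using (∃; _×_; _,_; proj₁; proj₂)
open import Data.Rational.Base as ℚ using (0ℚ; ↥_; ↧_; ↧ₙ_)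
import Data.Rational.Properties as ℚ
open import Data.Sum.Base using (_⊎_; inj₁; inj₂)
open import Data.Unit.Polymorphic.Base using (⊤)
open import Function.Base using (const)
open import Function.Bundles using (_⇔_; mk⇔; Equivalence)
open import Relation.Binary.Bundles using (StrictPartialOrder; TotalOrder)
open import Relation.Binary.Construct.Closure.ReflexiveTransitive using (Star; ε; _◅_)
import Relation.Binary.Construct.StrictToNonStrict as StrictToNonStrict
open import Relation.Binary.Definitions using (tri<; tri≈; tri>)
open import Relation.Binary.PropositionalEquality as ≡ using (_≡_; _≢_)
import Relation.Binary.Reasoning.StrictPartialOrder as StrictReasoning
open import Relation.Binary.Structures using (IsStrictTotalOrder)
open import Relation.Nullary.Decidable.Core using (Dec; yes; no)
open import Relation.Nullary.Negation.Core using (¬_; contradiction)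
open import Relation.Unary using (Pred; _∈_; _∉_; _⊆_; _≐_; _⊥_; ∁; ⋃; _∪_; _∩_)

-- Potentials live in 𝕂, where every edge has positive weight and the connectedness of K_n supplies
-- the maximum principle. The chain lives in ℝ, and `ρ` is the only passage between the two. Under
-- `ρ` infinitesimal transition probabilities become 0, so K_n may fall apart for the real chain.
-- The real maximum principle is therefore run on C, whose irreducibility takes over the role of the
-- connectedness of K_n. A path to a inside C may leave K_n, which does no harm because the
-- equilibrium potential vanishes there. To carry harmonicity across, `ρ` must respect finite sums
-- and products on the unit interval. Elements of the two fields are never compared directly: both
-- are tested against the same fractions m / (n + 1), and real identities are obtained up to a
-- bounded error after multiplication by n + 1. The chain enters only through the probabilities of
-- its finite histories. Restarting it at time n is expressed by intersecting with a history up to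
-- time n.

-- Arithmetic of ordered fields and the embedded naturals, integers and rationals

module OrderedFieldProperties {ℓ : Level} (F : OrderedField ℓ) where
  open OrderedField F public

  open IsStrictTotalOrder isStrictTotalOrder public
    using (isStrictPartialOrder)
    renaming (trans to <-trans; irrefl to <-irrefl; <-respˡ-≈ to <-respˡ; <-respʳ-≈ to <-respʳ)

  private
    module NonStrict = StrictToNonStrict _≈_ _<_
    strictPartialOrder : StrictPartialOrder ℓ ℓ ℓ
    strictPartialOrder = record { isStrictPartialOrder = isStrictPartialOrder }

  module ≤-Reasoning = StrictReasoning strictPartialOrder

  open RingProperties ring public
    using (-‿involutive; -‿distribˡ-*; -‿distribʳ-*; -0#≈0#)

  open SemiringMult semiring public
    using (×-homo-+; ×1-homo-*) renaming (_×_ to _·_)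
  private module TCO = SemiringMultTCO semiring

  fromℕ : ℕ → Carrier
  fromℕ n = n · 1#

  private
    -- Unlike fromℤ, this maps + 1 definitionally to 1#, so that the solver
    -- recognises the constant 1#.
    ⟦_⟧ℤ : ℤ → Carrier
    ⟦ + n      ⟧ℤ = n TCO.× 1#
    ⟦ -[1+ n ] ⟧ℤ = - (suc n TCO.× 1#)

    fromℤ-≈ : ∀ i → ⟦ i ⟧ℤ ≈ fromℤ i
    fromℤ-≈ (+ n)    = sym (TCO.×ᵤ≈× n 1#)
    fromℤ-≈ -[1+ n ] = -‿cong (sym (TCO.×ᵤ≈× (suc n) 1#))

  private module _ where
    open import Algebra.Solver.Ring.NaturalCoefficients.Default commutativeSemiring
    -- The ring solver set up below rests on `fromℤ` being a homomorphism, and `cancel-1` serves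
    -- that proof. Only the semiring solver is available here, so negatives enter as independent
    -- atoms.
    shuffle : ∀ w a b b′ → (w + a) + (b + b′) ≈ (a + b) + (w + b′)
    shuffle = solve 4 (λ w a b b′ → (w :+ a) :+ (b :+ b′) := (a :+ b) :+ (w :+ b′)) refl

  private
    module Group = AbelianGroupProperties +-abelianGroup

    cancel-1 : ∀ a b → (1# + a) + - (1# + b) ≈ a + - b
    cancel-1 a b = begin
      (1# + a) + - (1# + b)     ≈⟨ +-congˡ (Group.⁻¹-∙-comm 1# b) ⟨
      (1# + a) + (- 1# + - b)   ≈⟨ shuffle 1# a (- 1#) (- b) ⟩
      (a + - 1#) + (1# + - b)   ≈⟨ shuffle a (- 1#) 1# (- b) ⟩
      (- 1# + 1#) + (a + - b)   ≈⟨ +-congʳ (-‿inverseˡ 1#) ⟩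
      0# + (a + - b)            ≈⟨ +-identityˡ _ ⟩
      a + - b                   ∎
      where open import Relation.Binary.Reasoning.Setoid setoid

  fromℤ-⊖ : ∀ m n → fromℤ (m ⊖ n) ≈ fromℕ m + - fromℕ n
  fromℤ-⊖ m zero          = sym (trans (+-congˡ -0#≈0#) (+-identityʳ _))
  fromℤ-⊖ zero (suc n)    = sym (+-identityˡ _)
  fromℤ-⊖ (suc m) (suc n) = begin
    fromℤ (suc m ⊖ suc n)        ≡⟨ ≡.cong fromℤ (ℤ.[1+m]⊖[1+n]≡m⊖n m n) ⟩
    fromℤ (m ⊖ n)                ≈⟨ fromℤ-⊖ m n ⟩
    fromℕ m + - fromℕ n          ≈⟨ cancel-1 _ _ ⟨
    fromℕ (suc m) + - fromℕ (suc n) ∎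
    where open import Relation.Binary.Reasoning.Setoid setoid

  fromℤ-+ : ∀ i j → fromℤ (i ℤ.+ j) ≈ fromℤ i + fromℤ j
  fromℤ-+ (+ m)    (+ n)    = ×-homo-+ 1# m n
  fromℤ-+ (+ m)    -[1+ n ] = fromℤ-⊖ m (suc n)
  fromℤ-+ -[1+ m ] (+ n)    = trans (fromℤ-⊖ n (suc m)) (+-comm _ _)
  fromℤ-+ -[1+ m ] -[1+ n ] = begin
    - fromℕ (suc (suc (m ℕ.+ n)))           ≡⟨ ≡.cong (λ k → - fromℕ (suc k)) (ℕ.+-suc m n) ⟨
    - fromℕ (suc m ℕ.+ suc n)               ≈⟨ -‿cong (×-homo-+ 1# (suc m) (suc n)) ⟩
    - (fromℕ (suc m) + fromℕ (suc n))       ≈⟨ Group.⁻¹-∙-comm _ _ ⟨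
    - fromℕ (suc m) + - fromℕ (suc n)       ∎
    where open import Relation.Binary.Reasoning.Setoid setoid

  fromℤ-neg : ∀ i → fromℤ (ℤ.- i) ≈ - fromℤ i
  fromℤ-neg (+ zero)  = sym -0#≈0#
  fromℤ-neg (+ suc n) = refl
  fromℤ-neg -[1+ n ]  = sym (-‿involutive _)

  fromℤ-pos-* : ∀ m j → fromℤ (+ m ℤ.* j) ≈ fromℕ m * fromℤ j
  fromℤ-pos-* m (+ n) = begin
    fromℤ (+ m ℤ.* + n)   ≡⟨ ≡.cong fromℤ (ℤ.pos-* m n) ⟨
    fromℕ (m ℕ.* n)       ≈⟨ ×1-homo-* m n ⟩
    fromℕ m * fromℕ n     ∎
    where open import Relation.Binary.Reasoning.Setoid setoid
  fromℤ-pos-* m -[1+ n ] = begin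
    fromℤ (+ m ℤ.* -[1+ n ])        ≡⟨ ≡.cong fromℤ (ℤ.neg-distribʳ-* (+ m) (+ suc n)) ⟨
    fromℤ (ℤ.- (+ m ℤ.* + suc n))   ≈⟨ fromℤ-neg (+ m ℤ.* + suc n) ⟩
    - fromℤ (+ m ℤ.* + suc n)       ≈⟨ -‿cong (fromℤ-pos-* m (+ suc n)) ⟩
    - (fromℕ m * fromℕ (suc n))     ≈⟨ -‿distribʳ-* _ _ ⟩
    fromℕ m * - fromℕ (suc n)       ∎
    where open import Relation.Binary.Reasoning.Setoid setoid

  fromℤ-* : ∀ i j → fromℤ (i ℤ.* j) ≈ fromℤ i * fromℤ j
  fromℤ-* (+ m)    j = fromℤ-pos-* m j
  fromℤ-* -[1+ m ] j = begin
    fromℤ (-[1+ m ] ℤ.* j)        ≡⟨ ≡.cong fromℤ (ℤ.neg-distribˡ-* (+ suc m) j) ⟨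
    fromℤ (ℤ.- (+ suc m ℤ.* j))   ≈⟨ fromℤ-neg (+ suc m ℤ.* j) ⟩
    - fromℤ (+ suc m ℤ.* j)       ≈⟨ -‿cong (fromℤ-pos-* (suc m) j) ⟩
    - (fromℕ (suc m) * fromℤ j)   ≈⟨ -‿distribˡ-* _ _ ⟩
    - fromℕ (suc m) * fromℤ j     ∎
    where open import Relation.Binary.Reasoning.Setoid setoid

  private
    morphism : ℤ.+-*-rawRing -Raw-AlmostCommutative⟶ fromCommutativeRing commutativeRing
    morphism = record
      { ⟦_⟧    = ⟦_⟧ℤ
      ; +-homo = λ i j → trans (fromℤ-≈ (i ℤ.+ j)) (trans (fromℤ-+ i j) (+-cong (sym (fromℤ-≈ i)) (sym (fromℤ-≈ j))))
      ; *-homo = λ i j → trans (fromℤ-≈ (i ℤ.* j)) (trans (fromℤ-* i j) (*-cong (sym (fromℤ-≈ i)) (sym (fromℤ-≈ j))))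
      ; -‿homo = λ i → trans (fromℤ-≈ (ℤ.- i)) (trans (fromℤ-neg i) (-‿cong (sym (fromℤ-≈ i))))
      ; 0-homo = refl
      ; 1-homo = refl
      }

    coefficient-≟ : ∀ i j → _
    coefficient-≟ i j with i ℤ.≟ j
    ... | yes i≡j = just (reflexive (≡.cong ⟦_⟧ℤ i≡j))
    ... | no  _   = nothing

  module Solver = RingSolver ℤ.+-*-rawRing (fromCommutativeRing commutativeRing) morphism coefficient-≟

  ≤-totalOrder : TotalOrder ℓ ℓ ℓ
  ≤-totalOrder = record { isTotalOrder = NonStrict.isTotalOrder isStrictTotalOrder }

  open TotalOrder ≤-totalOrder public
    using ()
    renaming (refl to ≤-refl; reflexive to ≤-reflexive; trans to ≤-trans; antisym to ≤-antisym; total to ≤-total)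

  <⇒≤ : ∀ {x y} → x < y → x ≤ y
  <⇒≤ = inj₁

  <-≤-trans : ∀ {x y z} → x < y → y ≤ z → x < z
  <-≤-trans = NonStrict.<-≤-trans <-trans <-respʳ

  ≤-<-trans : ∀ {x y z} → x ≤ y → y < z → x < z
  ≤-<-trans = NonStrict.≤-<-trans sym <-trans <-respˡ

  <⇒≱ : ∀ {x y} → x < y → ¬ y ≤ x
  <⇒≱ x<y y≤x = <-irrefl refl (<-≤-trans x<y y≤x)

  ≮⇒≥ : ∀ {x y} → ¬ x < y → y ≤ x
  ≮⇒≥ {x} {y} x≮y with compare x y
  ... | tri< x<y _ _ = contradiction x<y x≮y
  ... | tri≈ _ x≈y _ = inj₂ (sym x≈y)
  ... | tri> _ _ y<x = inj₁ y<x

  ≰⇒> : ∀ {x y} → ¬ x ≤ y → y < x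
  ≰⇒> {x} {y} x≰y with compare x y
  ... | tri< x<y _ _ = contradiction (inj₁ x<y) x≰y
  ... | tri≈ _ x≈y _ = contradiction (inj₂ x≈y) x≰y
  ... | tri> _ _ y<x = y<x

  ≤∧≉⇒< : ∀ {x y} → x ≤ y → ¬ x ≈ y → x < y
  ≤∧≉⇒< (inj₁ x<y) _   = x<y
  ≤∧≉⇒< (inj₂ x≈y) x≉y = contradiction x≈y x≉y

  <⇒≉ : ∀ {x y} → x < y → ¬ y ≈ x
  <⇒≉ x<y y≈x = <-irrefl (sym y≈x) x<y

  +-monoʳ-≤ : ∀ z {x y} → x ≤ y → z + x ≤ z + y
  +-monoʳ-≤ z (inj₁ x<y) = inj₁ (+-monoʳ-< z x<y)
  +-monoʳ-≤ z (inj₂ x≈y) = inj₂ (+-congˡ x≈y)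

  +-monoˡ-< : ∀ z {x y} → x < y → x + z < y + z
  +-monoˡ-< z x<y = <-respˡ (+-comm z _) (<-respʳ (+-comm z _) (+-monoʳ-< z x<y))

  +-monoˡ-≤ : ∀ z {x y} → x ≤ y → x + z ≤ y + z
  +-monoˡ-≤ z (inj₁ x<y) = inj₁ (+-monoˡ-< z x<y)
  +-monoˡ-≤ z (inj₂ x≈y) = inj₂ (+-congʳ x≈y)

  +-mono-≤ : ∀ {x y u v} → x ≤ y → u ≤ v → x + u ≤ y + v
  +-mono-≤ x≤y u≤v = ≤-trans (+-monoˡ-≤ _ x≤y) (+-monoʳ-≤ _ u≤v)

  +-cancelˡ-≤ : ∀ z {x y} → z + x ≤ z + y → x ≤ y
  +-cancelˡ-≤ z {x} {y} h = ≮⇒≥ λ y<x → <⇒≱ (+-monoʳ-< z y<x) h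

  +-cancelʳ-≤ : ∀ z {x y} → x + z ≤ y + z → x ≤ y
  +-cancelʳ-≤ z {x} {y} h = ≮⇒≥ λ y<x → <⇒≱ (+-monoˡ-< z y<x) h

  +-nonNeg : ∀ {x y} → 0# ≤ x → 0# ≤ y → 0# ≤ x + y
  +-nonNeg 0≤x 0≤y = ≤-trans (≤-reflexive (sym (+-identityˡ 0#))) (+-mono-≤ 0≤x 0≤y)

  x≤x+y : ∀ {x y} → 0# ≤ y → x ≤ x + y
  x≤x+y 0≤y = ≤-trans (≤-reflexive (sym (+-identityʳ _))) (+-monoʳ-≤ _ 0≤y)

  x≤y+x : ∀ {x y} → 0# ≤ y → x ≤ y + x
  x≤y+x 0≤y = ≤-trans (≤-reflexive (sym (+-identityˡ _))) (+-monoˡ-≤ _ 0≤y)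

  private
    x+[y-x] : ∀ x y → x + (y - x) ≈ y
    x+[y-x] = solve 2 (λ x y → x :+ (y :- x) := y) refl
      where open Solver

  x≤y⇒0≤y-x : ∀ {x y} → x ≤ y → 0# ≤ y - x
  x≤y⇒0≤y-x {x} {y} x≤y = +-cancelˡ-≤ x (begin
    x + 0#        ≈⟨ +-identityʳ x ⟩
    x             ≤⟨ x≤y ⟩
    y             ≈⟨ x+[y-x] x y ⟨
    x + (y - x)   ∎)
    where open ≤-Reasoning

  0≤y-x⇒x≤y : ∀ {x y} → 0# ≤ y - x → x ≤ y
  0≤y-x⇒x≤y {x} {y} h = ≤-trans (x≤x+y h) (≤-reflexive (x+[y-x] x y))

  x<y⇒0<y-x : ∀ {x y} → x < y → 0# < y - x
  x<y⇒0<y-x {x} {y} x<y = ≰⇒> λ h → <⇒≱ x<y (≤-trans (≤-reflexive (sym (x+[y-x] x y)))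
    (≤-trans (+-monoʳ-≤ x h) (≤-reflexive (+-identityʳ x))))

  0<y-x⇒x<y : ∀ {x y} → 0# < y - x → x < y
  0<y-x⇒x<y {x} {y} h = <-respˡ (+-identityʳ x) (<-respʳ (x+[y-x] x y) (+-monoʳ-< x h))

  x+y≤z⇒x≤z-y : ∀ {x y z} → x + y ≤ z → x ≤ z - y
  x+y≤z⇒x≤z-y {x} {y} {z} h = ≤-trans
    (≤-reflexive (solve 2 (λ x y → x := (x :+ y) :- y) refl x y))
    (+-monoˡ-≤ (- y) h)
    where open Solver

  x≤z-y⇒x+y≤z : ∀ {x y z} → x ≤ z - y → x + y ≤ z
  x≤z-y⇒x+y≤z {x} {y} {z} h = ≤-trans (+-monoˡ-≤ y h)
    (≤-reflexive (solve 2 (λ z y → (z :- y) :+ y := z) refl z y))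
    where open Solver

  neg-mono-≤ : ∀ {x y} → x ≤ y → - y ≤ - x
  neg-mono-≤ {x} {y} x≤y = 0≤y-x⇒x≤y (≤-trans (x≤y⇒0≤y-x x≤y)
    (≤-reflexive (solve 2 (λ x y → y :- x := (:- x) :- (:- y)) refl x y)))
    where open Solver

  minus-monoʳ-≤ : ∀ z {x y} → x ≤ y → z - y ≤ z - x
  minus-monoʳ-≤ z x≤y = +-monoʳ-≤ z (neg-mono-≤ x≤y)

  *-nonNeg : ∀ {x y} → 0# ≤ x → 0# ≤ y → 0# ≤ x * y
  *-nonNeg (inj₁ 0<x) (inj₁ 0<y) = inj₁ (*-pos 0<x 0<y)
  *-nonNeg (inj₂ 0≈x) _          = inj₂ (sym (trans (*-congʳ (sym 0≈x)) (zeroˡ _)))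
  *-nonNeg (inj₁ _)   (inj₂ 0≈y) = inj₂ (sym (trans (*-congˡ (sym 0≈y)) (zeroʳ _)))

  *-monoˡ-≤ : ∀ {z x y} → 0# ≤ z → x ≤ y → z * x ≤ z * y
  *-monoˡ-≤ {z} {x} {y} 0≤z x≤y = 0≤y-x⇒x≤y (≤-trans (*-nonNeg 0≤z (x≤y⇒0≤y-x x≤y))
    (≤-reflexive (solve 3 (λ x y z → z :* (y :- x) := z :* y :- z :* x) refl x y z)))
    where open Solver

  *-monoʳ-≤ : ∀ {z x y} → 0# ≤ z → x ≤ y → x * z ≤ y * z
  *-monoʳ-≤ 0≤z x≤y = ≤-trans (≤-reflexive (*-comm _ _)) (≤-trans (*-monoˡ-≤ 0≤z x≤y) (≤-reflexive (*-comm _ _)))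

  *-mono-≤ : ∀ {x y u v} → 0# ≤ u → 0# ≤ y → x ≤ y → u ≤ v → x * u ≤ y * v
  *-mono-≤ 0≤u 0≤y x≤y u≤v = ≤-trans (*-monoʳ-≤ 0≤u x≤y) (*-monoˡ-≤ 0≤y u≤v)

  *-monoˡ-< : ∀ {z x y} → 0# < z → x < y → z * x < z * y
  *-monoˡ-< {z} {x} {y} 0<z x<y = 0<y-x⇒x<y (<-≤-trans (*-pos 0<z (x<y⇒0<y-x x<y))
    (≤-reflexive (solve 3 (λ x y z → z :* (y :- x) := z :* y :- z :* x) refl x y z)))
    where open Solver

  *-cancelˡ-≤ : ∀ {z x y} → 0# < z → z * x ≤ z * y → x ≤ y
  *-cancelˡ-≤ 0<z h = ≮⇒≥ λ y<x → <⇒≱ (*-monoˡ-< 0<z y<x) h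

  *-cancelˡ-< : ∀ {z x y} → 0# < z → z * x < z * y → x < y
  *-cancelˡ-< 0<z h = ≰⇒> λ y≤x → <⇒≱ h (*-monoˡ-≤ (<⇒≤ 0<z) y≤x)

  x*y≤x : ∀ {x y} → 0# ≤ x → y ≤ 1# → x * y ≤ x
  x*y≤x 0≤x y≤1 = ≤-trans (*-monoˡ-≤ 0≤x y≤1) (≤-reflexive (*-identityʳ _))

  0≤1 : 0# ≤ 1#
  0≤1 with ≤-total 0# 1#
  ... | inj₁ 0≤1 = 0≤1
  ... | inj₂ 1≤0 = ≤-trans (*-nonNeg 0≤-1 0≤-1) (≤-reflexive (solve 0 ((:- con (+ 1)) :* (:- con (+ 1)) := con (+ 1)) refl))
    where
    open Solver
    0≤-1 : 0# ≤ - 1#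
    0≤-1 = ≤-trans (≤-reflexive (sym -0#≈0#)) (neg-mono-≤ 1≤0)

  0<1 : 0# < 1#
  0<1 = ≤∧≉⇒< 0≤1 0≉1

  *-inverseʳ-pos : ∀ {x} → 0# < x → x * x ⁻¹ ≈ 1#
  *-inverseʳ-pos 0<x = *-inverseʳ _ (<⇒≉ 0<x)

  *-inverseˡ-pos : ∀ {x} → 0# < x → x ⁻¹ * x ≈ 1#
  *-inverseˡ-pos 0<x = trans (*-comm _ _) (*-inverseʳ-pos 0<x)

  ⁻¹-pos : ∀ {x} → 0# < x → 0# < x ⁻¹
  ⁻¹-pos {x} 0<x = *-cancelˡ-< 0<x (<-respˡ (sym (zeroʳ x)) (<-respʳ (sym (*-inverseʳ-pos 0<x)) 0<1))

  *⁻¹-cancel : ∀ {x} y → 0# < x → x * (y * x ⁻¹) ≈ y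
  *⁻¹-cancel {x} y 0<x = begin-equality
    x * (y * x ⁻¹)   ≈⟨ solve 3 (λ x y i → x :* (y :* i) := y :* (x :* i)) refl x y (x ⁻¹) ⟩
    y * (x * x ⁻¹)   ≈⟨ *-congˡ (*-inverseʳ-pos 0<x) ⟩
    y * 1#           ≈⟨ *-identityʳ y ⟩
    y                ∎
    where
    open Solver
    open ≤-Reasoning

  fromℕ-nonNeg : ∀ n → 0# ≤ fromℕ n
  fromℕ-nonNeg zero    = ≤-refl
  fromℕ-nonNeg (suc n) = +-nonNeg 0≤1 (fromℕ-nonNeg n)

  fromℕ-pos : ∀ n → 0# < fromℕ (suc n)
  fromℕ-pos n = <-≤-trans 0<1 (x≤x+y (fromℕ-nonNeg n))

  fromℕ-mono : ∀ {m n} → m ℕ.≤ n → fromℕ m ≤ fromℕ n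
  fromℕ-mono {n = n} ℕ.z≤n = fromℕ-nonNeg n
  fromℕ-mono (ℕ.s≤s m≤n)   = +-monoʳ-≤ 1# (fromℕ-mono m≤n)

  fromℕ-cancel-≤ : ∀ {m n} → fromℕ m ≤ fromℕ n → m ℕ.≤ n
  fromℕ-cancel-≤ {zero}          _ = ℕ.z≤n
  fromℕ-cancel-≤ {suc m} {zero}  h = contradiction h (<⇒≱ (fromℕ-pos m))
  fromℕ-cancel-≤ {suc m} {suc n} h = ℕ.s≤s (fromℕ-cancel-≤ (+-cancelˡ-≤ 1# h))

  fromℕ-+ : ∀ m n → fromℕ (m ℕ.+ n) ≈ fromℕ m + fromℕ n
  fromℕ-+ = ×-homo-+ 1#

  fromℕ-* : ∀ m n → fromℕ (m ℕ.* n) ≈ fromℕ m * fromℕ n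
  fromℕ-* = ×1-homo-*

  ∑-cong : {A : Set ℓ} (xs : List A) {f g : A → Carrier} → (∀ x → x ∈ˡ xs → f x ≈ g x) → ∑ xs f ≈ ∑ xs g
  ∑-cong []       h = refl
  ∑-cong (x ∷ xs) h = +-cong (h x (here ≡.refl)) (∑-cong xs λ y y∈ → h y (there y∈))

  ∑-mono : {A : Set ℓ} (xs : List A) {f g : A → Carrier} → (∀ x → x ∈ˡ xs → f x ≤ g x) → ∑ xs f ≤ ∑ xs g
  ∑-mono []       h = ≤-refl
  ∑-mono (x ∷ xs) h = +-mono-≤ (h x (here ≡.refl)) (∑-mono xs λ y y∈ → h y (there y∈))

  ∑-zero : {A : Set ℓ} (xs : List A) → ∑ xs (λ _ → 0#) ≈ 0#
  ∑-zero []       = refl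
  ∑-zero (x ∷ xs) = trans (+-identityˡ _) (∑-zero xs)

  ∑-nonNeg : {A : Set ℓ} (xs : List A) {f : A → Carrier} → (∀ x → x ∈ˡ xs → 0# ≤ f x) → 0# ≤ ∑ xs f
  ∑-nonNeg xs h = ≤-trans (≤-reflexive (sym (∑-zero xs))) (∑-mono xs h)

  ∑-+ : {A : Set ℓ} (xs : List A) (f g : A → Carrier) → ∑ xs (λ x → f x + g x) ≈ ∑ xs f + ∑ xs g
  ∑-+ []       f g = sym (+-identityˡ 0#)
  ∑-+ (x ∷ xs) f g = trans (+-congˡ (∑-+ xs f g))
    (solve 4 (λ a b c d → (a :+ b) :+ (c :+ d) := (a :+ c) :+ (b :+ d)) refl (f x) (g x) (∑ xs f) (∑ xs g))
    where open Solver

  ∑-*ˡ : {A : Set ℓ} (xs : List A) (c : Carrier) (f : A → Carrier) → ∑ xs (λ x → c * f x) ≈ c * ∑ xs f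
  ∑-*ˡ []       c f = sym (zeroʳ c)
  ∑-*ˡ (x ∷ xs) c f = trans (+-congˡ (∑-*ˡ xs c f)) (sym (distribˡ c _ _))

  ∑-*ʳ : {A : Set ℓ} (xs : List A) (c : Carrier) (f : A → Carrier) → ∑ xs (λ x → f x * c) ≈ ∑ xs f * c
  ∑-*ʳ xs c f = trans (∑-cong xs λ x _ → *-comm (f x) c) (trans (∑-*ˡ xs c f) (*-comm c _))

  ∑-neg : {A : Set ℓ} (xs : List A) (f : A → Carrier) → ∑ xs (λ x → - f x) ≈ - ∑ xs f
  ∑-neg []       f = sym -0#≈0#
  ∑-neg (x ∷ xs) f = trans (+-congˡ (∑-neg xs f)) (solve 2 (λ a b → (:- a) :+ (:- b) := :- (a :+ b)) refl (f x) (∑ xs f))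
    where open Solver

  ∑-minus : {A : Set ℓ} (xs : List A) (f g : A → Carrier) → ∑ xs (λ x → f x - g x) ≈ ∑ xs f - ∑ xs g
  ∑-minus xs f g = trans (∑-+ xs f (λ x → - g x)) (+-congˡ (∑-neg xs g))

  term≤∑ : {A : Set ℓ} {xs : List A} {f : A → Carrier} → (∀ x → x ∈ˡ xs → 0# ≤ f x) →
           ∀ {x} → x ∈ˡ xs → f x ≤ ∑ xs f
  term≤∑ {xs = x ∷ xs} h (here ≡.refl) = x≤x+y (∑-nonNeg xs λ y y∈ → h y (there y∈))
  term≤∑ {xs = x ∷ xs} h (there y∈)    =
    ≤-trans (term≤∑ (λ y y∈ → h y (there y∈)) y∈) (x≤y+x (h x (here ≡.refl)))

  ∑≤0⇒term≤0 : {A : Set ℓ} {xs : List A} {f : A → Carrier} → (∀ x → x ∈ˡ xs → 0# ≤ f x) →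
               ∑ xs f ≤ 0# → ∀ {x} → x ∈ˡ xs → f x ≤ 0#
  ∑≤0⇒term≤0 h ∑≤0 x∈ = ≤-trans (term≤∑ h x∈) ∑≤0

  fromℤ-mono-≤ : ∀ {i j} → i ℤ.≤ j → fromℤ i ≤ fromℤ j
  fromℤ-mono-≤ {i} {j} i≤j with j ℤ.- i in eq | ℤ.i≤j⇒0≤j-i i≤j
  ... | + n | _ = 0≤y-x⇒x≤y (begin
    0#                    ≤⟨ fromℕ-nonNeg n ⟩
    fromℤ (+ n)           ≡⟨ ≡.cong fromℤ eq ⟨
    fromℤ (j ℤ.- i)       ≈⟨ fromℤ-+ j (ℤ.- i) ⟩
    fromℤ j + fromℤ (ℤ.- i) ≈⟨ +-congˡ (fromℤ-neg i) ⟩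
    fromℤ j - fromℤ i     ∎)
    where open ≤-Reasoning

  fromℤ-mono-< : ∀ {i j} → i ℤ.< j → fromℤ i < fromℤ j
  fromℤ-mono-< {i} {j} i<j = begin-strict
    fromℤ i               ≈⟨ +-identityˡ _ ⟨
    0# + fromℤ i          <⟨ +-monoˡ-< _ (fromℕ-pos 0) ⟩
    fromℕ 1 + fromℤ i     ≈⟨ fromℤ-+ (+ 1) i ⟨
    fromℤ (ℤ.suc i)       ≤⟨ fromℤ-mono-≤ (ℤ.i<j⇒suc[i]≤j i<j) ⟩
    fromℤ j               ∎
    where open ≤-Reasoning

  fromℤ-cancel-≤ : ∀ {i j} → fromℤ i ≤ fromℤ j → i ℤ.≤ j
  fromℤ-cancel-≤ h = ℤ.≮⇒≥ λ j<i → <⇒≱ (fromℤ-mono-< j<i) h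

  ↧-pos : ∀ q → 0# < fromℕ (↧ₙ q)
  ↧-pos (ℚ.mkℚ _ d _) = fromℕ-pos d

  ↧-*-fromℚ : ∀ q → fromℕ (↧ₙ q) * fromℚ q ≈ fromℤ (↥ q)
  ↧-*-fromℚ q = *⁻¹-cancel _ (↧-pos q)

  private
    -- Clearing both denominators turns a comparison of fractions into the comparison of integers by
    -- which `ℚ._≤_` is defined. Monotonicity of `fromℚ` and its converse then reduce to `fromℤ`.
    cross : ∀ p q → fromℕ (↧ₙ p) * fromℕ (↧ₙ q) * fromℚ p ≈ fromℤ (↥ p ℤ.* ↧ q)
    cross p q = begin-equality
      fromℕ (↧ₙ p) * fromℕ (↧ₙ q) * fromℚ p    ≈⟨ solve 3 (λ a b c → a :* b :* c := (a :* c) :* b) refl _ (fromℕ (↧ₙ q)) (fromℚ p) ⟩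
      fromℕ (↧ₙ p) * fromℚ p * fromℕ (↧ₙ q)    ≈⟨ *-congʳ (↧-*-fromℚ p) ⟩
      fromℤ (↥ p) * fromℕ (↧ₙ q)               ≈⟨ fromℤ-* (↥ p) (↧ q) ⟨
      fromℤ (↥ p ℤ.* ↧ q)                      ∎
      where
      open Solver
      open ≤-Reasoning

    ↧↧-pos : ∀ p q → 0# < fromℕ (↧ₙ p) * fromℕ (↧ₙ q)
    ↧↧-pos p q = *-pos (↧-pos p) (↧-pos q)

    cross′ : ∀ p q → fromℕ (↧ₙ p) * fromℕ (↧ₙ q) * fromℚ q ≈ fromℤ (↥ q ℤ.* ↧ p)
    cross′ p q = trans (*-congʳ (*-comm _ _)) (cross q p)

  fromℚ-mono-≤ : ∀ p q → p ℚ.≤ q → fromℚ p ≤ fromℚ q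
  fromℚ-mono-≤ p q (ℚ.*≤* h) = *-cancelˡ-≤ (↧↧-pos p q)
    (≤-trans (≤-reflexive (cross p q)) (≤-trans (fromℤ-mono-≤ h) (≤-reflexive (sym (cross′ p q)))))

  fromℚ-cancel-≤ : ∀ p q → fromℚ p ≤ fromℚ q → p ℚ.≤ q
  fromℚ-cancel-≤ p q h = ℚ.*≤* (fromℤ-cancel-≤
    (≤-trans (≤-reflexive (sym (cross p q))) (≤-trans (*-monoˡ-≤ (<⇒≤ (↧↧-pos p q)) h) (≤-reflexive (cross′ p q)))))

  -- `ℚ./` stores its result in lowest terms, and the gcd `g` restores the given fraction: `↧ q`
  -- times `g` is n + 1, and `↥ q` times `g` is m.
  *-fromℚ-/ : ∀ m n → fromℕ (suc n) * fromℚ (+ m ℚ./ suc n) ≈ fromℕ m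
  *-fromℚ-/ m n = begin-equality
    fromℕ (suc n) * fromℚ q             ≡⟨ ≡.cong (λ i → fromℤ i * fromℚ q) (ℚ.↧-/ (+ m) (suc n)) ⟨
    fromℤ (↧ q ℤ.* g) * fromℚ q         ≈⟨ *-congʳ (fromℤ-* (↧ q) g) ⟩
    fromℕ (↧ₙ q) * fromℤ g * fromℚ q    ≈⟨ solve 3 (λ a b c → a :* b :* c := (a :* c) :* b) refl _ (fromℤ g) (fromℚ q) ⟩
    fromℕ (↧ₙ q) * fromℚ q * fromℤ g    ≈⟨ *-congʳ (↧-*-fromℚ q) ⟩
    fromℤ (↥ q) * fromℤ g               ≈⟨ fromℤ-* (↥ q) g ⟨
    fromℤ (↥ q ℤ.* g)                   ≡⟨ ≡.cong fromℤ (ℚ.↥-/ (+ m) (suc n)) ⟩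
    fromℕ m                             ∎
    where
    open Solver
    open ≤-Reasoning
    q = + m ℚ./ suc n
    g = ℤ.gcd (+ m) (+ suc n)

  -- An element of a non-Archimedean field may have no integer part; the bound `fromℕ n` provides
  -- one by descent on n. Ties are allowed at both ends.
  floor : ∀ n {x} → 0# ≤ x → x ≤ fromℕ n → ∃ λ m → fromℕ m ≤ x × x ≤ fromℕ (suc m)
  floor zero    0≤x x≤n = 0 , 0≤x , ≤-trans x≤n (fromℕ-nonNeg 1)
  floor (suc n) {x} 0≤x x≤1+n with ≤-total x (fromℕ n)
  ... | inj₁ x≤n = floor n 0≤x x≤n
  ... | inj₂ n≤x = n , n≤x , x≤1+n

-- Maximum principle and finite substochastic linear systems

module FiniteSystems {ℓ : Level} (em : ExcludedMiddle ℓ) (F : OrderedField ℓ) where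
  open OrderedFieldProperties F

  -- The terms of the sum are nonnegative, so a nonpositive sum makes each of them at most 0, and a
  -- positive weight can be cancelled. For weights of sum 1 this is the equality case of averaging:
  -- values at most m with average at least m equal m wherever the weight is positive.
  saturate : {A : Set ℓ} (ys : List A) {w g : A → Carrier} {m : Carrier} →
             (∀ y → y ∈ˡ ys → 0# ≤ w y) → (∀ y → y ∈ˡ ys → 0# < w y → g y ≤ m) →
             ∑ ys (λ y → w y * (m - g y)) ≤ 0# →
             ∀ {y} → y ∈ˡ ys → 0# < w y → m ≤ g y
  saturate ys {w} {g} {m} 0≤w g≤m ∑≤0 {y} y∈ 0<w =
    0≤y-x⇒x≤y (≤-trans (≤-reflexive (sym -0#≈0#)) (≤-trans (neg-mono-≤ m-g≤0)
      (≤-reflexive (solve 2 (λ m g → :- (m :- g) := g :- m) refl m (g y)))))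
    where
    open Solver
    term≥0 : ∀ z → z ∈ˡ ys → 0# ≤ w z * (m - g z)
    term≥0 z z∈ with 0≤w z z∈
    ... | inj₁ 0<wz = *-nonNeg (inj₁ 0<wz) (x≤y⇒0≤y-x (g≤m z z∈ 0<wz))
    ... | inj₂ 0≈wz = ≤-reflexive (sym (trans (*-congʳ (sym 0≈wz)) (zeroˡ _)))
    m-g≤0 : m - g y ≤ 0#
    m-g≤0 = *-cancelˡ-≤ 0<w (≤-trans (∑≤0⇒term≤0 term≥0 ∑≤0 y∈) (≤-reflexive (sym (zeroʳ _))))

  argmax : {A : Set ℓ} (P : Pred A ℓ) (g : A → Carrier) (xs : List A) {x₀ : A} → P x₀ →
           ∃ λ x → P x × g x₀ ≤ g x × (∀ y → y ∈ˡ xs → P y → g y ≤ g x)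
  argmax P g []       {x₀} px₀ = x₀ , px₀ , ≤-refl , λ _ ()
  argmax P g (z ∷ zs) {x₀} px₀ with argmax P g zs px₀
  ... | x , px , x₀≤x , max with em {P z × g x < g z}
  ...   | yes (pz , x<z) = z , pz , ≤-trans x₀≤x (<⇒≤ x<z) , λ where
            _ (here ≡.refl) _  → ≤-refl
            y (there y∈)    py → ≤-trans (max y y∈ py) (<⇒≤ x<z)
  ...   | no ¬larger = x , px , x₀≤x , λ where
            _ (here ≡.refl) pz → ≮⇒≥ λ x<z → ¬larger (pz , x<z)
            y (there y∈)    py → max y y∈ py

  module _ {V : Set ℓ} (nbr : V → List V) (w : V → V → Carrier) (w-nonNeg : ∀ x y → 0# ≤ w x y) where

    PositiveEdge : V → V → Set ℓ
    PositiveEdge x y = y ∈ˡ nbr x × 0# < w x y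

    -- A maximiser above `c` exists because only members of the finite list `xs` can exceed `c`.
    -- `saturate` passes its value along the exit path. As the value never drops, each vertex on the
    -- way still lies above `c`, where subharmonicity is assumed, and the endpoint contradicts
    -- `g z ≤ c`.
    maximum-principle :
      (A : Pred V ℓ) → (∀ {x y} → x ∈ A → PositiveEdge x y → y ∈ A) →
      (g : V → Carrier) (c : Carrier) (xs : List V) →
      (∀ x → x ∈ A → c < g x → x ∈ˡ xs) →
      (∀ x → x ∈ A → c < g x → ∑ (nbr x) (λ y → w x y * (g x - g y)) ≤ 0#) →
      (∀ x → x ∈ A → c < g x → ∃ λ z → g z ≤ c × Star PositiveEdge x z) →
      ∀ x → x ∈ A → g x ≤ c
    maximum-principle A closed g c xs covered subharmonic exit x₀ x₀∈A = ≮⇒≥ impossible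
      where
      impossible : ¬ c < g x₀
      impossible c<gx₀ with argmax (_∈ A) g xs x₀∈A
      ... | x , x∈A , gx₀≤gx , max with exit x x∈A (<-≤-trans c<gx₀ gx₀≤gx)
      ...   | z , gz≤c , path = <⇒≱ c<gx (≤-trans (spread x∈A ≤-refl path) gz≤c)
        where
        c<gx : c < g x
        c<gx = <-≤-trans c<gx₀ gx₀≤gx
        maximal : ∀ y → y ∈ A → g y ≤ g x
        maximal y y∈A with c <? g y
        ... | yes c<gy = max y (covered y y∈A c<gy) y∈A
        ... | no  c≮gy = ≤-trans (≮⇒≥ c≮gy) (<⇒≤ c<gx)
        spread : ∀ {u z} → u ∈ A → g x ≤ g u → Star PositiveEdge u z → g x ≤ g z
        spread         u∈A gx≤gu ε = gx≤gu
        spread {u = u} u∈A gx≤gu (e@(v∈nbr , 0<w) ◅ es) = spread (closed u∈A e)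
          (≤-trans gx≤gu (saturate (nbr u) (λ y _ → w-nonNeg u y)
            (λ y y∈ 0<wy → ≤-trans (maximal y (closed u∈A (y∈ , 0<wy))) gx≤gu)
            (subharmonic u u∈A (<-≤-trans c<gx gx≤gu)) v∈nbr 0<w))
          es

  ∑-─ : {A : Set ℓ} {zs : List A} {y : A} (f : A → Carrier) (y∈ : y ∈ˡ zs) → ∑ zs f ≈ f y + ∑ (zs ─ y∈) f
  ∑-─ f (here ≡.refl)           = refl
  ∑-─ {zs = z ∷ zs} {y} f (there y∈) = trans (+-congˡ (∑-─ f y∈))
    (solve 3 (λ a b c → a :+ (b :+ c) := b :+ (a :+ c)) refl (f z) (f y) (∑ (zs ─ y∈) f))
    where open Solver

  ∈-─ : {A : Set ℓ} {zs : List A} {y z : A} (y∈ : y ∈ˡ zs) → z ∈ˡ zs → y ≢ z → z ∈ˡ (zs ─ y∈)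
  ∈-─ (here ≡.refl) (here ≡.refl) y≢z = contradiction ≡.refl y≢z
  ∈-─ (here ≡.refl) (there z∈)    y≢z = z∈
  ∈-─ (there y∈)    (here ≡.refl) y≢z = here ≡.refl
  ∈-─ (there y∈)    (there z∈)    y≢z = there (∈-─ y∈ z∈ y≢z)

  -- Each nonzero term is matched with an occurrence in `zs`, which is then deleted; uniqueness of
  -- `ys` keeps a later term from claiming the same occurrence. Used in both directions, it
  -- identifies sums over two lists that contain the same support.
  ∑-⊆ : {A : Set ℓ} {ys zs : List A} {f : A → Carrier} → Unique ys → (∀ y → 0# ≤ f y) →
        (∀ y → y ∈ˡ ys → ¬ f y ≈ 0# → y ∈ˡ zs) → ∑ ys f ≤ ∑ zs f
  ∑-⊆ {ys = []} {zs}        []             0≤f support = ∑-nonNeg zs λ y _ → 0≤f y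
  ∑-⊆ {ys = y ∷ ys} {zs} {f} (y≢ys ∷ unique) 0≤f support with f y ≟ 0#
  ... | yes fy≈0 = ≤-trans (+-mono-≤ (≤-reflexive fy≈0) (∑-⊆ unique 0≤f λ z z∈ → support z (there z∈)))
                     (≤-reflexive (+-identityˡ _))
  ... | no  fy≉0 = ≤-trans
    (+-monoʳ-≤ (f y) (∑-⊆ unique 0≤f λ z z∈ fz≉0 →
      ∈-─ y∈zs (support z (there z∈) fz≉0) (All.lookup y≢ys z∈)))
    (≤-reflexive (sym (∑-─ f y∈zs)))
    where
    y∈zs : y ∈ˡ zs
    y∈zs = support y (here ≡.refl) fy≉0

  private
    -- For p < 1 the constant `c` is 1 / (1 - p), so that `c * a` solves x = p x + a. The bound a ≤
    -- 1 - p is what a substochastic row with diagonal entry p leaves for its other entries; for p ≥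
    -- 1 it forces a nonnegative a to be 0.
    pivot : ∀ {p} → 0# ≤ p → ∃ λ c → 0# ≤ c ×
            (∀ a → a ≤ 1# - p → c * a ≤ 1#) ×
            (∀ a → 0# ≤ a → a ≤ 1# - p → c * a ≈ p * (c * a) + a)
    pivot {p} 0≤p with p <? 1#
    ... | yes p<1 = c , <⇒≤ 0<c ,
                    (λ a a≤ → ≤-trans (*-monoˡ-≤ (<⇒≤ 0<c) a≤) (≤-reflexive (*-inverseˡ-pos 0<1-p))) ,
                    λ a _ _ → begin-equality
                      c * a                             ≈⟨ solve 3 (λ p c a → c :* a := p :* (c :* a) :+ ((con (+ 1) :- p) :* c) :* a) refl p c a ⟩
                      p * (c * a) + ((1# - p) * c) * a  ≈⟨ +-congˡ (*-congʳ (*-inverseʳ-pos 0<1-p)) ⟩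
                      p * (c * a) + 1# * a              ≈⟨ +-congˡ (*-identityˡ a) ⟩
                      p * (c * a) + a                   ∎
      where
      open Solver
      open ≤-Reasoning
      0<1-p : 0# < 1# - p
      0<1-p = x<y⇒0<y-x p<1
      c = (1# - p) ⁻¹
      0<c : 0# < c
      0<c = ⁻¹-pos 0<1-p
    ... | no  p≮1 = 0# , ≤-refl ,
                    (λ a _ → ≤-trans (≤-reflexive (zeroˡ a)) 0≤1) ,
                    λ a 0≤a a≤ → begin-equality
                      0# * a               ≈⟨ zeroˡ a ⟩
                      0#                   ≈⟨ ≤-antisym 0≤a (≤-trans a≤ 1-p≤0) ⟩
                      a                    ≈⟨ solve 2 (λ p a → a := p :* (con (+ 0) :* a) :+ a) refl p a ⟩
                      p * (0# * a) + a     ∎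
      where
      open Solver
      open ≤-Reasoning
      1-p≤0 : 1# - p ≤ 0#
      1-p≤0 = ≤-trans (minus-monoʳ-≤ 1# (≮⇒≥ p≮1)) (≤-reflexive (-‿inverseʳ 1#))

    -- The product `c * (∑ Q v + b)` is the value of the eliminated unknown and `s` its coefficient
    -- in the row `P`. With v constantly 1 the identity controls the new row sums; with v the
    -- solution of the smaller system it recovers the old equations.
    substitute : {A : Set ℓ} (xs : List A) (P Q v : A → Carrier) (a b s c : Carrier) →
                 ∑ xs (λ y → (P y + s * (c * Q y)) * v y) + (a + s * (c * b)) ≈
                 s * (c * (∑ xs (λ y → Q y * v y) + b)) + (∑ xs (λ y → P y * v y) + a)
    substitute xs P Q v a b s c = begin-equality
      ∑ xs (λ y → (P y + s * (c * Q y)) * v y) + (a + s * (c * b))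
        ≈⟨ +-congʳ (∑-cong xs λ y _ → solve 5 (λ P s c Q v → (P :+ s :* (c :* Q)) :* v := P :* v :+ (s :* c) :* (Q :* v)) refl (P y) s c (Q y) (v y)) ⟩
      ∑ xs (λ y → P y * v y + (s * c) * (Q y * v y)) + (a + s * (c * b))
        ≈⟨ +-congʳ (trans (∑-+ xs _ _) (+-congˡ (∑-*ˡ xs _ _))) ⟩
      (∑ xs (λ y → P y * v y) + (s * c) * ∑ xs (λ y → Q y * v y)) + (a + s * (c * b))
        ≈⟨ solve 6 (λ p s c q a b → (p :+ (s :* c) :* q) :+ (a :+ s :* (c :* b)) := s :* (c :* (q :+ b)) :+ (p :+ a)) refl (∑ xs (λ y → P y * v y)) s c (∑ xs (λ y → Q y * v y)) a b ⟩
      s * (c * (∑ xs (λ y → Q y * v y) + b)) + (∑ xs (λ y → P y * v y) + a) ∎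
      where
      open Solver
      open ≤-Reasoning

    ∑-*1 : {A : Set ℓ} (xs : List A) (P : A → Carrier) → ∑ xs (λ y → P y * 1#) ≈ ∑ xs P
    ∑-*1 xs P = ∑-cong xs λ y _ → *-identityʳ (P y)

  Solution : {V : Set ℓ} → List V → (V → V → Carrier) → (V → Carrier) → Set ℓ
  Solution {V} xs P r = ∃ λ (v : V → Carrier) → (∀ x → 0# ≤ v x) × (∀ x → v x ≤ 1#) ×
                    (∀ x → x ∈ˡ xs → v x ≈ ∑ xs (λ y → P x y * v y) + r x)

  -- Gaussian elimination.  A row of total weight 1 concentrated on the diagonal
  -- reads v x = v x; it is satisfied by v x = 0 (the second case of pivot).
  solve-substochastic :
    {V : Set ℓ} {xs : List V} → Unique xs →
    (P : V → V → Carrier) (r : V → Carrier) →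
    (∀ x y → 0# ≤ P x y) → (∀ x → 0# ≤ r x) → (∀ x → ∑ xs (P x) + r x ≤ 1#) →
    Solution xs P r
  solve-substochastic []                          P r 0≤P 0≤r rows = (λ _ → 0#) , (λ _ → ≤-refl) , (λ _ → 0≤1) , λ _ ()
  solve-substochastic {V} {o ∷ xs} (o≢xs ∷ unique) P r 0≤P 0≤r rows with pivot (0≤P o o)
  ... | c , 0≤c , c-bound , c-solves = back-substitute (solve-substochastic unique P′ r′
      (λ x y → +-nonNeg (0≤P x y) (*-nonNeg (0≤P x o) (*-nonNeg 0≤c (0≤P o y))))
      (λ x → +-nonNeg (0≤r x) (*-nonNeg (0≤P x o) (*-nonNeg 0≤c (0≤r o))))
      rows′)
    where
    open Solver
    -- `P′` and `r′` describe the chain watched only outside `o`: a visit to `o` is replaced by the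
    -- step that leaves it, and `c` accounts for the repeated loops at `o`.
    P′ : V → V → Carrier
    P′ x y = P x y + P x o * (c * P o y)
    r′ : V → Carrier
    r′ x = r x + P x o * (c * r o)
    row-o : ∑ xs (P o) + r o ≤ 1# - P o o
    row-o = x+y≤z⇒x≤z-y (≤-trans
      (≤-reflexive (solve 3 (λ a b d → (a :+ b) :+ d := (d :+ a) :+ b) refl (∑ xs (P o)) (r o) (P o o))) (rows o))
    rows′ : ∀ x → ∑ xs (P′ x) + r′ x ≤ 1#
    rows′ x = begin
      ∑ xs (P′ x) + r′ x                      ≈⟨ +-congʳ (∑-*1 xs (P′ x)) ⟨
      ∑ xs (λ y → P′ x y * 1#) + r′ x         ≈⟨ substitute xs (P x) (P o) (λ _ → 1#) (r x) (r o) (P x o) c ⟩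
      P x o * (c * (∑ xs (λ y → P o y * 1#) + r o)) + (∑ xs (λ y → P x y * 1#) + r x)
        ≈⟨ +-cong (*-congˡ (*-congˡ (+-congʳ (∑-*1 xs (P o))))) (+-congʳ (∑-*1 xs (P x))) ⟩
      P x o * (c * (∑ xs (P o) + r o)) + (∑ xs (P x) + r x)
        ≤⟨ +-monoˡ-≤ _ (x*y≤x (0≤P x o) (c-bound _ row-o)) ⟩
      P x o + (∑ xs (P x) + r x)              ≈⟨ +-assoc _ _ _ ⟨
      P x o + ∑ xs (P x) + r x                ≤⟨ rows x ⟩
      1#                                      ∎
      where open ≤-Reasoning
    back-substitute : Solution xs P′ r′ → Solution (o ∷ xs) P r
    back-substitute (v′ , 0≤v′ , v′≤1 , v′-solves) = v , 0≤v , v≤1 , v-solves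
      where
      rest : Carrier
      rest = ∑ xs (λ y → P o y * v′ y) + r o
      0≤rest : 0# ≤ rest
      0≤rest = +-nonNeg (∑-nonNeg xs λ y _ → *-nonNeg (0≤P o y) (0≤v′ y)) (0≤r o)
      rest≤ : rest ≤ 1# - P o o
      rest≤ = ≤-trans (+-monoˡ-≤ (r o) (∑-mono xs λ y _ → x*y≤x (0≤P o y) (v′≤1 y))) row-o
      v : V → Carrier
      v x with em {o ≡ x}
      ... | yes _ = c * rest
      ... | no  _ = v′ x
      v-o : v o ≈ c * rest
      v-o with em {o ≡ o}
      ... | yes _   = refl
      ... | no  o≢o = contradiction ≡.refl o≢o
      v-xs : ∀ x → x ∈ˡ xs → v x ≈ v′ x
      v-xs x x∈ with em {o ≡ x}
      ... | yes o≡x = contradiction o≡x (All.lookup o≢xs x∈)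
      ... | no  _   = refl
      0≤v : ∀ x → 0# ≤ v x
      0≤v x with em {o ≡ x}
      ... | yes _ = *-nonNeg 0≤c 0≤rest
      ... | no  _ = 0≤v′ x
      v≤1 : ∀ x → v x ≤ 1#
      v≤1 x with em {o ≡ x}
      ... | yes _ = c-bound rest rest≤
      ... | no  _ = v′≤1 x
      ∑-v : ∀ x → ∑ xs (λ y → P x y * v y) ≈ ∑ xs (λ y → P x y * v′ y)
      ∑-v x = ∑-cong xs λ y y∈ → *-congˡ (v-xs y y∈)
      v-solves : ∀ x → x ∈ˡ o ∷ xs → v x ≈ ∑ (o ∷ xs) (λ y → P x y * v y) + r x
      v-solves x (here ≡.refl) = begin-equality
        v o                                     ≈⟨ v-o ⟩
        c * rest                                ≈⟨ c-solves rest 0≤rest rest≤ ⟩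
        P o o * (c * rest) + rest               ≈⟨ +-assoc _ _ _ ⟨
        P o o * (c * rest) + ∑ xs (λ y → P o y * v′ y) + r o ≈⟨ +-congʳ (+-cong (*-congˡ v-o) (∑-v o)) ⟨
        ∑ (o ∷ xs) (λ y → P o y * v y) + r o    ∎
        where open ≤-Reasoning
      v-solves x (there x∈) = begin-equality
        v x                                     ≈⟨ v-xs x x∈ ⟩
        v′ x                                    ≈⟨ v′-solves x x∈ ⟩
        ∑ xs (λ y → P′ x y * v′ y) + r′ x       ≈⟨ substitute xs (P x) (P o) v′ (r x) (r o) (P x o) c ⟩
        P x o * (c * rest) + (∑ xs (λ y → P x y * v′ y) + r x) ≈⟨ +-assoc _ _ _ ⟨
        P x o * (c * rest) + ∑ xs (λ y → P x y * v′ y) + r x ≈⟨ +-congʳ (+-cong (*-congˡ v-o) (∑-v x)) ⟨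
        ∑ (o ∷ xs) (λ y → P x y * v y) + r x    ∎
        where open ≤-Reasoning

the-satisfies : ∀ {ℓ} (em : ExcludedMiddle ℓ) {A : Set ℓ} (default : A) (P : Pred A ℓ) → ∃ P → P (the em default P)
the-satisfies em default P witness with em {∃ P}
... | yes (_ , px) = px
... | no  ¬∃       = contradiction witness ¬∃

-- The Archimedean property of the reals

module CompleteOrderedFieldProperties {ℓ : Level} (ℝ : CompleteOrderedField ℓ) where
  open CompleteOrderedField ℝ public using (complete)
  open OrderedFieldProperties (CompleteOrderedField.orderedField ℝ) public

  archimedean : ∀ x → ¬ (∀ n → fromℕ n ≤ x)
  archimedean x bounded
    with complete (λ r → ∃ λ n → r ≈ fromℕ n) (0# , 0 , refl) (x , λ _ (n , r≈n) → ≤-trans (≤-reflexive r≈n) (bounded n))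
  ... | s , upper , least = <⇒≱ s-1<s (least (s - 1#) λ _ (n , r≈n) →
          ≤-trans (≤-reflexive r≈n) (x+y≤z⇒x≤z-y (≤-trans (≤-reflexive (+-comm _ _)) (upper _ (suc n , refl)))))
    where
    s-1<s : s - 1# < s
    s-1<s = 0<y-x⇒x<y (<-respʳ (solve 1 (λ s → con (+ 1) := s :- (s :- con (+ 1))) refl s) 0<1)
      where open Solver

  -- If y < x, dividing the hypothesis by x - y bounds all naturals. Estimates of real parts come in
  -- this form, since rounding to a multiple of 1 / (n + 1) costs a fixed number of units.
  archimedean-≤ : ∀ {x y} c → (∀ n → fromℕ (suc n) * x ≤ fromℕ (suc n) * y + c) → x ≤ y
  archimedean-≤ {x} {y} c h = ≮⇒≥ λ y<x → archimedean (c * (x - y) ⁻¹) λ n →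
    let 0<x-y = x<y⇒0<y-x y<x in *-cancelˡ-≤ 0<x-y (begin
      (x - y) * fromℕ n                             ≤⟨ *-monoˡ-≤ (<⇒≤ 0<x-y) (fromℕ-mono (ℕ.n≤1+n n)) ⟩
      (x - y) * fromℕ (suc n)                       ≈⟨ solve 3 (λ x y n → (x :- y) :* n := n :* x :- n :* y) refl x y (fromℕ (suc n)) ⟩
      fromℕ (suc n) * x - fromℕ (suc n) * y         ≤⟨ +-monoˡ-≤ _ (h n) ⟩
      fromℕ (suc n) * y + c - fromℕ (suc n) * y     ≈⟨ solve 2 (λ a c → a :+ c :- a := c) refl (fromℕ (suc n) * y) c ⟩
      c                                             ≈⟨ *⁻¹-cancel c 0<x-y ⟨
      (x - y) * (c * (x - y) ⁻¹)                    ∎)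
    where
    open Solver
    open ≤-Reasoning

-- Arithmetic of the real part

module RealPart {ℓ : Level} (𝕂 : OrderedField ℓ) (ℝ : CompleteOrderedField ℓ) where
  private
    module K = OrderedFieldProperties 𝕂
    module R = CompleteOrderedFieldProperties ℝ

  RationalsBelow : K.Carrier → Pred R.Carrier ℓ
  RationalsBelow k r = ∃ λ q → r R.≈ R.fromℚ q × K.fromℚ q K.≤ k

  -- r is the real part of k ≥ 0, tested against the rationals m / (n + 1).
  record _⇝_ (k : K.Carrier) (r : R.Carrier) : Set ℓ where
    field
      lower : ∀ m n → K.fromℕ m K.≤ K.fromℕ (suc n) K.* k → R.fromℕ m R.≤ R.fromℕ (suc n) R.* r
      upper : ∀ m n → K.fromℕ (suc n) K.* k K.≤ K.fromℕ m → R.fromℕ (suc n) R.* r R.≤ R.fromℕ m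

  open _⇝_ public

  below-bound : ∀ {k} m n → K.fromℕ (suc n) K.* k K.≤ K.fromℕ m →
                ∀ r → r ∈ RationalsBelow k → r R.≤ R.fromℚ (+ m ℚ./ suc n)
  below-bound {k} m n nk≤m r (q , r≈q , q≤k) = R.≤-trans (R.≤-reflexive r≈q)
    (R.fromℚ-mono-≤ q (+ m ℚ./ suc n) (K.fromℚ-cancel-≤ q (+ m ℚ./ suc n) (K.*-cancelˡ-≤ (K.fromℕ-pos n) (begin
      K.fromℕ (suc n) K.* K.fromℚ q                 ≤⟨ K.*-monoˡ-≤ (K.fromℕ-nonNeg (suc n)) q≤k ⟩
      K.fromℕ (suc n) K.* k                         ≤⟨ nk≤m ⟩
      K.fromℕ m                                     ≈⟨ K.*-fromℚ-/ m n ⟨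
      K.fromℕ (suc n) K.* K.fromℚ (+ m ℚ./ suc n)   ∎))))
    where open K.≤-Reasoning

  below-/ : ∀ {k} m n → K.fromℕ m K.≤ K.fromℕ (suc n) K.* k → R.fromℚ (+ m ℚ./ suc n) ∈ RationalsBelow k
  below-/ m n m≤nk = + m ℚ./ suc n , R.refl , K.*-cancelˡ-≤ (K.fromℕ-pos n) (K.≤-trans (K.≤-reflexive (K.*-fromℚ-/ m n)) m≤nk)

  -- A fraction below k belongs to the set whose supremum is r, and a fraction above k bounds that
  -- set.
  sup⇒⇝ : ∀ {k r} → IsSup R._≤_ (RationalsBelow k) r → k ⇝ r
  sup⇒⇝ (above , least) .lower m n m≤nk = R.≤-trans (R.≤-reflexive (R.sym (R.*-fromℚ-/ m n)))
    (R.*-monoˡ-≤ (R.fromℕ-nonNeg (suc n)) (above _ (below-/ m n m≤nk)))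
  sup⇒⇝ (above , least) .upper m n nk≤m = R.≤-trans
    (R.*-monoˡ-≤ (R.fromℕ-nonNeg (suc n)) (least _ (below-bound m n nk≤m))) (R.≤-reflexive (R.*-fromℚ-/ m n))

  private
    1*k : ∀ {k} → K.fromℕ 1 K.* k K.≈ k
    1*k = K.trans (K.*-congʳ (K.+-identityʳ _)) (K.*-identityˡ _)

    1*r : ∀ {r} → R.fromℕ 1 R.* r R.≈ r
    1*r = R.trans (R.*-congʳ (R.+-identityʳ _)) (R.*-identityˡ _)

  -- Transition probabilities, potentials and normalised capacities all lie in this interval, which
  -- guarantees that the supremum defining the real part exists.
  UnitK : Pred K.Carrier ℓ
  UnitK k = K.0# K.≤ k × k K.≤ K.1#

  sup-exists : ∀ {k} → k ∈ UnitK → ∃ (IsSup R._≤_ (RationalsBelow k))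
  sup-exists {k} (0≤k , k≤1) = R.complete (RationalsBelow k)
    (_ , below-/ 0 0 (K.≤-trans 0≤k (K.≤-reflexive (K.sym 1*k))))
    (_ , below-bound 1 0 (K.≤-trans (K.≤-reflexive 1*k) (K.≤-trans k≤1 (K.≤-reflexive (K.sym (K.+-identityʳ _))))))

  ⇝-nonNeg : ∀ {k r} → K.0# K.≤ k → k ⇝ r → R.0# R.≤ r
  ⇝-nonNeg 0≤k k⇝r = R.≤-trans (k⇝r .lower 0 0 (K.≤-trans 0≤k (K.≤-reflexive (K.sym 1*k)))) (R.≤-reflexive 1*r)

  ⇝-≤1 : ∀ {k r} → k K.≤ K.1# → k ⇝ r → r R.≤ R.1#
  ⇝-≤1 k≤1 k⇝r = R.≤-trans (R.≤-reflexive (R.sym 1*r)) (R.≤-trans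
    (k⇝r .upper 1 0 (K.≤-trans (K.≤-reflexive 1*k) (K.≤-trans k≤1 (K.≤-reflexive (K.sym (K.+-identityʳ _))))))
    (R.≤-reflexive (R.+-identityʳ _)))

  ⇝-≥1 : ∀ {k r} → K.1# K.≤ k → k ⇝ r → R.1# R.≤ r
  ⇝-≥1 1≤k k⇝r = R.≤-trans (R.≤-reflexive (R.sym (R.+-identityʳ _))) (R.≤-trans
    (k⇝r .lower 1 0 (K.≤-trans (K.≤-reflexive (K.+-identityʳ _)) (K.≤-trans 1≤k (K.≤-reflexive (K.sym 1*k)))))
    (R.≤-reflexive 1*r))

  ⇝-1 : ∀ {k r} → k K.≈ K.1# → k ⇝ r → r R.≈ R.1#
  ⇝-1 k≈1 k⇝r = R.≤-antisym (⇝-≤1 (K.≤-reflexive k≈1) k⇝r) (⇝-≥1 (K.≤-reflexive (K.sym k≈1)) k⇝r)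

  ⇝-0 : ∀ {k r} → k K.≈ K.0# → k ⇝ r → r R.≈ R.0#
  ⇝-0 k≈0 k⇝r = R.≤-antisym
    (R.≤-trans (R.≤-reflexive (R.sym 1*r)) (k⇝r .upper 0 0 (K.≤-reflexive (K.trans 1*k k≈0))))
    (⇝-nonNeg (K.≤-reflexive (K.sym k≈0)) k⇝r)

  -- Together with `⇝-infinitesimal` this decides when a real part is positive: exactly when some
  -- natural multiple of k reaches 1.
  ⇝-pos : ∀ {k r} n → K.1# K.≤ K.fromℕ (suc n) K.* k → k ⇝ r → R.0# R.< r
  ⇝-pos n 1≤nk k⇝r = R.*-cancelˡ-< (R.fromℕ-pos n) (R.≤-<-trans (R.≤-reflexive (R.zeroʳ _))
    (R.<-≤-trans (R.fromℕ-pos 0) (k⇝r .lower 1 n (K.≤-trans (K.≤-reflexive (K.+-identityʳ _)) 1≤nk))))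

  ⇝-infinitesimal : ∀ {k r} → (∀ n → K.fromℕ (suc n) K.* k K.≤ K.1#) → k ⇝ r → r R.≤ R.0#
  ⇝-infinitesimal nk≤1 k⇝r = R.archimedean-≤ (R.fromℕ 1) λ n → R.≤-trans
    (k⇝r .upper 1 n (K.≤-trans (nk≤1 n) (K.≤-reflexive (K.sym (K.+-identityʳ _)))))
    (R.≤-reflexive (R.sym (R.trans (R.+-congʳ (R.zeroʳ _)) (R.+-identityˡ _))))

  private
    n*k≤n : ∀ {k} n → k K.≤ K.1# → K.fromℕ n K.* k K.≤ K.fromℕ n
    n*k≤n n k≤1 = K.x*y≤x (K.fromℕ-nonNeg n) k≤1

    -- The m is the integer part of (n + 1) k. The same m locates (n + 1) r in ℝ, so k and r are
    -- known with the same error and can be estimated side by side.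
    sandwich : ∀ {k r} → k ∈ UnitK → k ⇝ r → ∀ n → ∃ λ m →
      (K.fromℕ m K.≤ K.fromℕ (suc n) K.* k × K.fromℕ (suc n) K.* k K.≤ K.fromℕ (suc m)) ×
      (R.fromℕ m R.≤ R.fromℕ (suc n) R.* r × R.fromℕ (suc n) R.* r R.≤ R.fromℕ (suc m))
    sandwich {k} (0≤k , k≤1) k⇝r n
      with K.floor (suc n) {K.fromℕ (suc n) K.* k} (K.*-nonNeg (K.fromℕ-nonNeg (suc n)) 0≤k) (n*k≤n (suc n) k≤1)
    ... | m , m≤nk , nk≤1+m = m , (m≤nk , nk≤1+m) , k⇝r .lower m n m≤nk , k⇝r .upper (suc m) n nk≤1+m

  ⇝-mono : ∀ {k l r s} → k ∈ UnitK → k K.≤ l → k ⇝ r → l ⇝ s → r R.≤ s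
  ⇝-mono {k} {l} {r} {s} unit k≤l k⇝r l⇝s = R.archimedean-≤ R.1# λ n →
    let m , (m≤nk , _) , (_ , nr≤1+m) = sandwich unit k⇝r n in begin
      R.fromℕ (suc n) R.* r              ≤⟨ nr≤1+m ⟩
      R.1# R.+ R.fromℕ m                 ≈⟨ R.+-comm _ _ ⟩
      R.fromℕ m R.+ R.1#                 ≤⟨ R.+-monoˡ-≤ R.1# (l⇝s .lower m n
                                              (K.≤-trans m≤nk (K.*-monoˡ-≤ (K.fromℕ-nonNeg (suc n)) k≤l))) ⟩
      R.fromℕ (suc n) R.* s R.+ R.1#     ∎
    where open R.≤-Reasoning

  ⇝-cong : ∀ {k l r s} → k ∈ UnitK → k K.≈ l → k ⇝ r → l ⇝ s → r R.≈ s
  ⇝-cong unit@(0≤k , k≤1) k≈l k⇝r l⇝s = R.≤-antisym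
    (⇝-mono unit (K.≤-reflexive k≈l) k⇝r l⇝s)
    (⇝-mono (K.≤-trans 0≤k (K.≤-reflexive k≈l) , K.≤-trans (K.≤-reflexive (K.sym k≈l)) k≤1) (K.≤-reflexive (K.sym k≈l)) l⇝s k⇝r)

  -- Each of the two integer parts is off by at most 1, hence the error `1# + 1#`, which does not
  -- grow with n.
  ⇝-+ : ∀ {k l r s t} → k ∈ UnitK → l ∈ UnitK → k ⇝ r → l ⇝ s → (k K.+ l) ⇝ t → t R.≈ r R.+ s
  ⇝-+ {k} {l} {r} {s} {t} uk ul k⇝r l⇝s kl⇝t = R.≤-antisym
    (R.archimedean-≤ (R.1# R.+ R.1#) λ n →
      let m , (_ , nk≤1+m) , (m≤nr , _) = sandwich uk k⇝r n
          m′ , (_ , nl≤1+m′) , (m′≤ns , _) = sandwich ul l⇝s n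
      in begin
        R.fromℕ (suc n) R.* t                                ≤⟨ kl⇝t .upper (suc m ℕ.+ suc m′) n (K.≤-trans
                                                                  (K.≤-reflexive (K.distribˡ _ k l)) (K.≤-trans
                                                                  (K.+-mono-≤ nk≤1+m nl≤1+m′)
                                                                  (K.≤-reflexive (K.sym (K.fromℕ-+ (suc m) (suc m′)))))) ⟩
        R.fromℕ (suc m ℕ.+ suc m′)                           ≈⟨ R.fromℕ-+ (suc m) (suc m′) ⟩
        (R.1# R.+ R.fromℕ m) R.+ (R.1# R.+ R.fromℕ m′)       ≈⟨ solve 2 (λ m m′ → (con (+ 1) :+ m) :+ (con (+ 1) :+ m′) := (m :+ m′) :+ (con (+ 1) :+ con (+ 1))) R.refl (R.fromℕ m) (R.fromℕ m′) ⟩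
        R.fromℕ m R.+ R.fromℕ m′ R.+ (R.1# R.+ R.1#)         ≤⟨ R.+-monoˡ-≤ _ (R.+-mono-≤ m≤nr m′≤ns) ⟩
        R.fromℕ (suc n) R.* r R.+ R.fromℕ (suc n) R.* s R.+ (R.1# R.+ R.1#)  ≈⟨ R.+-congʳ (R.distribˡ _ r s) ⟨
        R.fromℕ (suc n) R.* (r R.+ s) R.+ (R.1# R.+ R.1#)    ∎)
    (R.archimedean-≤ (R.1# R.+ R.1#) λ n →
      let m , (m≤nk , _) , (_ , nr≤1+m) = sandwich uk k⇝r n
          m′ , (m′≤nl , _) , (_ , ns≤1+m′) = sandwich ul l⇝s n
      in begin
        R.fromℕ (suc n) R.* (r R.+ s)                        ≈⟨ R.distribˡ _ r s ⟩
        R.fromℕ (suc n) R.* r R.+ R.fromℕ (suc n) R.* s      ≤⟨ R.+-mono-≤ nr≤1+m ns≤1+m′ ⟩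
        (R.1# R.+ R.fromℕ m) R.+ (R.1# R.+ R.fromℕ m′)       ≈⟨ solve 2 (λ m m′ → (con (+ 1) :+ m) :+ (con (+ 1) :+ m′) := (m :+ m′) :+ (con (+ 1) :+ con (+ 1))) R.refl (R.fromℕ m) (R.fromℕ m′) ⟩
        R.fromℕ m R.+ R.fromℕ m′ R.+ (R.1# R.+ R.1#)         ≈⟨ R.+-congʳ (R.fromℕ-+ m m′) ⟨
        R.fromℕ (m ℕ.+ m′) R.+ (R.1# R.+ R.1#)               ≤⟨ R.+-monoˡ-≤ _ (kl⇝t .lower (m ℕ.+ m′) n (K.≤-trans
                                                                  (K.≤-reflexive (K.fromℕ-+ m m′)) (K.≤-trans
                                                                  (K.+-mono-≤ m≤nk m′≤nl)
                                                                  (K.≤-reflexive (K.sym (K.distribˡ _ k l)))))) ⟩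
        R.fromℕ (suc n) R.* t R.+ (R.1# R.+ R.1#)            ∎)
    where
    open R.≤-Reasoning
    open R.Solver

  -- With N = n + 1, m ≤ N k ≤ m + 1 and m′ ≤ N l ≤ m′ + 1, the products m m′ and
  -- (m + 1) (m′ + 1) enclose N² k l and differ by at most 3 N.
  ⇝-* : ∀ {k l r s t} → k ∈ UnitK → l ∈ UnitK → k ⇝ r → l ⇝ s → (k K.* l) ⇝ t → t R.≈ r R.* s
  ⇝-* {k} {l} {r} {s} {t} uk@(0≤k , k≤1) ul@(0≤l , l≤1) k⇝r l⇝s kl⇝t = R.≤-antisym
    (R.archimedean-≤ (R.fromℕ 3) λ n → divide n
      let m , (m≤nk , nk≤1+m) , (m≤nr , _) = sandwich uk k⇝r n
          m′ , (m′≤nl , nl≤1+m′) , (m′≤ns , _) = sandwich ul l⇝s n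
      in begin
        -- The second index is N² - 1: its successor is definitionally `suc n ℕ.* suc n`.
        N² n R.* t                                           ≤⟨ kl⇝t .upper (suc m ℕ.* suc m′) (n ℕ.+ n ℕ.* suc n) (K.≤-trans
                                                                  (K.≤-reflexive (product-K n)) (K.≤-trans
                                                                  (K.*-mono-≤ (K.*-nonNeg (K.fromℕ-nonNeg (suc n)) 0≤l) (K.fromℕ-nonNeg (suc m)) nk≤1+m nl≤1+m′)
                                                                  (K.≤-reflexive (K.sym (K.fromℕ-* (suc m) (suc m′)))))) ⟩
        R.fromℕ (suc m ℕ.* suc m′)                           ≈⟨ R.fromℕ-* (suc m) (suc m′) ⟩
        R.fromℕ (suc m) R.* R.fromℕ (suc m′)                 ≤⟨ gap n m m′ (m≤n n m k≤1 m≤nk) (m≤n n m′ l≤1 m′≤nl) ⟩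
        R.fromℕ m R.* R.fromℕ m′ R.+ 3N n                    ≤⟨ R.+-monoˡ-≤ _ (R.*-mono-≤ (R.fromℕ-nonNeg m′) (R.≤-trans (R.fromℕ-nonNeg m) m≤nr) m≤nr m′≤ns) ⟩
        R.fromℕ (suc n) R.* r R.* (R.fromℕ (suc n) R.* s) R.+ 3N n  ≈⟨ R.+-congʳ (product-R n) ⟨
        N² n R.* (r R.* s) R.+ 3N n                          ∎)
    (R.archimedean-≤ (R.fromℕ 3) λ n → divide n
      let m , (m≤nk , _) , (m≤nr , nr≤1+m) = sandwich uk k⇝r n
          m′ , (m′≤nl , _) , (m′≤ns , ns≤1+m′) = sandwich ul l⇝s n
      in begin
        N² n R.* (r R.* s)                                   ≈⟨ product-R n ⟩
        R.fromℕ (suc n) R.* r R.* (R.fromℕ (suc n) R.* s)    ≤⟨ R.*-mono-≤ (R.≤-trans (R.fromℕ-nonNeg m′) m′≤ns) (R.fromℕ-nonNeg (suc m)) nr≤1+m ns≤1+m′ ⟩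
        R.fromℕ (suc m) R.* R.fromℕ (suc m′)                 ≤⟨ gap n m m′ (m≤n n m k≤1 m≤nk) (m≤n n m′ l≤1 m′≤nl) ⟩
        R.fromℕ m R.* R.fromℕ m′ R.+ 3N n                    ≈⟨ R.+-congʳ (R.fromℕ-* m m′) ⟨
        R.fromℕ (m ℕ.* m′) R.+ 3N n                          ≤⟨ R.+-monoˡ-≤ _ (kl⇝t .lower (m ℕ.* m′) (n ℕ.+ n ℕ.* suc n) (K.≤-trans
                                                                  (K.≤-reflexive (K.fromℕ-* m m′)) (K.≤-trans
                                                                  (K.*-mono-≤ (K.fromℕ-nonNeg m′) (K.*-nonNeg (K.fromℕ-nonNeg (suc n)) 0≤k) m≤nk m′≤nl)
                                                                  (K.≤-reflexive (K.sym (product-K n)))))) ⟩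
        N² n R.* t R.+ 3N n                                  ∎)
    where
    open R.≤-Reasoning
    N² : ℕ → R.Carrier
    N² n = R.fromℕ (suc n ℕ.* suc n)
    3N : ℕ → R.Carrier
    3N n = R.fromℕ (suc n) R.* R.fromℕ 3
    product-K : ∀ n → K.fromℕ (suc n ℕ.* suc n) K.* (k K.* l) K.≈ K.fromℕ (suc n) K.* k K.* (K.fromℕ (suc n) K.* l)
    product-K n = K.trans (K.*-congʳ (K.fromℕ-* (suc n) (suc n)))
      (solve 3 (λ n k l → (n :* n) :* (k :* l) := (n :* k) :* (n :* l)) K.refl (K.fromℕ (suc n)) k l)
      where open K.Solver
    product-R : ∀ n → N² n R.* (r R.* s) R.≈ R.fromℕ (suc n) R.* r R.* (R.fromℕ (suc n) R.* s)
    product-R n = R.trans (R.*-congʳ (R.fromℕ-* (suc n) (suc n)))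
      (solve 3 (λ n k l → (n :* n) :* (k :* l) := (n :* k) :* (n :* l)) R.refl (R.fromℕ (suc n)) r s)
      where open R.Solver
    m≤n : ∀ n m {k} → k K.≤ K.1# → K.fromℕ m K.≤ K.fromℕ (suc n) K.* k → R.fromℕ m R.≤ R.fromℕ (suc n)
    m≤n n m k≤1 m≤nk = R.fromℕ-mono (K.fromℕ-cancel-≤ {m} {suc n} (K.≤-trans m≤nk (n*k≤n (suc n) k≤1)))
    gap : ∀ n m m′ → R.fromℕ m R.≤ R.fromℕ (suc n) → R.fromℕ m′ R.≤ R.fromℕ (suc n) →
          R.fromℕ (suc m) R.* R.fromℕ (suc m′) R.≤ R.fromℕ m R.* R.fromℕ m′ R.+ 3N n
    gap n m m′ m≤n m′≤n = begin
      R.fromℕ (suc m) R.* R.fromℕ (suc m′)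
        ≈⟨ solve 2 (λ m m′ → (con (+ 1) :+ m) :* (con (+ 1) :+ m′) := m :* m′ :+ (m :+ (m′ :+ con (+ 1)))) R.refl (R.fromℕ m) (R.fromℕ m′) ⟩
      R.fromℕ m R.* R.fromℕ m′ R.+ (R.fromℕ m R.+ (R.fromℕ m′ R.+ R.1#))
        ≤⟨ R.+-monoʳ-≤ _ (R.+-mono-≤ m≤n (R.+-mono-≤ m′≤n (R.x≤x+y (R.fromℕ-nonNeg n)))) ⟩
      R.fromℕ m R.* R.fromℕ m′ R.+ (R.fromℕ (suc n) R.+ (R.fromℕ (suc n) R.+ R.fromℕ (suc n)))
        ≈⟨ solve 2 (λ c N → c :+ (N :+ (N :+ N)) := c :+ N :* (con (+ 1) :+ (con (+ 1) :+ (con (+ 1) :+ con (+ 0))))) R.refl (R.fromℕ m R.* R.fromℕ m′) (R.fromℕ (suc n)) ⟩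
      R.fromℕ m R.* R.fromℕ m′ R.+ 3N n ∎
      where open R.Solver
    -- Cancelling one factor N turns the error 3 N into the constant 3 that `archimedean-≤` accepts.
    divide : ∀ n {x y} → N² n R.* x R.≤ N² n R.* y R.+ 3N n → R.fromℕ (suc n) R.* x R.≤ R.fromℕ (suc n) R.* y R.+ R.fromℕ 3
    divide n {x} {y} h = R.*-cancelˡ-≤ (R.fromℕ-pos n) (begin
      R.fromℕ (suc n) R.* (R.fromℕ (suc n) R.* x)      ≈⟨ R.trans (R.*-congʳ (R.fromℕ-* (suc n) (suc n))) (R.*-assoc _ _ x) ⟨
      N² n R.* x                                       ≤⟨ h ⟩
      N² n R.* y R.+ 3N n                              ≈⟨ R.+-congʳ (R.*-congʳ (R.fromℕ-* (suc n) (suc n))) ⟩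
      R.fromℕ (suc n) R.* R.fromℕ (suc n) R.* y R.+ 3N n  ≈⟨ solve 3 (λ N y c → N :* N :* y :+ N :* c := N :* (N :* y :+ c)) R.refl (R.fromℕ (suc n)) y (R.fromℕ 3) ⟩
      R.fromℕ (suc n) R.* (R.fromℕ (suc n) R.* y R.+ R.fromℕ 3) ∎)
      where open R.Solver

-- Bounds on limits of sequences

module Limits {ℓ : Level} (F : OrderedField ℓ) where
  open OrderedFieldProperties F

  limit-≤ : ∀ {s l c} N → s ConvergesTo l → (∀ n → N ℕ.≤ n → s n ≤ c) → l ≤ c
  limit-≤ {s} {l} {c} N conv bound = ≮⇒≥ λ c<l →
    let M , close = conv (l - c) (x<y⇒0<y-x c<l)
        n = N ℕ.⊔ M
    in <⇒≱ (proj₂ (close n (ℕ.m≤n⊔m N M))) (begin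
         s n + (l - c)   ≤⟨ +-monoˡ-≤ _ (bound n (ℕ.m≤m⊔n N M)) ⟩
         c + (l - c)     ≈⟨ solve 2 (λ c l → c :+ (l :- c) := l) refl c l ⟩
         l               ∎)
    where
    open ≤-Reasoning
    open Solver

  limit-≥ : ∀ {s l c} N → s ConvergesTo l → (∀ n → N ℕ.≤ n → c ≤ s n) → c ≤ l
  limit-≥ {s} {l} {c} N conv bound = ≮⇒≥ λ l<c →
    let M , close = conv (c - l) (x<y⇒0<y-x l<c)
        n = N ℕ.⊔ M
    in <⇒≱ (proj₁ (close n (ℕ.m≤n⊔m N M))) (begin
         l + (c - l)     ≈⟨ solve 2 (λ c l → l :+ (c :- l) := c) refl c l ⟩
         c               ≤⟨ bound n (ℕ.m≤m⊔n N M) ⟩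
         s n             ∎)
    where
    open ≤-Reasoning
    open Solver

-- Consequences of countable additivity

module Probability {ℓ : Level} (em : ExcludedMiddle ℓ) (ℝ : CompleteOrderedField ℓ) (S : ProbabilitySpace ℝ) where
  open CompleteOrderedFieldProperties ℝ
  open Limits (CompleteOrderedField.orderedField ℝ)
  open ProbabilitySpace S

  Event : Set (Level.suc ℓ)
  Event = Pred Ω ℓ

  ∅ : Event
  ∅ = ∁ (λ _ → ⊤)

  private
    -- Padding two events with `∅` makes finite additivity an instance of countable additivity, once
    -- `ℙ ∅` is known to vanish.
    sequence : Event → Event → ℕ → Event
    sequence A B zero          = A
    sequence A B (suc zero)    = B
    sequence A B (suc (suc _)) = ∅

  ∅-event : IsEvent ∅
  ∅-event = ∁-event whole

  private
    sequence-event : ∀ {A B} → IsEvent A → IsEvent B → ∀ i → IsEvent (sequence A B i)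
    sequence-event eA eB zero          = eA
    sequence-event eA eB (suc zero)    = eB
    sequence-event eA eB (suc (suc _)) = ∅-event

    sequence-≐ : ∀ A B → ⋃ ℕ (sequence A B) ≐ A ∪ B
    sequence-≐ A B = to , from
      where
      to : ⋃ ℕ (sequence A B) ⊆ A ∪ B
      to (zero , a)            = inj₁ a
      to (suc zero , b)        = inj₂ b
      to (suc (suc _) , false) = ⊥-elim (false _)
      from : A ∪ B ⊆ ⋃ ℕ (sequence A B)
      from (inj₁ a) = 0 , a
      from (inj₂ b) = 1 , b

    sequence-disjoint : ∀ {A B} → A ⊥ B → ∀ i j → i ≢ j → sequence A B i ⊥ sequence A B j
    sequence-disjoint dis zero          zero          i≢j _             = i≢j ≡.refl
    sequence-disjoint dis zero          (suc zero)    i≢j (a , b)       = dis (a , b)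
    sequence-disjoint dis zero          (suc (suc _)) i≢j (_ , false)   = false _
    sequence-disjoint dis (suc zero)    zero          i≢j (b , a)       = dis (a , b)
    sequence-disjoint dis (suc zero)    (suc zero)    i≢j _             = i≢j ≡.refl
    sequence-disjoint dis (suc zero)    (suc (suc _)) i≢j (_ , false)   = false _
    sequence-disjoint dis (suc (suc _)) j             i≢j (false , _)   = false _

  ∪-event : ∀ {A B} → IsEvent A → IsEvent B → IsEvent (A ∪ B)
  ∪-event {A} {B} eA eB = ≐-event (sequence-≐ A B) (⋃-event (sequence-event eA eB))

  ∩-event : ∀ {A B} → IsEvent A → IsEvent B → IsEvent (A ∩ B)
  ∩-event {A} {B} eA eB = ≐-event
    ((λ ¬¬ab → em⇒dne em (λ ¬a → ¬¬ab (inj₁ ¬a)) , em⇒dne em (λ ¬b → ¬¬ab (inj₂ ¬b))) ,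
     λ { (a , b) (inj₁ ¬a) → ¬a a ; (a , b) (inj₂ ¬b) → ¬b b })
    (∁-event (∪-event (∁-event eA) (∁-event eB)))

  -- Countable additivity for the constant sequence `∅` says that the multiples of `ℙ ∅` converge to
  -- `ℙ ∅`, although from the second on they are at least twice as large.
  ℙ-∅ : ℙ ∅ ≈ 0#
  ℙ-∅ = ≤-antisym ℙ∅≤0 (ℙ-nonNeg ∅-event)
    where
    converges : partialSum (λ _ → ℙ ∅) ConvergesTo ℙ (⋃ ℕ λ _ → ∅)
    converges = ℙ-σadditive (λ _ → ∅-event) λ _ _ _ (false , _) → false _
    2ℙ≤ : ∀ n → 2 ℕ.≤ n → ℙ ∅ + ℙ ∅ ≤ partialSum (λ _ → ℙ ∅) n
    2ℙ≤ (suc (suc zero))    _ = +-monoˡ-≤ _ (x≤y+x ≤-refl)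
    2ℙ≤ (suc (suc (suc n))) _ = ≤-trans (2ℙ≤ (suc (suc n)) (ℕ.s≤s (ℕ.s≤s ℕ.z≤n))) (x≤x+y (ℙ-nonNeg ∅-event))
    2ℙ≤ (suc zero) (ℕ.s≤s ())
    ⋃∅≐∅ : ⋃ ℕ (λ _ → ∅) ≐ ∅
    ⋃∅≐∅ = proj₂ , (0 ,_)
    ℙ∅≤0 : ℙ ∅ ≤ 0#
    ℙ∅≤0 = +-cancelˡ-≤ (ℙ ∅) (≤-trans (limit-≥ 2 converges 2ℙ≤) (≤-reflexive
      (trans (ℙ-resp-≐ (⋃-event λ _ → ∅-event) ⋃∅≐∅) (sym (+-identityʳ _)))))

  ℙ-∪ : ∀ {A B} → IsEvent A → IsEvent B → A ⊥ B → ℙ (A ∪ B) ≈ ℙ A + ℙ B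
  ℙ-∪ {A} {B} eA eB dis = trans (sym (ℙ-resp-≐ (⋃-event (sequence-event eA eB)) (sequence-≐ A B)))
    (≤-antisym (limit-≤ 2 converges λ n 2≤n → ≤-reflexive (sums n 2≤n))
               (limit-≥ 2 converges λ n 2≤n → ≤-reflexive (sym (sums n 2≤n))))
    where
    converges : partialSum (λ i → ℙ (sequence A B i)) ConvergesTo ℙ (⋃ ℕ (sequence A B))
    converges = ℙ-σadditive (sequence-event eA eB) (sequence-disjoint dis)
    sums : ∀ n → 2 ℕ.≤ n → partialSum (λ i → ℙ (sequence A B i)) n ≈ ℙ A + ℙ B
    sums (suc (suc zero))    _ = +-congʳ (+-identityˡ _)
    sums (suc (suc (suc n))) _ = trans (+-cong (sums (suc (suc n)) (ℕ.s≤s (ℕ.s≤s ℕ.z≤n))) ℙ-∅) (+-identityʳ _)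
    sums (suc zero) (ℕ.s≤s ())

  ℙ-split : ∀ {A B} → IsEvent A → IsEvent B → ℙ A ≈ ℙ (A ∩ B) + ℙ (A ∩ ∁ B)
  ℙ-split {A} {B} eA eB = trans (ℙ-resp-≐ eA (to , from))
    (ℙ-∪ (∩-event eA eB) (∩-event eA (∁-event eB)) λ ((_ , b) , (_ , ¬b)) → ¬b b)
    where
    to : A ⊆ (A ∩ B) ∪ (A ∩ ∁ B)
    to {ω} a with em {B ω}
    ... | yes b = inj₁ (a , b)
    ... | no ¬b = inj₂ (a , ¬b)
    from : (A ∩ B) ∪ (A ∩ ∁ B) ⊆ A
    from (inj₁ (a , _)) = a
    from (inj₂ (a , _)) = a

  ℙ-split-⊆ : ∀ {A B} → IsEvent A → IsEvent B → A ⊆ B → ℙ B ≈ ℙ A + ℙ (B ∩ ∁ A)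
  ℙ-split-⊆ eA eB A⊆B = trans (ℙ-split eB eA) (+-congʳ (ℙ-resp-≐ (∩-event eB eA) (proj₂ , λ a → A⊆B a , a)))

  ℙ-mono : ∀ {A B} → IsEvent A → IsEvent B → A ⊆ B → ℙ A ≤ ℙ B
  ℙ-mono eA eB A⊆B = ≤-trans (x≤x+y (ℙ-nonNeg (∩-event eB (∁-event eA)))) (≤-reflexive (sym (ℙ-split-⊆ eA eB A⊆B)))

  ℙ-∁ : ∀ {A} → IsEvent A → ℙ A + ℙ (∁ A) ≈ 1#
  ℙ-∁ {A} eA = trans (+-congˡ (ℙ-resp-≐ (∁-event eA) ((λ ¬a → _ , ¬a) , proj₂)))
    (trans (sym (ℙ-split-⊆ eA whole _)) ℙ-whole)

  -- Each event of the list is removed from B before the rest is treated; disjointness keeps the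
  -- remaining events inside what is left.
  ∑ℙ≤ℙ : {A : Set ℓ} {zs : List A} → Unique zs → (E : A → Event) → (∀ z → IsEvent (E z)) →
         (∀ {y z} → y ≢ z → E y ⊥ E z) → ∀ {B} → IsEvent B → (∀ z → E z ⊆ B) →
         ∑ zs (λ z → ℙ (E z)) ≤ ℙ B
  ∑ℙ≤ℙ {zs = zs} unique E eE dis eB E⊆B = go zs unique eB λ z _ → E⊆B z
    where
    go : ∀ zs → Unique zs → ∀ {B} → IsEvent B → (∀ z → z ∈ˡ zs → E z ⊆ B) → ∑ zs (λ z → ℙ (E z)) ≤ ℙ B
    go []       []               eB E⊆B = ℙ-nonNeg eB
    go (z ∷ zs) (z≢zs ∷ unique) eB E⊆B = ≤-trans
      (+-monoʳ-≤ _ (go zs unique (∩-event eB (∁-event (eE z))) λ y y∈ e →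
        E⊆B y (there y∈) e , λ e′ → dis (All.lookup z≢zs y∈) (e′ , e)))
      (≤-reflexive (sym (ℙ-split-⊆ (eE z) eB (E⊆B z (here ≡.refl)))))

  -- The increments `D` are disjoint with the same union, and the first n + 1 of them add up to
  -- `ℙ (E n)`. A common bound therefore passes to the limit.
  ℙ-⋃-increasing : ∀ {E : ℕ → Event} {c} → (∀ n → IsEvent (E n)) → (∀ n → E n ⊆ E (suc n)) →
                   (∀ n → ℙ (E n) ≤ c) → ℙ (⋃ ℕ E) ≤ c
  ℙ-⋃-increasing {E} {c} eE E⊆E bound = ≤-trans
    (≤-reflexive (ℙ-resp-≐ (⋃-event eE) ((λ {ω} (n , e) → first n e) , λ (n , d) → n , D⊆E n d)))
    (limit-≤ 1 (ℙ-σadditive eD disjoint) λ { (suc n) _ → ≤-trans (≤-reflexive (telescope n)) (bound n) })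
    where
    D : ℕ → Event
    D zero    = E 0
    D (suc n) = E (suc n) ∩ ∁ (E n)
    eD : ∀ n → IsEvent (D n)
    eD zero    = eE 0
    eD (suc n) = ∩-event (eE (suc n)) (∁-event (eE n))
    D⊆E : ∀ n → D n ⊆ E n
    D⊆E zero    d = d
    D⊆E (suc n) d = proj₁ d
    E-mono : ∀ {m n} → m ℕ.≤′ n → E m ⊆ E n
    E-mono ℕ.≤′-refl        e = e
    E-mono (ℕ.≤′-step m≤n)  e = E⊆E _ (E-mono m≤n e)
    disjoint-< : ∀ i j → i ℕ.< j → D i ⊥ D j
    disjoint-< i (suc j) (ℕ.s≤s i≤j) (di , (_ , ¬ej)) = ¬ej (E-mono (ℕ.≤⇒≤′ i≤j) (D⊆E i di))
    disjoint : ∀ i j → i ≢ j → D i ⊥ D j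
    disjoint i j i≢j (di , dj) with ℕ.<-cmp i j
    ... | tri< i<j _ _ = disjoint-< i j i<j (di , dj)
    ... | tri≈ _ i≡j _ = i≢j i≡j
    ... | tri> _ _ j<i = disjoint-< j i j<i (dj , di)
    first : ∀ n {ω} → E n ω → ⋃ ℕ D ω
    first zero    e = 0 , e
    first (suc n) {ω} e with em {E n ω}
    ... | yes e′ = first n e′
    ... | no ¬e′ = suc n , e , ¬e′
    telescope : ∀ n → partialSum (λ i → ℙ (D i)) (suc n) ≈ ℙ (E n)
    telescope zero    = +-identityˡ _
    telescope (suc n) = trans (+-congʳ (telescope n)) (sym (ℙ-split-⊆ (eE n) (eE (suc n)) (E⊆E n)))

  -- The complements increase and are null, so their union is null. The intersection is written with
  -- complements and a union because those are the operations under which events are closed by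
  -- definition.
  almost-sure-⋂ : ∀ {E : ℕ → Event} → (∀ n → IsEvent (E n)) → (∀ n → E (suc n) ⊆ E n) →
                  (∀ n → 1# ≤ ℙ (E n)) → ℙ (∁ (⋃ ℕ (λ n → ∁ (E n)))) ≈ 1#
  almost-sure-⋂ {E} eE E⊆E sure = begin-equality
    ℙ (∁ U)            ≈⟨ +-identityˡ _ ⟨
    0# + ℙ (∁ U)       ≈⟨ +-congʳ (≤-antisym (ℙ-nonNeg eU) null) ⟩
    ℙ U + ℙ (∁ U)      ≈⟨ ℙ-∁ eU ⟩
    1#                 ∎
    where
    open ≤-Reasoning
    U = ⋃ ℕ (λ n → ∁ (E n))
    eU : IsEvent U
    eU = ⋃-event λ n → ∁-event (eE n)
    null : ℙ U ≤ 0#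
    null = ℙ-⋃-increasing (λ n → ∁-event (eE n)) (λ n ¬e e → ¬e (E⊆E n e)) λ n →
      +-cancelˡ-≤ 1# (≤-trans (+-monoˡ-≤ _ (sure n)) (≤-reflexive (trans (ℙ-∁ (eE n)) (sym (+-identityʳ 1#)))))

-- Hitting probabilities and equilibrium functions of the real transition matrix

eventually-all : ∀ {a p} {A : Set a} {P : A → ℕ → Set p} (xs : List A) →
                 (∀ x → x ∈ˡ xs → ∃ λ N → ∀ n → N ℕ.≤ n → P x n) →
                 ∃ λ N → ∀ n → N ℕ.≤ n → ∀ x → x ∈ˡ xs → P x n
eventually-all []       h = 0 , λ _ _ _ ()
eventually-all (x ∷ xs) h with h x (here ≡.refl) | eventually-all xs (λ y y∈ → h y (there y∈))
... | N , hx | M , hxs = N ℕ.⊔ M , λ where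
  n le _ (here ≡.refl) → hx n (ℕ.≤-trans (ℕ.m≤m⊔n N M) le)
  n le y (there y∈)    → hxs n (ℕ.≤-trans (ℕ.m≤n⊔m N M) le) y y∈

module Hitting
  {ℓ : Level} (em : ExcludedMiddle ℓ) (ℝ : CompleteOrderedField ℓ) {V : Set ℓ}
  (nbr : V → List V) (π : V → V → CompleteOrderedField.Carrier ℝ)
  (π-nonNeg : ∀ x y → CompleteOrderedField._≤_ ℝ (CompleteOrderedField.0# ℝ) (π x y))
  (∑π : ∀ x → CompleteOrderedField._≈_ ℝ (CompleteOrderedField.∑ ℝ (nbr x) (π x)) (CompleteOrderedField.1# ℝ))
  where

  open CompleteOrderedFieldProperties ℝ
  open FiniteSystems em (CompleteOrderedField.orderedField ℝ) using (PositiveEdge; saturate; maximum-principle)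

  Edge : V → V → Set ℓ
  Edge = PositiveEdge nbr π π-nonNeg

  average : V → (V → Carrier) → Carrier
  average x f = ∑ (nbr x) (λ y → π x y * f y)

  average-mono : ∀ x {f g : V → Carrier} → (∀ y → Edge x y → f y ≤ g y) → average x f ≤ average x g
  average-mono x {f} {g} f≤g = ∑-mono (nbr x) term
    where
    term : ∀ y → y ∈ˡ nbr x → π x y * f y ≤ π x y * g y
    term y y∈ with π-nonNeg x y
    ... | inj₁ 0<π = *-monoˡ-≤ (inj₁ 0<π) (f≤g y (y∈ , 0<π))
    ... | inj₂ 0≈π = ≤-reflexive (trans (trans (*-congʳ (sym 0≈π)) (zeroˡ _)) (sym (trans (*-congʳ (sym 0≈π)) (zeroˡ _))))

  average-const : ∀ x c → average x (λ _ → c) ≈ c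
  average-const x c = trans (∑-*ʳ (nbr x) c (π x)) (trans (*-congʳ (∑π x)) (*-identityˡ c))

  average-deviation : ∀ x c (g : V → Carrier) → ∑ (nbr x) (λ y → π x y * (c - g y)) ≈ c - average x g
  average-deviation x c g = begin-equality
    ∑ (nbr x) (λ y → π x y * (c - g y))          ≈⟨ ∑-cong (nbr x) (λ y _ → solve 3 (λ p c g → p :* (c :- g) := p :* c :- p :* g) refl (π x y) c (g y)) ⟩
    ∑ (nbr x) (λ y → π x y * c - π x y * g y)    ≈⟨ ∑-minus (nbr x) _ _ ⟩
    average x (λ _ → c) - average x g            ≈⟨ +-congʳ (average-const x c) ⟩
    c - average x g                              ∎
    where
    open ≤-Reasoning
    open Solver

  average-minus : ∀ x (f g : V → Carrier) → average x (λ y → f y - g y) ≈ average x f - average x g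
  average-minus x f g = trans
    (∑-cong (nbr x) λ y _ → solve 3 (λ p c g → p :* (c :- g) := p :* c :- p :* g) refl (π x y) (f y) (g y))
    (∑-minus (nbr x) _ _)
    where open Solver

  -- The probability that the chain started at x visits a in its first k steps.
  hit : V → ℕ → V → Carrier
  hit a k x with em {x ≡ a}
  hit a k       x | yes _ = 1#
  hit a zero    x | no  _ = 0#
  hit a (suc k) x | no  _ = average x (hit a k)

  hit-a : ∀ a k → hit a k a ≈ 1#
  hit-a a k with em {a ≡ a}
  ... | yes _   = refl
  ... | no  a≢a = contradiction ≡.refl a≢a

  hit-zero : ∀ {a x} → x ≢ a → hit a 0 x ≈ 0#
  hit-zero {a} {x} x≢a with em {x ≡ a}
  ... | yes x≡a = contradiction x≡a x≢a
  ... | no  _   = refl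

  hit-suc : ∀ {a} k {x} → x ≢ a → hit a (suc k) x ≈ average x (hit a k)
  hit-suc {a} k {x} x≢a with em {x ≡ a}
  ... | yes x≡a = contradiction x≡a x≢a
  ... | no  _   = refl

  hit-≤1 : ∀ a k x → hit a k x ≤ 1#
  hit-≤1 a k x with em {x ≡ a}
  hit-≤1 a k       x | yes _ = ≤-refl
  hit-≤1 a zero    x | no  _ = 0≤1
  hit-≤1 a (suc k) x | no  _ = ≤-trans (average-mono x λ y _ → hit-≤1 a k y) (≤-reflexive (average-const x 1#))

  hit-nonNeg : ∀ a k x → 0# ≤ hit a k x
  hit-nonNeg a k x with em {x ≡ a}
  hit-nonNeg a k       x | yes _ = 0≤1
  hit-nonNeg a zero    x | no  _ = ≤-refl
  hit-nonNeg a (suc k) x | no  _ = ≤-trans (≤-reflexive (sym (average-const x 0#))) (average-mono x λ y _ → hit-nonNeg a k y)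

  hit-increasing : ∀ a k x → hit a k x ≤ hit a (suc k) x
  hit-increasing a k x with em {x ≡ a}
  hit-increasing a k       x | yes _ = ≤-refl
  hit-increasing a zero    x | no  _ =
    ≤-trans (≤-reflexive (sym (average-const x 0#))) (average-mono x λ y _ → hit-nonNeg a 0 y)
  hit-increasing a (suc k) x | no  _ = average-mono x λ y _ → hit-increasing a k y

  hit-mono : ∀ a x {k m} → k ℕ.≤′ m → hit a k x ≤ hit a m x
  hit-mono a x ℕ.≤′-refl       = ≤-refl
  hit-mono a x (ℕ.≤′-step k≤m) = ≤-trans (hit-mono a x k≤m) (hit-increasing a _ x)

  private
    sup : ∀ a x → ∃ (IsSup _≤_ (λ r → ∃ λ k → r ≈ hit a k x))
    sup a x = complete _ (hit a 0 x , 0 , refl) (1# , λ _ (k , r≈) → ≤-trans (≤-reflexive r≈) (hit-≤1 a k x))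

  -- Abstract, as case analyses on em must not reach the instances of em inside hit.
  abstract
    hit∞ : V → V → Carrier
    hit∞ a x = proj₁ (sup a x)

    hit≤hit∞ : ∀ a k x → hit a k x ≤ hit∞ a x
    hit≤hit∞ a k x = proj₁ (proj₂ (sup a x)) _ (k , refl)

    hit∞-least : ∀ a x {u} → (∀ k → hit a k x ≤ u) → hit∞ a x ≤ u
    hit∞-least a x h = proj₂ (proj₂ (sup a x)) _ λ _ (k , r≈) → ≤-trans (≤-reflexive r≈) (h k)

  hit∞-≤1 : ∀ a x → hit∞ a x ≤ 1#
  hit∞-≤1 a x = hit∞-least a x λ k → hit-≤1 a k x

  hit∞-nonNeg : ∀ a x → 0# ≤ hit∞ a x
  hit∞-nonNeg a x = ≤-trans (hit-nonNeg a 0 x) (hit≤hit∞ a 0 x)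

  hit∞-a : ∀ a → 1# ≤ hit∞ a a
  hit∞-a a = ≤-trans (≤-reflexive (sym (hit-a a 0))) (hit≤hit∞ a 0 a)

  -- A positive c can be divided out. For c = 0 both products vanish, and the case k = 0 of the
  -- hypothesis already gives the bound.
  *-hit∞-least : ∀ a x {c d} → 0# ≤ c → (∀ k → c * hit a k x ≤ d) → c * hit∞ a x ≤ d
  *-hit∞-least a x {c} {d} (inj₁ 0<c) h = ≤-trans
    (*-monoˡ-≤ (<⇒≤ 0<c) (hit∞-least a x λ k → *-cancelˡ-≤ 0<c (≤-trans (h k) (≤-reflexive (sym (*⁻¹-cancel d 0<c))))))
    (≤-reflexive (*⁻¹-cancel d 0<c))
  *-hit∞-least a x {c} {d} (inj₂ 0≈c) h = ≤-trans (≤-reflexive (trans (zero* (hit∞ a x)) (sym (zero* (hit a 0 x))))) (h 0)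
    where
    zero* : ∀ y → c * y ≈ 0#
    zero* y = trans (*-congʳ (sym 0≈c)) (zeroˡ y)

  -- Monotone convergence for a finite sum: one neighbour at a time is sent to its supremum. The
  -- horizons j of the head and k of the tail are independent; monotonicity raises both to their
  -- maximum, where the hypothesis applies.
  average-hit∞-least : ∀ a x {d} → (∀ k → average x (hit a k) ≤ d) → average x (hit∞ a) ≤ d
  average-hit∞-least a x h = go (nbr x) h
    where
    go : ∀ ys {d} → (∀ k → ∑ ys (λ y → π x y * hit a k y) ≤ d) → ∑ ys (λ y → π x y * hit∞ a y) ≤ d
    go []       h = h 0
    go (y ∷ ys) {d} h = ≤-trans (≤-reflexive (+-comm _ _)) (x≤z-y⇒x+y≤z (go ys λ k → x+y≤z⇒x≤z-y
      (≤-trans (≤-reflexive (+-comm _ _)) (x≤z-y⇒x+y≤z (*-hit∞-least a y (π-nonNeg x y) λ j → x+y≤z⇒x≤z-y (begin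
        π x y * hit a j y + ∑ ys (λ z → π x z * hit a k z)
          ≤⟨ +-mono-≤ (*-monoˡ-≤ (π-nonNeg x y) (hit-mono a y (ℕ.≤⇒≤′ (ℕ.m≤m⊔n j k))))
                      (∑-mono ys λ z _ → *-monoˡ-≤ (π-nonNeg x z) (hit-mono a z (ℕ.≤⇒≤′ (ℕ.m≤n⊔m j k)))) ⟩
        π x y * hit a (j ℕ.⊔ k) y + ∑ ys (λ z → π x z * hit a (j ℕ.⊔ k) z)
          ≤⟨ h (j ℕ.⊔ k) ⟩
        d ∎))))))
      where open ≤-Reasoning

  -- At a the value 1 dominates every average of probabilities; elsewhere the one-step recursion
  -- passes to the limit. Equality may fail at a, and the defect there is the probability of never
  -- returning.
  hit∞-superharmonic : ∀ a x → average x (hit∞ a) ≤ hit∞ a x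
  hit∞-superharmonic a x with em {x ≡ a}
  ... | yes ≡.refl = ≤-trans (average-mono x λ y _ → hit∞-≤1 a y) (≤-trans (≤-reflexive (average-const x 1#)) (hit∞-a a))
  ... | no  x≢a    = average-hit∞-least a x λ k → ≤-trans (≤-reflexive (sym (hit-suc k x≢a))) (hit≤hit∞ a (suc k) x)

  hit∞-subharmonic : ∀ {a x} → x ≢ a → hit∞ a x ≤ average x (hit∞ a)
  hit∞-subharmonic {a} {x} x≢a = hit∞-least a x λ k → ≤-trans (hit-increasing a k x)
    (≤-trans (≤-reflexive (hit-suc k x≢a)) (average-mono x λ y _ → hit≤hit∞ a k y))

  module Class (C : Pred V ℓ) (closed : ∀ {x y} → x ∈ C → Edge x y → y ∈ C)
               (irreducible : ∀ x y → x ∈ C → y ∈ C → Star Edge x y) where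

    CertainHit : V → Set ℓ
    CertainHit a = ∀ x → x ∈ C → 1# ≤ hit∞ a x

    private
      spread : {P : Pred V ℓ} → (∀ x y → x ∈ C → P x → Edge x y → P y) → ∀ {x y} → x ∈ C → P x → Star Edge x y → P y
      spread step x∈C px ε        = px
      spread step x∈C px (e ◅ es) = spread step (closed x∈C e) (step _ _ x∈C px e) es

    -- Where g attains m, superharmonicity makes the average at most m, while every value reached by
    -- an edge from C is at least m. `saturate`, applied to the negated function, forces equality
    -- along each edge.
    minimum-spreads : ∀ (g : V → Carrier) m → (∀ x → x ∈ C → m ≤ g x) → (∀ x → x ∈ C → average x g ≤ g x) →
                      ∀ {a} → a ∈ C → g a ≤ m → ∀ x → x ∈ C → g x ≤ m
    minimum-spreads g m m≤g superharmonic a∈C ga≤m x x∈C = spread {λ y → g y ≤ m} step a∈C ga≤m (irreducible _ x a∈C x∈C)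
      where
      step : ∀ u v → u ∈ C → g u ≤ m → Edge u v → g v ≤ m
      step u v u∈C gu≤m (v∈ , 0<π) = 0≤y-x⇒x≤y (≤-trans (x≤y⇒0≤y-x -m≤-gv)
        (≤-reflexive (solve 2 (λ m g → (:- g) :- (:- m) := m :- g) refl m (g v))))
        where
        open Solver
        -m≤-gv : - m ≤ - g v
        -m≤-gv = saturate (nbr u) (λ y _ → π-nonNeg u y) (λ y y∈ 0<π → neg-mono-≤ (m≤g y (closed u∈C (y∈ , 0<π)))) (begin
          ∑ (nbr u) (λ y → π u y * (- m - - g y))     ≈⟨ average-deviation u (- m) (λ y → - g y) ⟩
          - m - average u (λ y → - g y)               ≈⟨ +-congˡ (-‿cong (trans (∑-cong (nbr u) λ y _ → sym (-‿distribʳ-* _ _)) (∑-neg (nbr u) _))) ⟩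
          - m - - average u g                         ≈⟨ solve 2 (λ m a → (:- m) :- (:- a) := a :- m) refl m (average u g) ⟩
          average u g - m                             ≤⟨ +-monoˡ-≤ _ (≤-trans (superharmonic u u∈C) gu≤m) ⟩
          m - m                                       ≈⟨ -‿inverseʳ m ⟩
          0#                                          ∎) v∈ 0<π
          where open ≤-Reasoning

    -- By superharmonicity hit∞ c ≥ hit∞ c a · hit∞ a = hit∞ c a, so the minimum
    -- of hit∞ c is attained at a and spreads to c, where hit∞ c is 1.
    certainHit-transfer : ∀ {a c} → a ∈ C → c ∈ C → CertainHit a → CertainHit c
    certainHit-transfer {a} {c} a∈C c∈C certain x x∈C = ≤-trans (hit∞-a c) (≤-trans
      (minimum-spreads g (g a) g-minimal (λ y _ → hit∞-superharmonic c y) a∈C ≤-refl c c∈C) (g-minimal x x∈C))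
      where
      g = hit∞ c
      -- One way to reach `c` is to reach `a` within k steps and continue from there. By induction
      -- on k: off `a` the left side averages exactly, while g is superharmonic.
      below : ∀ k y → y ∈ C → g a * hit a k y ≤ g y
      below k y y∈C with em {y ≡ a}
      below k       y y∈C | yes ≡.refl = ≤-reflexive (*-identityʳ _)
      below zero    y y∈C | no  _      = ≤-trans (≤-reflexive (zeroʳ _)) (hit∞-nonNeg c y)
      below (suc k) y y∈C | no  _      = begin
        g a * average y (hit a k)                      ≈⟨ ∑-*ˡ (nbr y) (g a) _ ⟨
        ∑ (nbr y) (λ z → g a * (π y z * hit a k z))    ≈⟨ ∑-cong (nbr y) (λ z _ → solve 3 (λ g p h → g :* (p :* h) := p :* (g :* h)) refl (g a) (π y z) (hit a k z)) ⟩
        average y (λ z → g a * hit a k z)              ≤⟨ average-mono y (λ z e → below k z (closed y∈C e)) ⟩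
        average y g                                    ≤⟨ hit∞-superharmonic c y ⟩
        g y                                            ∎
        where
        open ≤-Reasoning
        open Solver
      g-minimal : ∀ y → y ∈ C → g a ≤ g y
      g-minimal y y∈C = begin
        g a                  ≈⟨ *-identityʳ _ ⟨
        g a * 1#             ≤⟨ *-monoˡ-≤ (hit∞-nonNeg c a) (certain y y∈C) ⟩
        g a * hit∞ a y       ≤⟨ *-hit∞-least a y (hit∞-nonNeg c a) (λ k → below k y y∈C) ⟩
        g y                  ∎
        where open ≤-Reasoning

    -- The value 1 is the largest that `hit∞ a` can take, so it spreads along edges once the average
    -- is 1. Off a subharmonicity gives this; at a itself the hypothesis does.
    certainReturn⇒certainHit : ∀ {a} → a ∈ C → 1# ≤ average a (hit∞ a) → CertainHit a
    certainReturn⇒certainHit {a} a∈C return x x∈C = spread {λ y → 1# ≤ hit∞ a y} step a∈C (hit∞-a a) (irreducible a x a∈C x∈C)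
      where
      1≤average : ∀ u → 1# ≤ hit∞ a u → 1# ≤ average u (hit∞ a)
      1≤average u 1≤h with em {u ≡ a}
      ... | yes ≡.refl = return
      ... | no  u≢a    = ≤-trans 1≤h (hit∞-subharmonic u≢a)
      step : ∀ u v → u ∈ C → 1# ≤ hit∞ a u → Edge u v → 1# ≤ hit∞ a v
      step u v u∈C 1≤h (v∈ , 0<π) = saturate (nbr u) (λ y _ → π-nonNeg u y) (λ y _ _ → hit∞-≤1 a y)
        (≤-trans (≤-reflexive (average-deviation u 1# (hit∞ a)))
          (≤-trans (minus-monoʳ-≤ 1# (1≤average u 1≤h)) (≤-reflexive (-‿inverseʳ 1#)))) v∈ 0<π

    -- This is what remains of a potential on K after taking real parts. As infinitesimal edges are
    -- lost, parts of K may be cut off from both a and the complement of K, and there these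
    -- conditions need not determine u.
    record IsEquilibrium (K : Pred V ℓ) (a : V) (u : V → Carrier) : Set ℓ where
      field
        nonNeg   : ∀ x → 0# ≤ u x
        base     : u a ≈ 1#
        harmonic : ∀ x → x ∈ K → x ≢ a → u x ≈ average x u
        outside  : ∀ x → x ∉ K → u x ≈ 0#

    open IsEquilibrium

    -- The maximum principle on C at level 0 for the difference u - `hit∞ a`. The difference is
    -- nonpositive at a and outside K, so only vertices of K other than a can exceed 0, and there u
    -- is harmonic. The exit path to a comes from irreducibility and may leave K.
    equilibrium≤hit∞ : ∀ {K a u} → FiniteSubset K → a ∈ C → IsEquilibrium K a u → ∀ x → x ∈ C → u x ≤ hit∞ a x
    equilibrium≤hit∞ {K} {a} {u} (xs , K⊆xs) a∈C eq x x∈C = 0≤y-x⇒x≤y (≤-trans (x≤y⇒0≤y-x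
        (maximum-principle nbr π π-nonNeg C closed g 0# xs covered subharmonic exit x x∈C))
        (≤-reflexive (solve 2 (λ u h → con (+ 0) :- (u :- h) := h :- u) refl (u x) (hit∞ a x))))
      where
      open Solver
      g : V → Carrier
      g y = u y - hit∞ a y
      ga≤0 : g a ≤ 0#
      ga≤0 = ≤-trans (+-mono-≤ (≤-reflexive (eq .base)) (neg-mono-≤ (hit∞-a a))) (≤-reflexive (-‿inverseʳ 1#))
      in-K : ∀ y → 0# < g y → y ∈ K
      in-K y 0<gy = em⇒dne em λ y∉K → <⇒≱ 0<gy (≤-trans
        (+-mono-≤ (≤-reflexive (eq .outside y y∉K)) (neg-mono-≤ (hit∞-nonNeg a y))) (≤-reflexive (-‿inverseʳ 0#)))
      not-a : ∀ y → 0# < g y → y ≢ a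
      not-a y 0<gy ≡.refl = <⇒≱ 0<gy ga≤0
      covered : ∀ y → y ∈ C → 0# < g y → y ∈ˡ xs
      covered y _ 0<gy = K⊆xs y (in-K y 0<gy)
      subharmonic : ∀ y → y ∈ C → 0# < g y → ∑ (nbr y) (λ z → π y z * (g y - g z)) ≤ 0#
      subharmonic y _ 0<gy = begin
        ∑ (nbr y) (λ z → π y z * (g y - g z))        ≈⟨ average-deviation y (g y) g ⟩
        g y - average y g                            ≈⟨ +-congˡ (-‿cong (trans (average-minus y u (hit∞ a)) (+-congʳ (sym (eq .harmonic y (in-K y 0<gy) (not-a y 0<gy)))))) ⟩
        g y - (u y - average y (hit∞ a))             ≈⟨ solve 3 (λ u h m → (u :- h) :- (u :- m) := m :- h) refl (u y) (hit∞ a y) (average y (hit∞ a)) ⟩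
        average y (hit∞ a) - hit∞ a y                ≤⟨ +-monoˡ-≤ _ (hit∞-superharmonic a y) ⟩
        hit∞ a y - hit∞ a y                          ≈⟨ -‿inverseʳ _ ⟩
        0#                                           ∎
        where open ≤-Reasoning
      exit : ∀ y → y ∈ C → 0# < g y → ∃ λ z → g z ≤ 0# × Star Edge y z
      exit y y∈C _ = a , ga≤0 , irreducible y a y∈C a∈C

    module _ {a : V} (K : ℕ → Pred V ℓ) (increasing : ∀ n → K n ⊆ K (suc n)) (covers : ∀ x → ∃ λ n → x ∈ K n)
             (u : ℕ → V → Carrier) (equilibrium : ∀ n → IsEquilibrium (K n) a (u n)) where

      private
        K-mono : ∀ {m n} → m ℕ.≤′ n → K m ⊆ K n
        K-mono ℕ.≤′-refl       x∈ = x∈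
        K-mono (ℕ.≤′-step m≤n) x∈ = increasing _ (K-mono m≤n x∈)

      -- By induction on k: once `K n` contains y, harmonicity reduces the bound at y to the bound
      -- one step shorter at its neighbours. There are finitely many, so a common threshold exists.
      hit≤equilibrium : ∀ k y → ∃ λ N → ∀ n → N ℕ.≤ n → hit a k y ≤ u n y
      hit≤equilibrium k y with em {y ≡ a}
      hit≤equilibrium k       y | yes ≡.refl = 0 , λ n _ → ≤-reflexive (sym (equilibrium n .base))
      hit≤equilibrium zero    y | no  _      = 0 , λ n _ → equilibrium n .nonNeg y
      hit≤equilibrium (suc k) y | no  y≢a
        with covers y | eventually-all (nbr y) (λ z _ → hit≤equilibrium k z)
      ... | N , y∈KN | M , below = N ℕ.⊔ M , λ n le → ≤-trans
        (average-mono y λ z (z∈ , _) → below n (ℕ.≤-trans (ℕ.m≤n⊔m N M) le) z z∈)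
        (≤-reflexive (sym (equilibrium n .harmonic y (K-mono (ℕ.≤⇒≤′ (ℕ.≤-trans (ℕ.m≤m⊔n N M) le)) y∈KN) y≢a)))

      -- For each edge from a some finite horizon already has hitting probability at least 1 - δ,
      -- and u n eventually exceeds it by `hit≤equilibrium`. The finitely many neighbours share one
      -- threshold.
      escape-vanishes : a ∈ C → CertainHit a → ∀ {δ} → 0# < δ → ∃ λ N → ∀ n → N ℕ.≤ n → 1# - average a (u n) ≤ δ
      escape-vanishes a∈C certain {δ} 0<δ with eventually-all (nbr a) near
        where
        1-δ<1 : 1# - δ < 1#
        1-δ<1 = 0<y-x⇒x<y (<-respʳ (solve 1 (λ e → e := con (+ 1) :- (con (+ 1) :- e)) refl δ) 0<δ)
          where open Solver
        near : ∀ y → y ∈ˡ nbr a → ∃ λ N → ∀ n → N ℕ.≤ n → Edge a y → 1# - δ ≤ u n y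
        near y y∈ with em {∃ λ k → 1# - δ ≤ hit a k y}
        ... | yes (k , close) = let N , below = hit≤equilibrium k y in N , λ n le _ → ≤-trans close (below n le)
        -- Without such a k, `hit∞ a y` is at most 1 - δ. This refutes `certain` only for y in C; a
        -- neighbour reached with infinitesimal probability may lie outside C, which is why the
        -- claim is conditional on `Edge a y`.
        ... | no  ¬close      = 0 , λ n _ e → contradiction
          (hit∞-least a y λ k → <⇒≤ (≰⇒> λ close → ¬close (k , close)))
          (<⇒≱ (<-≤-trans 1-δ<1 (certain y (closed a∈C e))))
      ... | N , near = N , λ n le → begin
        1# - average a (u n)                ≤⟨ minus-monoʳ-≤ 1# (average-mono a λ y e → near n le y (proj₁ e) e) ⟩
        1# - average a (λ _ → 1# - δ)       ≈⟨ +-congˡ (-‿cong (average-const a (1# - δ))) ⟩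
        1# - (1# - δ)                       ≈⟨ solve 1 (λ e → con (+ 1) :- (con (+ 1) :- e) := e) refl δ ⟩
        δ                                   ∎
        where
        open ≤-Reasoning
        open Solver

-- Histories and hitting events of the Markov chain

module Recurrence
  {ℓ : Level} (em : ExcludedMiddle ℓ) (ℝ : CompleteOrderedField ℓ) {V : Set ℓ}
  (nbr : V → List V) (unique : ∀ x → Unique (nbr x)) (π : V → V → CompleteOrderedField.Carrier ℝ)
  (π-nonNeg : ∀ x y → CompleteOrderedField._≤_ ℝ (CompleteOrderedField.0# ℝ) (π x y))
  (∑π : ∀ x → CompleteOrderedField._≈_ ℝ (CompleteOrderedField.∑ ℝ (nbr x) (π x)) (CompleteOrderedField.1# ℝ))
  where

  open CompleteOrderedFieldProperties ℝ
  open Hitting em ℝ nbr π π-nonNeg ∑π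

  module _ {o : V} (chain : MarkovChain ℝ π o) where
    open MarkovChain chain
    open Probability em ℝ space

    history-event : ∀ n s → IsEvent (History n s)
    history-event zero s = ≐-event ((λ { x₀ zero _ → x₀ }) , λ h → h 0 ℕ.z≤n) (measurable 0 (s 0))
    history-event (suc n) s = ≐-event (to , from) (∩-event (history-event n s) (measurable (suc n) (s (suc n))))
      where
      to : History n s ∩ (λ ω → X (suc n) ω ≡ s (suc n)) ⊆ History (suc n) s
      to (h , x) i i≤1+n with ℕ.m≤n⇒m<n∨m≡n i≤1+n
      ... | inj₁ (ℕ.s≤s i≤n) = h i i≤n
      ... | inj₂ ≡.refl      = x
      from : History (suc n) s ⊆ History n s ∩ (λ ω → X (suc n) ω ≡ s (suc n))
      from h = (λ i i≤n → h i (ℕ.m≤n⇒m≤1+n i≤n)) , h (suc n) ℕ.≤-refl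

    -- Only the values up to time n + 1 are used; `z` at later times is a filler.
    extend : ℕ → (ℕ → V) → V → ℕ → V
    extend n s z i with i ℕ.≤? n
    ... | yes _ = s i
    ... | no  _ = z

    extend-old : ∀ n s z {i} → i ℕ.≤ n → extend n s z i ≡ s i
    extend-old n s z {i} i≤n with i ℕ.≤? n
    ... | yes _  = ≡.refl
    ... | no i≰n = contradiction i≤n i≰n

    extend-new : ∀ n s z → extend n s z (suc n) ≡ z
    extend-new n s z with suc n ℕ.≤? n
    ... | yes n<n = contradiction n<n (ℕ.<-irrefl ≡.refl)
    ... | no  _   = ≡.refl

    private
      extend⊆ : ∀ n s z → History (suc n) (extend n s z) ⊆ History n s
      extend⊆ n s z h i i≤n = ≡.trans (h i (ℕ.m≤n⇒m≤1+n i≤n)) (extend-old n s z i≤n)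

      extend-disjoint : ∀ n s {y z} → y ≢ z → History (suc n) (extend n s y) ⊥ History (suc n) (extend n s z)
      extend-disjoint n s {y} {z} y≢z (hy , hz) = y≢z (≡.trans (≡.sym (≡.trans (hy (suc n) ℕ.≤-refl) (extend-new n s y)))
        (≡.trans (hz (suc n) ℕ.≤-refl) (extend-new n s z)))

    ℙ-extend : ∀ n s z → ℙ (History (suc n) (extend n s z)) ≈ ℙ (History n s) * π (s n) z
    ℙ-extend n s z = trans (markov n (extend n s z)) (*-cong
      (ℙ-resp-≐ (history-event n _)
        ((λ h i i≤n → ≡.trans (h i i≤n) (extend-old n s z i≤n)) ,
         (λ h i i≤n → ≡.trans (h i i≤n) (≡.sym (extend-old n s z i≤n)))))
      (reflexive (≡.cong₂ π (extend-old n s z ℕ.≤-refl) (extend-new n s z))))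

    ∑ℙ-extend : ∀ n s → ∑ (nbr (s n)) (λ z → ℙ (History (suc n) (extend n s z))) ≈ ℙ (History n s)
    ∑ℙ-extend n s = begin-equality
      ∑ (nbr (s n)) (λ z → ℙ (History (suc n) (extend n s z)))   ≈⟨ ∑-cong (nbr (s n)) (λ z _ → ℙ-extend n s z) ⟩
      ∑ (nbr (s n)) (λ z → ℙ (History n s) * π (s n) z)          ≈⟨ ∑-*ˡ (nbr (s n)) _ _ ⟩
      ℙ (History n s) * ∑ (nbr (s n)) (π (s n))                  ≈⟨ *-congˡ (∑π (s n)) ⟩
      ℙ (History n s) * 1#                                       ≈⟨ *-identityʳ _ ⟩
      ℙ (History n s)                                            ∎
      where open ≤-Reasoning

    -- The inequality ≥ is superadditivity; it holds for E and its complement,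
    -- and the two sum up to equalities.
    ℙ-one-step : ∀ n s {E} → IsEvent E →
                 ℙ (History n s ∩ E) ≈ ∑ (nbr (s n)) (λ z → ℙ (History (suc n) (extend n s z) ∩ E))
    ℙ-one-step n s {E} eE = ≤-antisym
      (+-cancelʳ-≤ (∑ (nbr (s n)) (part (∁ E))) (begin
        ℙ (History n s ∩ E) + ∑ (nbr (s n)) (part (∁ E))     ≤⟨ +-monoʳ-≤ _ (super (∁-event eE)) ⟩
        ℙ (History n s ∩ E) + ℙ (History n s ∩ ∁ E)          ≈⟨ ℙ-split (history-event n s) eE ⟨
        ℙ (History n s)                                      ≈⟨ ∑ℙ-extend n s ⟨
        ∑ (nbr (s n)) (λ z → ℙ (History (suc n) (extend n s z)))
          ≈⟨ ∑-cong (nbr (s n)) (λ z _ → ℙ-split (history-event (suc n) _) eE) ⟩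
        ∑ (nbr (s n)) (λ z → part E z + part (∁ E) z)        ≈⟨ ∑-+ (nbr (s n)) _ _ ⟩
        ∑ (nbr (s n)) (part E) + ∑ (nbr (s n)) (part (∁ E))  ∎))
      (super eE)
      where
      open ≤-Reasoning
      part : Event → V → Carrier
      part E z = ℙ (History (suc n) (extend n s z) ∩ E)
      super : ∀ {E} → IsEvent E → ∑ (nbr (s n)) (part E) ≤ ℙ (History n s ∩ E)
      super {E} eE = ∑ℙ≤ℙ (unique (s n)) (λ z → History (suc n) (extend n s z) ∩ E)
        (λ z → ∩-event (history-event (suc n) _) eE)
        (λ y≢z ((hy , _) , (hz , _)) → extend-disjoint n s y≢z (hy , hz))
        (∩-event (history-event n s) eE)
        (λ z (h , e) → extend⊆ n s z h , e)

    -- The recursion unfolds one step at a time, as that of `hit` does, so that the two can be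
    -- compared by induction on k.
    HitWithin : V → ℕ → ℕ → Event
    HitWithin a n zero    = λ ω → X n ω ≡ a
    HitWithin a n (suc k) = (λ ω → X n ω ≡ a) ∪ HitWithin a (suc n) k

    hitWithin-event : ∀ a n k → IsEvent (HitWithin a n k)
    hitWithin-event a n zero    = measurable n a
    hitWithin-event a n (suc k) = ∪-event (measurable n a) (hitWithin-event a (suc n) k)

    hitWithin-increasing : ∀ a n k → HitWithin a n k ⊆ HitWithin a n (suc k)
    hitWithin-increasing a n zero    x        = inj₁ x
    hitWithin-increasing a n (suc k) (inj₁ x) = inj₁ x
    hitWithin-increasing a n (suc k) (inj₂ x) = inj₂ (hitWithin-increasing a (suc n) k x)

    -- The Markov property at time n for hitting events: decomposing by the state at time n + 1
    -- turns the recursion of `HitWithin` into that of `hit`. The decision of `s n ≡ a` is passed as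
    -- an argument, so that the case analysis does not reach the instances of `em` inside `hit`.
    ℙ-hitWithin : ∀ a k n s → ℙ (History n s ∩ HitWithin a n k) ≈ ℙ (History n s) * hit a k (s n)
    private
      ℙ-hitWithin′ : ∀ a k n s → Dec (s n ≡ a) → ℙ (History n s ∩ HitWithin a n k) ≈ ℙ (History n s) * hit a k (s n)
    ℙ-hitWithin a k n s = ℙ-hitWithin′ a k n s em
    ℙ-hitWithin′ a k n s (yes sn≡a) = trans
      (ℙ-resp-≐ (∩-event (history-event n s) (hitWithin-event a n k)) (proj₁ , λ h → h , hits k h))
      (sym (trans (*-congˡ (trans (reflexive (≡.cong (hit a k) sn≡a)) (hit-a a k))) (*-identityʳ _)))
      where
      hits : ∀ k → History n s ⊆ HitWithin a n k
      hits zero    h = ≡.trans (h n ℕ.≤-refl) sn≡a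
      hits (suc k) h = inj₁ (≡.trans (h n ℕ.≤-refl) sn≡a)
    ℙ-hitWithin′ a zero n s (no sn≢a) = trans
      (trans (ℙ-resp-≐ (∩-event (history-event n s) (measurable n a)) (none , λ false → contradiction _ false)) ℙ-∅)
      (sym (trans (*-congˡ (hit-zero sn≢a)) (zeroʳ _)))
      where
      none : History n s ∩ (λ ω → X n ω ≡ a) ⊆ ∅
      none (h , x) _ = sn≢a (≡.trans (≡.sym (h n ℕ.≤-refl)) x)
    ℙ-hitWithin′ a (suc k) n s (no sn≢a) = begin-equality
      ℙ (History n s ∩ HitWithin a n (suc k))
        ≈⟨ ℙ-resp-≐ (∩-event (history-event n s) (hitWithin-event a n (suc k))) (later , λ (h , e) → h , inj₂ e) ⟩
      ℙ (History n s ∩ HitWithin a (suc n) k)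
        ≈⟨ ℙ-one-step n s (hitWithin-event a (suc n) k) ⟩
      ∑ (nbr (s n)) (λ z → ℙ (History (suc n) (extend n s z) ∩ HitWithin a (suc n) k))
        ≈⟨ ∑-cong (nbr (s n)) (λ z _ → trans (ℙ-hitWithin a k (suc n) (extend n s z)) (trans
             (*-cong (ℙ-extend n s z) (reflexive (≡.cong (hit a k) (extend-new n s z)))) (*-assoc _ _ _))) ⟩
      ∑ (nbr (s n)) (λ z → ℙ (History n s) * (π (s n) z * hit a k z))
        ≈⟨ ∑-*ˡ (nbr (s n)) _ _ ⟩
      ℙ (History n s) * average (s n) (hit a k)
        ≈⟨ *-congˡ (hit-suc k sn≢a) ⟨
      ℙ (History n s) * hit a (suc k) (s n) ∎
      where
      open ≤-Reasoning
      later : History n s ∩ HitWithin a n (suc k) ⊆ History n s ∩ HitWithin a (suc n) k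
      later (h , inj₁ x) = contradiction (≡.trans (≡.sym (h n ℕ.≤-refl)) x) sn≢a
      later (h , inj₂ e) = h , e

    HitFrom : V → ℕ → Event
    HitFrom a n = ⋃ ℕ (HitWithin a n)

    hitFrom-event : ∀ a n → IsEvent (HitFrom a n)
    hitFrom-event a n = ⋃-event (hitWithin-event a n)

    hitFrom-decreasing : ∀ a n → HitFrom a (suc n) ⊆ HitFrom a n
    hitFrom-decreasing a n (k , e) = suc k , inj₂ e

    private
      visit : ∀ a n k {ω} → HitWithin a n k ω → ∃ λ m → n ℕ.≤ m × X m ω ≡ a
      visit a n zero    x        = n , ℕ.≤-refl , x
      visit a n (suc k) (inj₁ x) = n , ℕ.≤-refl , x
      visit a n (suc k) (inj₂ e) with visit a (suc n) k e
      ... | m , n<m , x = m , ℕ.<⇒≤ n<m , x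

      revisit : ∀ a d n {ω} → X (n ℕ.+ d) ω ≡ a → HitFrom a n ω
      revisit a zero    n {ω} x = 0 , ≡.subst (λ i → X i ω ≡ a) (ℕ.+-identityʳ n) x
      revisit a (suc d) n {ω} x = hitFrom-decreasing a n (revisit a d (suc n) (≡.subst (λ i → X i ω ≡ a) (ℕ.+-suc n d) x))

    -- This writes the event with complements and countable unions of hitting events, which makes it
    -- measurable and puts it in the form of `almost-sure-⋂`.
    infinitelyOften-≐ : ∀ a → ∁ (⋃ ℕ (λ n → ∁ (HitFrom a n))) ≐ InfinitelyOften a
    infinitelyOften-≐ a = to , from
      where
      to : ∁ (⋃ ℕ (λ n → ∁ (HitFrom a n))) ⊆ InfinitelyOften a
      to ¬∃ n with em⇒dne em (λ ¬hit → ¬∃ (n , ¬hit))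
      ... | k , e = visit a n k e
      from : InfinitelyOften a ⊆ ∁ (⋃ ℕ (λ n → ∁ (HitFrom a n)))
      from {ω} io (n , ¬hit) with io n
      ... | m , n≤m , x = ¬hit (revisit a (m ℕ.∸ n) n (≡.subst (λ i → X i ω ≡ a) (≡.sym (ℕ.m+[n∸m]≡n n≤m)) x))

    infinitelyOften-event : ∀ a → IsEvent (InfinitelyOften a)
    infinitelyOften-event a = ≐-event (infinitelyOften-≐ a) (∁-event (⋃-event λ n → ∁-event (hitFrom-event a n)))

    ℙ-start : ℙ (History 0 (const o)) ≈ 1#
    ℙ-start = trans (ℙ-resp-≐ (history-event 0 (const o)) ((λ h → h 0 ℕ.z≤n) , λ { x zero _ → x })) initial

    module _ (C : Pred V ℓ) (closed : ∀ {x y} → x ∈ C → Edge x y → y ∈ C)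
             (irreducible : ∀ x y → x ∈ C → y ∈ C → Star Edge x y) where
      open Class C closed irreducible using (CertainHit)

      private
        -- Appending an edge multiplies the probability of a history by a positive factor, so a path
        -- in C is realised by a history of positive probability.
        reachable : ∀ {x y} → Star Edge x y → ∀ n s → s n ≡ x → 0# < ℙ (History n s) →
                    ∃ λ m → ∃ λ t → t m ≡ y × 0# < ℙ (History m t)
        reachable ε                          n s sn≡x 0<ℙ = n , s , sn≡x , 0<ℙ
        reachable (_◅_ {j = z} (_ , 0<π) es) n s ≡.refl 0<ℙ = reachable es (suc n) (extend n s z) (extend-new n s z)
          (<-respʳ (sym (ℙ-extend n s z)) (*-pos 0<ℙ 0<π))

      -- Let H be a history of positive probability ending in x at time n. Recurrence makes a visit
      -- to o at or after time n almost sure, so `ℙ H` equals `ℙ (H ∩ D)`. By the Markov property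
      -- the latter is at most `ℙ H` times `hit∞ o x`, and `ℙ H` cancels.
      recurrent⇒certainHit : o ∈ C → ℙ (InfinitelyOften o) ≈ 1# → CertainHit o
      recurrent⇒certainHit o∈C recurrent x x∈C
        with reachable (irreducible o x o∈C x∈C) 0 (const o) ≡.refl (<-respʳ (sym ℙ-start) 0<1)
      ... | n , s , ≡.refl , 0<ℙ = *-cancelˡ-≤ 0<ℙ (begin
        ℙ H * 1#                                   ≈⟨ *-identityʳ _ ⟩
        ℙ H                                        ≈⟨ ℙ-split eH eD ⟩
        ℙ (H ∩ D) + ℙ (H ∩ ∁ D)                    ≤⟨ +-monoʳ-≤ _ (≤-trans (ℙ-mono (∩-event eH (∁-event eD)) (∁-event eD) proj₂) null) ⟩
        ℙ (H ∩ D) + 0#                             ≈⟨ +-identityʳ _ ⟩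
        ℙ (H ∩ D)                                  ≈⟨ ℙ-resp-≐ (∩-event eH eD) ((λ (h , (k , e)) → k , (h , e)) , λ (k , (h , e)) → h , (k , e)) ⟩
        ℙ (⋃ ℕ (λ k → H ∩ HitWithin o n k))        ≤⟨ ℙ-⋃-increasing (λ k → ∩-event eH (hitWithin-event o n k))
                                                        (λ k (h , e) → h , hitWithin-increasing o n k e) bound ⟩
        ℙ H * hit∞ o (s n)                         ∎)
        where
        open ≤-Reasoning
        H D : Event
        H = History n s
        D = HitFrom o n
        eH = history-event n s
        eD = hitFrom-event o n
        bound : ∀ k → ℙ (H ∩ HitWithin o n k) ≤ ℙ H * hit∞ o (s n)
        bound k = ≤-trans (≤-reflexive (ℙ-hitWithin o k n s)) (*-monoˡ-≤ (<⇒≤ 0<ℙ) (hit≤hit∞ o k (s n)))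
        certain : 1# ≤ ℙ D
        certain = ≤-trans (≤-reflexive (sym recurrent)) (ℙ-mono (infinitelyOften-event o) eD
          λ io → em⇒dne em λ ¬d → proj₂ (infinitelyOften-≐ o) io (n , ¬d))
        null : ℙ (∁ D) ≤ 0#
        null = +-cancelˡ-≤ 1# (≤-trans (+-monoˡ-≤ _ certain) (≤-reflexive (trans (ℙ-∁ eD) (sym (+-identityʳ 1#)))))

      private
        -- Given a history up to n, a visit at or after time n + j is almost sure. For j = 0 this is
        -- certainty of hitting from the current state; otherwise the history is prolonged by one
        -- step within C, which lowers j.
        certainHit⇒hitFrom : CertainHit o → ∀ j n s → s n ∈ C → ℙ (History n s) ≤ ℙ (History n s ∩ HitFrom o (n ℕ.+ j))
        certainHit⇒hitFrom certain zero n s sn∈C rewrite ℕ.+-identityʳ n = begin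
          ℙ (History n s)                          ≈⟨ *-identityʳ _ ⟨
          ℙ (History n s) * 1#                     ≤⟨ *-monoˡ-≤ 0≤ℙ (certain (s n) sn∈C) ⟩
          ℙ (History n s) * hit∞ o (s n)           ≤⟨ *-hit∞-least o (s n) 0≤ℙ (λ k → ≤-trans
                                                        (≤-reflexive (sym (ℙ-hitWithin o k n s)))
                                                        (ℙ-mono (∩-event (history-event n s) (hitWithin-event o n k))
                                                          (∩-event (history-event n s) (hitFrom-event o n)) λ (h , e) → h , (k , e))) ⟩
          ℙ (History n s ∩ HitFrom o n)            ∎
          where
          open ≤-Reasoning
          0≤ℙ = ℙ-nonNeg (history-event n s)
        certainHit⇒hitFrom certain (suc j) n s sn∈C rewrite ℕ.+-suc n j = begin
          ℙ (History n s)                                                       ≈⟨ ∑ℙ-extend n s ⟨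
          ∑ (nbr (s n)) (λ z → ℙ (History (suc n) (extend n s z)))              ≤⟨ ∑-mono (nbr (s n)) next ⟩
          ∑ (nbr (s n)) (λ z → ℙ (History (suc n) (extend n s z) ∩ D))          ≈⟨ ℙ-one-step n s (hitFrom-event o _) ⟨
          ℙ (History n s ∩ D)                                                   ∎
          where
          open ≤-Reasoning
          D : Event
          D = HitFrom o (suc n ℕ.+ j)
          next : ∀ z → z ∈ˡ nbr (s n) → ℙ (History (suc n) (extend n s z)) ≤ ℙ (History (suc n) (extend n s z) ∩ D)
          next z z∈ with π-nonNeg (s n) z
          ... | inj₁ 0<π = certainHit⇒hitFrom certain j (suc n) (extend n s z)
            (≡.subst C (≡.sym (extend-new n s z)) (closed sn∈C (z∈ , 0<π)))
          -- A prolongation of probability 0 may leave C, but it contributes nothing to the sum.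
          ... | inj₂ 0≈π = ≤-trans
            (≤-reflexive (trans (ℙ-extend n s z) (trans (*-congˡ (sym 0≈π)) (zeroʳ _))))
            (ℙ-nonNeg (∩-event (history-event (suc n) _) (hitFrom-event o _)))

      certainHit⇒recurrent : o ∈ C → CertainHit o → ℙ (InfinitelyOften o) ≈ 1#
      certainHit⇒recurrent o∈C certain = trans
        (ℙ-resp-≐ (infinitelyOften-event o) (proj₂ (infinitelyOften-≐ o) , proj₁ (infinitelyOften-≐ o)))
        (almost-sure-⋂ (hitFrom-event o) (hitFrom-decreasing o) λ n → begin
          1#                                            ≈⟨ ℙ-start ⟨
          ℙ (History 0 (const o))                       ≤⟨ certainHit⇒hitFrom certain n 0 (const o) o∈C ⟩
          ℙ (History 0 (const o) ∩ HitFrom o n)         ≤⟨ ℙ-mono (∩-event (history-event 0 _) (hitFrom-event o n)) (hitFrom-event o n) proj₂ ⟩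
          ℙ (HitFrom o n)                               ∎)
        where open ≤-Reasoning

-- Comparability of magnitudes by natural multiples

module Comparison {ℓ : Level} (F : OrderedField ℓ) where
  open OrderedFieldProperties F

  infix 4 _≍_
  -- A form of `≃` free of division and rationals, with one multiplier for both directions. For
  -- positive elements the two relations agree.
  _≍_ : Carrier → Carrier → Set ℓ
  x ≍ y = ∃ λ n → x ≤ fromℕ n * y × y ≤ fromℕ n * x

  ≍-sym : ∀ {x y} → x ≍ y → y ≍ x
  ≍-sym (n , x≤ny , y≤nx) = n , y≤nx , x≤ny

  ≍-trans : ∀ {x y z} → x ≍ y → y ≍ z → x ≍ z
  ≍-trans {x} {y} {z} (m , x≤my , y≤mx) (n , y≤nz , z≤ny) = m ℕ.* n , (begin
      x                          ≤⟨ x≤my ⟩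
      fromℕ m * y                ≤⟨ *-monoˡ-≤ (fromℕ-nonNeg m) y≤nz ⟩
      fromℕ m * (fromℕ n * z)    ≈⟨ *-assoc _ _ _ ⟨
      fromℕ m * fromℕ n * z      ≈⟨ *-congʳ (fromℕ-* m n) ⟨
      fromℕ (m ℕ.* n) * z        ∎) , (begin
      z                          ≤⟨ z≤ny ⟩
      fromℕ n * y                ≤⟨ *-monoˡ-≤ (fromℕ-nonNeg n) y≤mx ⟩
      fromℕ n * (fromℕ m * x)    ≈⟨ solve 3 (λ n m x → n :* (m :* x) := m :* n :* x) refl (fromℕ n) (fromℕ m) x ⟩
      fromℕ m * fromℕ n * x      ≈⟨ *-congʳ (fromℕ-* m n) ⟨
      fromℕ (m ℕ.* n) * x        ∎)
    where
    open ≤-Reasoning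
    open Solver

  private
    fromℚ-0 : fromℚ 0ℚ ≈ 0#
    fromℚ-0 = zeroˡ _

  fromℚ-pos : ∀ q → 0ℚ ℚ.< q → 0# < fromℚ q
  fromℚ-pos q 0<q = ≰⇒> λ q≤0 → ℚ.<-irrefl ≡.refl (ℚ.<-≤-trans 0<q
    (fromℚ-cancel-≤ q 0ℚ (≤-trans q≤0 (≤-reflexive (sym fromℚ-0)))))

  fromℚ-cancel-pos : ∀ q → 0# < fromℚ q → 0ℚ ℚ.< q
  fromℚ-cancel-pos q 0<q = ℚ.≰⇒> λ q≤0 → <⇒≱ 0<q (≤-trans (fromℚ-mono-≤ q 0ℚ q≤0) (≤-reflexive fromℚ-0))

  private
    n≤d*n : ∀ d n → fromℕ n ≤ fromℕ (suc d) * fromℕ n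
    n≤d*n d n = ≤-trans (≤-reflexive (sym (*-identityˡ _))) (*-monoʳ-≤ (fromℕ-nonNeg n) (x≤x+y (fromℕ-nonNeg d)))

  fromℚ-≤-fromℕ : ∀ q → ∃ λ n → fromℚ q ≤ fromℕ n
  fromℚ-≤-fromℕ q@(ℚ.mkℚ (+ n) d _) = n , *-cancelˡ-≤ (↧-pos q) (≤-trans (≤-reflexive (↧-*-fromℚ q)) (n≤d*n d n))
  fromℚ-≤-fromℕ q@(ℚ.mkℚ -[1+ n ] d _) = 0 , *-cancelˡ-≤ (↧-pos q) (≤-trans (≤-reflexive (↧-*-fromℚ q))
    (≤-trans (≤-trans (neg-mono-≤ (fromℕ-nonNeg (suc n))) (≤-reflexive -0#≈0#)) (n≤d*n d 0)))

  1≤n*fromℚ : ∀ q → 0# < fromℚ q → ∃ λ n → 1# ≤ fromℕ n * fromℚ q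
  1≤n*fromℚ q@(ℚ.mkℚ (+ suc n) d _) 0<q = suc d , ≤-trans (x≤x+y (fromℕ-nonNeg n)) (≤-reflexive (sym (↧-*-fromℚ q)))
  1≤n*fromℚ q@(ℚ.mkℚ (+ zero) d _) 0<q = contradiction (≤-reflexive (↧-*-fromℚ q))
    (<⇒≱ (*-pos (↧-pos q) 0<q))
  1≤n*fromℚ q@(ℚ.mkℚ -[1+ n ] d _) 0<q = contradiction
    (≤-trans (≤-reflexive (↧-*-fromℚ q)) (≤-trans (neg-mono-≤ (fromℕ-nonNeg (suc n))) (≤-reflexive -0#≈0#)))
    (<⇒≱ (*-pos (↧-pos q) 0<q))

  unit-fraction : ∀ n → ∃ λ q → fromℕ (suc n) * fromℚ q ≈ 1#
  unit-fraction n = + 1 ℚ./ suc n , trans (*-fromℚ-/ 1 n) (+-identityʳ 1#)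

  fromℕ-rational : ∀ n → ∃ λ q → fromℚ q ≈ fromℕ n
  fromℕ-rational n = + n ℚ./ 1 , trans (sym (trans (*-congʳ (+-identityʳ 1#)) (*-identityˡ _))) (*-fromℚ-/ n 0)

-- The limit superior of reciprocals in the extended reals

module LimitSuperior
  {ℓ : Level} (em : ExcludedMiddle ℓ) (𝕂 : OrderedField ℓ) (ℝ : CompleteOrderedField ℓ)
  {V : Set ℓ} (Γ : WeightedGraph 𝕂 V) (lf : LocallyFinite Γ) where

  open CompleteOrderedFieldProperties ℝ
  open Network em 𝕂 ℝ Γ lf using (ℝ∞; ∞; _≤∞_; _<∞_; reciprocal; limsup)
  open import Relation.Binary.Construct.Add.Supremum.NonStrict _≤_ using ([_]; _≤⊤⁺; [≤]-injective)
  open import Relation.Binary.Construct.Add.Supremum.Strict _<_ using ([_]<⊤⁺)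
  open import Relation.Nullary.Construct.Add.Supremum using (⊤⁺) renaming ([_] to fin)

  private
    ∞≰fin : ∀ {r} → ¬ ∞ ≤∞ fin r
    ∞≰fin ()

    TailSup : (ℕ → ℝ∞) → Pred ℝ∞ ℓ
    TailSup g s = ∃ λ n → IsSup _≤∞_ (λ t → ∃ λ m → n ℕ.≤ m × t ≡ g m) s

  ≢∞⇒<∞ : ∀ {x} → x ≢ ∞ → x <∞ ∞
  ≢∞⇒<∞ {⊤⁺}    x≢∞ = contradiction ≡.refl x≢∞
  ≢∞⇒<∞ {fin r} _   = [ r ]<⊤⁺

  <∞⇒≢∞ : ∀ {x} → x <∞ ∞ → x ≢ ∞
  <∞⇒≢∞ [ r ]<⊤⁺ ()

  reciprocal-≤ : ∀ {x r} → 0# ≤ x → reciprocal x ≤∞ fin r → 0# < r × 1# ≤ r * x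
  reciprocal-≤ {x} 0≤x h with x ≟ 0#
  reciprocal-≤     0≤x () | yes _
  reciprocal-≤ {x} {r} 0≤x [ x⁻¹≤r ] | no x≉0 = <-≤-trans (⁻¹-pos 0<x) x⁻¹≤r ,
    ≤-trans (≤-reflexive (sym (*-inverseˡ-pos 0<x))) (*-monoʳ-≤ (<⇒≤ 0<x) x⁻¹≤r)
    where
    0<x : 0# < x
    0<x = ≤∧≉⇒< 0≤x λ 0≈x → x≉0 (sym 0≈x)

  reciprocal-fin : ∀ {x d} → 0# < d → d ≤ x → ∃ λ r → reciprocal x ≡ fin r × 0# ≤ r × r ≤ d ⁻¹
  reciprocal-fin {x} {d} 0<d d≤x with x ≟ 0#
  ... | yes x≈0 = contradiction x≈0 (<⇒≉ (<-≤-trans 0<d d≤x))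
  ... | no  _   = x ⁻¹ , ≡.refl , <⇒≤ (⁻¹-pos 0<x) , *-cancelˡ-≤ 0<x (begin
    x * x ⁻¹     ≈⟨ *-inverseʳ-pos 0<x ⟩
    1#           ≈⟨ *-inverseʳ-pos 0<d ⟨
    d * d ⁻¹     ≤⟨ *-monoʳ-≤ (<⇒≤ (⁻¹-pos 0<d)) d≤x ⟩
    x * d ⁻¹     ∎)
    where
    open ≤-Reasoning
    0<x : 0# < x
    0<x = <-≤-trans 0<d d≤x

  -- Every tail has supremum `∞`, so a finite infimum is impossible. If the description in `limsup`
  -- found no infimum, its default would be `∞` as well, so existence need not be settled here.
  limsup-∞ : ∀ {e : ℕ → Carrier} → (∀ n → 0# ≤ e n) →
             (∀ {δ} → 0# < δ → ∃ λ N → ∀ n → N ℕ.≤ n → e n ≤ δ) → limsup (λ n → reciprocal (e n)) ≡ ∞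
  limsup-∞ {e} 0≤e e→0 with em {∃ (IsInf _≤∞_ (TailSup (λ n → reciprocal (e n))))}
  ... | no  _                      = ≡.refl
  ... | yes (⊤⁺ , _)               = ≡.refl
  ... | yes (fin x , _ , greatest) = contradiction (greatest ∞ tail) ∞≰fin
    where
    tail : ∀ s → TailSup (λ n → reciprocal (e n)) s → ∞ ≤∞ s
    tail ⊤⁺      _               = ∞ ≤⊤⁺
    -- A finite bound r of the tail forces r · e m ≥ 1 for all m ≥ n; the choice δ = 1 / (r + 1)
    -- makes this product less than 1 for some such m.
    tail (fin r) (n , upper , _) = contradiction
      (proj₂ (reciprocal-≤ (0≤e m) (upper _ (m , ℕ.m≤m⊔n n N , ≡.refl))))
      (<⇒≱ (begin-strict
        r * e m                    ≤⟨ *-monoˡ-≤ (<⇒≤ 0<r) (e-small m (ℕ.m≤n⊔m n N)) ⟩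
        r * (r + 1#) ⁻¹            ≈⟨ *-comm _ _ ⟩
        (r + 1#) ⁻¹ * r            <⟨ *-monoˡ-< (⁻¹-pos 0<r+1) r<r+1 ⟩
        (r + 1#) ⁻¹ * (r + 1#)     ≈⟨ *-inverseˡ-pos 0<r+1 ⟩
        1#                         ∎))
      where
      open ≤-Reasoning
      0<r : 0# < r
      0<r = proj₁ (reciprocal-≤ (0≤e n) (upper _ (n , ℕ.≤-refl , ≡.refl)))
      r<r+1 : r < r + 1#
      r<r+1 = <-respˡ (+-identityʳ r) (+-monoʳ-< r 0<1)
      0<r+1 : 0# < r + 1#
      0<r+1 = <-trans 0<r r<r+1
      N = proj₁ (e→0 (⁻¹-pos 0<r+1))
      e-small = proj₂ (e→0 (⁻¹-pos 0<r+1))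
      m = n ℕ.⊔ N

  -- The default of `limsup` is `∞`, so here an infimum has to be exhibited: the real supremum of
  -- the lower bounds of the tail suprema. These lower bounds include 0 and are bounded by the
  -- finite supremum `s₀` of the whole sequence, which then bounds `limsup` too.
  limsup-≢∞ : ∀ {e : ℕ → Carrier} {d} → 0# < d → (∀ n → d ≤ e n) → limsup (λ n → reciprocal (e n)) ≢ ∞
  limsup-≢∞ {e} {d} 0<d d≤e limsup≡∞ = ∞≰fin (≡.subst (_≤∞ fin s₀) limsup≡∞ (proj₁ limsup-inf (fin s₀) (0 , s₀-sup)))
    where
    g : ℕ → ℝ∞
    g n = reciprocal (e n)
    value : ∀ n → ∃ λ r → g n ≡ fin r × 0# ≤ r × r ≤ d ⁻¹
    value n = reciprocal-fin 0<d (d≤e n)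
    fin-injective : ∀ {r s} → fin r ≡ fin s → r ≡ s
    fin-injective ≡.refl = ≡.refl
    Values : Pred Carrier ℓ
    Values r = ∃ λ m → fin r ≡ g m
    values-bounded : ∀ r → r ∈ Values → r ≤ d ⁻¹
    values-bounded r (m , eq) with value m
    ... | r′ , gm≡r′ , _ , r′≤ = ≤-trans (≤-reflexive (reflexive (fin-injective (≡.trans eq gm≡r′)))) r′≤
    values-sup = complete Values (proj₁ (value 0) , 0 , ≡.sym (proj₁ (proj₂ (value 0)))) (d ⁻¹ , values-bounded)
    s₀ = proj₁ values-sup
    s₀-sup : IsSup _≤∞_ (λ t → ∃ λ m → 0 ℕ.≤ m × t ≡ g m) (fin s₀)
    s₀-sup = above , least
      where
      above : ∀ t → (∃ λ m → 0 ℕ.≤ m × t ≡ g m) → t ≤∞ fin s₀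
      above t (m , _ , t≡) with value m
      ... | r , gm≡r , _ = ≡.subst (_≤∞ fin s₀) (≡.sym (≡.trans t≡ gm≡r)) [ proj₁ (proj₂ values-sup) r (m , ≡.sym gm≡r) ]
      least : ∀ u → (∀ t → (∃ λ m → 0 ℕ.≤ m × t ≡ g m) → t ≤∞ u) → fin s₀ ≤∞ u
      least ⊤⁺      _ = _ ≤⊤⁺
      least (fin r) h = [ proj₂ (proj₂ values-sup) r (λ r′ (m , eq) → [≤]-injective (h (fin r′) (m , ℕ.z≤n , eq))) ]
    Lower : Pred Carrier ℓ
    Lower r = ∀ s → TailSup g s → fin r ≤∞ s
    0-lower : Lower 0#
    0-lower s (n , upper , _) with value n
    ... | r , gn≡r , 0≤r , _ = ≤∞-trans [ 0≤r ] (≡.subst (_≤∞ s) gn≡r (upper (g n) (n , ℕ.≤-refl , ≡.refl)))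
      where
      ≤∞-trans : ∀ {x y z} → x ≤∞ y → y ≤∞ z → x ≤∞ z
      ≤∞-trans [ p ] [ q ]     = [ ≤-trans p q ]
      ≤∞-trans p     (l ≤⊤⁺)   = _ ≤⊤⁺
    lower-sup = complete Lower (0# , 0-lower) (s₀ , λ r lower → [≤]-injective (lower (fin s₀) (0 , s₀-sup)))
    inf-exists : IsInf _≤∞_ (TailSup g) (fin (proj₁ lower-sup))
    inf-exists = below , greatest
      where
      below : ∀ s → TailSup g s → fin (proj₁ lower-sup) ≤∞ s
      below ⊤⁺      _ = _ ≤⊤⁺
      below (fin r) t = [ proj₂ (proj₂ lower-sup) r (λ r′ lower → [≤]-injective (lower (fin r) t)) ]
      greatest : ∀ u → (∀ s → TailSup g s → u ≤∞ s) → u ≤∞ fin (proj₁ lower-sup)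
      greatest ⊤⁺      h = contradiction (h (fin s₀) (0 , s₀-sup)) ∞≰fin
      greatest (fin r) h = [ proj₁ (proj₂ lower-sup) r h ]
    limsup-inf : IsInf _≤∞_ (TailSup g) (limsup g)
    limsup-inf = the-satisfies em ∞ (IsInf _≤∞_ (TailSup g)) (_ , inf-exists)

-- The real transition matrix of the network

module NetworkProperties
  {ℓ : Level} (em : ExcludedMiddle ℓ) (𝕂 : OrderedField ℓ) (ℝ : CompleteOrderedField ℓ)
  {V : Set ℓ} (Γ : WeightedGraph 𝕂 V) (lf : LocallyFinite Γ)
  (twoElements : HasTwoElements V) (connected : Connected Γ) where

  open WeightedGraph Γ
  open Network em 𝕂 ℝ Γ lf
  open RealPart 𝕂 ℝ
  private
    module K = OrderedFieldProperties 𝕂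
    module R = CompleteOrderedFieldProperties ℝ

  neighbours-unique : ∀ x → Unique (neighbours x)
  neighbours-unique x with lf x
  ... | _ , unique , _ = unique

  ∼⇒∈neighbours : ∀ {x y} → x ∼ y → y ∈ˡ neighbours x
  ∼⇒∈neighbours {x} {y} x∼y with lf x
  ... | _ , _ , adjacent = Equivalence.from (adjacent y) x∼y

  ∈neighbours⇒∼ : ∀ {x y} → y ∈ˡ neighbours x → x ∼ y
  ∈neighbours⇒∼ {x} {y} y∈ with lf x
  ... | _ , _ , adjacent = Equivalence.to (adjacent y) y∈

  b≤deg : ∀ x y → b x y K.≤ deg x
  b≤deg x y with nonNegative x y
  ... | inj₁ x∼y = K.term≤∑ {f = b x} (λ z _ → nonNegative x z) (∼⇒∈neighbours x∼y)
  ... | inj₂ 0≈b = K.≤-trans (K.≤-reflexive (K.sym 0≈b)) (K.∑-nonNeg (neighbours x) λ z _ → nonNegative x z)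

  deg-pos : ∀ x → K.0# K.< deg x
  deg-pos x = leave (proj₂ other) (connected x (proj₁ other))
    where
    other : ∃ λ y → x ≢ y
    other with em {x ≡ proj₁ twoElements}
    ... | yes ≡.refl = proj₂ twoElements
    ... | no  x≢y    = _ , x≢y
    leave : ∀ {z} → x ≢ z → Star _∼_ x z → K.0# K.< deg x
    leave x≢x ε                   = contradiction ≡.refl x≢x
    leave _   (_◅_ {j = w} x∼w _) = K.<-≤-trans x∼w (b≤deg x w)

  p-nonNeg : ∀ x y → K.0# K.≤ p x y
  p-nonNeg x y = K.*-nonNeg (nonNegative x y) (K.<⇒≤ (K.⁻¹-pos (deg-pos x)))

  p-pos : ∀ {x y} → x ∼ y → K.0# K.< p x y
  p-pos {x} x∼y = K.*-pos x∼y (K.⁻¹-pos (deg-pos x))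

  deg*p : ∀ x y → deg x K.* p x y K.≈ b x y
  deg*p x y = K.*⁻¹-cancel (b x y) (deg-pos x)

  p≉0⇒∼ : ∀ {x y} → ¬ p x y K.≈ K.0# → x ∼ y
  p≉0⇒∼ {x} {y} p≉0 = K.≤∧≉⇒< (nonNegative x y) λ 0≈b →
    p≉0 (K.trans (K.*-congʳ (K.sym 0≈b)) (K.zeroˡ _))

  ∑p : ∀ x → K.∑ (neighbours x) (p x) K.≈ K.1#
  ∑p x = K.trans (K.∑-*ʳ (neighbours x) _ (b x)) (K.*-inverseʳ-pos (deg-pos x))

  p-≤1 : ∀ x y → p x y K.≤ K.1#
  p-≤1 x y = K.≤-trans (K.*-monoʳ-≤ (K.<⇒≤ (K.⁻¹-pos (deg-pos x))) (b≤deg x y)) (K.≤-reflexive (K.*-inverseʳ-pos (deg-pos x)))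

  p-unit : ∀ x y → UnitK (p x y)
  p-unit x y = p-nonNeg x y , p-≤1 x y

  mean : V → (V → K.Carrier) → K.Carrier
  mean x f = K.∑ (neighbours x) (λ y → p x y K.* f y)

  Δ-mean : ∀ f x → Δ f x K.≈ f x K.- mean x f
  Δ-mean f x = begin-equality
    deg x K.⁻¹ K.* K.∑ (neighbours x) (λ y → b x y K.* (f x K.- f y))
      ≈⟨ K.∑-*ˡ (neighbours x) _ _ ⟨
    K.∑ (neighbours x) (λ y → deg x K.⁻¹ K.* (b x y K.* (f x K.- f y)))
      ≈⟨ K.∑-cong (neighbours x) (λ y _ → solve 4 (λ d b u v → d :* (b :* (u :- v)) := b :* d :* u :- b :* d :* v) K.refl (deg x K.⁻¹) (b x y) (f x) (f y)) ⟩
    K.∑ (neighbours x) (λ y → p x y K.* f x K.- p x y K.* f y)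
      ≈⟨ K.∑-minus (neighbours x) _ _ ⟩
    K.∑ (neighbours x) (λ y → p x y K.* f x) K.- mean x f
      ≈⟨ K.+-congʳ (K.trans (K.∑-*ʳ (neighbours x) (f x) (p x)) (K.trans (K.*-congʳ (∑p x)) (K.*-identityˡ _))) ⟩
    f x K.- mean x f ∎
    where
    open K.≤-Reasoning
    open K.Solver

  ρ-⇝ : ∀ {k} → UnitK k → k ⇝ ρ k
  ρ-⇝ unit = sup⇒⇝ (the-satisfies em R.0# _ (sup-exists unit))

  ρ-cong : ∀ {k l} → UnitK k → UnitK l → k K.≈ l → ρ k R.≈ ρ l
  ρ-cong uk ul k≈l = ⇝-cong uk k≈l (ρ-⇝ uk) (ρ-⇝ ul)

  0-unit : UnitK K.0#
  0-unit = K.≤-refl , K.0≤1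

  1-unit : UnitK K.1#
  1-unit = K.0≤1 , K.≤-refl

  ρ-0 : ρ K.0# R.≈ R.0#
  ρ-0 = ⇝-0 K.refl (ρ-⇝ 0-unit)

  ρ-1 : ρ K.1# R.≈ R.1#
  ρ-1 = ⇝-1 K.refl (ρ-⇝ 1-unit)

  ρ-nonNeg : ∀ {k} → UnitK k → R.0# R.≤ ρ k
  ρ-nonNeg unit = ⇝-nonNeg (proj₁ unit) (ρ-⇝ unit)

  ρ-* : ∀ {k l} → UnitK k → UnitK l → ρ (k K.* l) R.≈ ρ k R.* ρ l
  ρ-* uk@(0≤k , k≤1) ul@(0≤l , l≤1) = ⇝-* uk ul (ρ-⇝ uk) (ρ-⇝ ul)
    (ρ-⇝ (K.*-nonNeg 0≤k 0≤l , K.≤-trans (K.x*y≤x 0≤k l≤1) k≤1))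

  ρ-+ : ∀ {k l} → UnitK k → UnitK l → UnitK (k K.+ l) → ρ (k K.+ l) R.≈ ρ k R.+ ρ l
  ρ-+ uk ul ukl = ⇝-+ uk ul (ρ-⇝ uk) (ρ-⇝ ul) (ρ-⇝ ukl)

  -- `ρ-+` requires all its arguments in the unit interval; partial sums of nonnegative terms with
  -- total at most 1 stay there.
  ρ-∑ : {A : Set ℓ} (xs : List A) {f : A → K.Carrier} → (∀ x → K.0# K.≤ f x) → K.∑ xs f K.≤ K.1# →
        ρ (K.∑ xs f) R.≈ R.∑ xs (λ x → ρ (f x))
  ρ-∑ []       0≤f ∑≤1 = ρ-0
  ρ-∑ (x ∷ xs) {f} 0≤f ∑≤1 = R.trans
    (ρ-+ (0≤f x , K.≤-trans (K.x≤x+y 0≤rest) ∑≤1) (0≤rest , rest≤1) (K.+-nonNeg (0≤f x) 0≤rest , ∑≤1))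
    (R.+-congˡ (ρ-∑ xs 0≤f rest≤1))
    where
    0≤rest : K.0# K.≤ K.∑ xs f
    0≤rest = K.∑-nonNeg xs λ y _ → 0≤f y
    rest≤1 : K.∑ xs f K.≤ K.1#
    rest≤1 = K.≤-trans (K.x≤y+x (0≤f x)) ∑≤1

  π-nonNeg : ∀ x y → R.0# R.≤ π x y
  π-nonNeg x y = ρ-nonNeg (p-unit x y)

  -- A finite neighbourhood lets `ρ` pass through the sum, so no mass is lost to transitions of
  -- infinitesimal probability.
  ∑π : ∀ x → R.∑ (neighbours x) (π x) R.≈ R.1#
  ∑π x = R.trans (R.sym (ρ-∑ (neighbours x) (p-nonNeg x) ∑p≤1))
    (R.trans (ρ-cong (K.∑-nonNeg (neighbours x) (λ y _ → p-nonNeg x y) , ∑p≤1) 1-unit (∑p x)) ρ-1)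
    where
    ∑p≤1 : K.∑ (neighbours x) (p x) K.≤ K.1#
    ∑p≤1 = K.≤-reflexive (∑p x)

  open Hitting em ℝ neighbours π π-nonNeg ∑π public

  mean-unit : ∀ x {f} → (∀ y → UnitK (f y)) → UnitK (mean x f)
  mean-unit x unit = K.∑-nonNeg (neighbours x) (λ y _ → K.*-nonNeg (p-nonNeg x y) (proj₁ (unit y))) ,
    K.≤-trans (K.∑-mono (neighbours x) λ y _ → K.x*y≤x (p-nonNeg x y) (proj₂ (unit y))) (K.≤-reflexive (∑p x))

  -- Additivity and multiplicativity of `ρ` combine here; this is how harmonicity for `p` over 𝕂
  -- becomes harmonicity for `π` over ℝ.
  ρ-mean : ∀ x {f} → (∀ y → UnitK (f y)) → ρ (mean x f) R.≈ average x (λ y → ρ (f y))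
  ρ-mean x unit = R.trans
    (ρ-∑ (neighbours x) (λ y → K.*-nonNeg (p-nonNeg x y) (proj₁ (unit y))) (proj₂ (mean-unit x unit)))
    (R.∑-cong (neighbours x) λ y _ → ρ-* (p-unit x y) (unit y))

-- Essential components as closed irreducible classes of the real chain

module EssentialComponents
  {ℓ : Level} (em : ExcludedMiddle ℓ) (𝕂 : OrderedField ℓ) (ℝ : CompleteOrderedField ℓ)
  {V : Set ℓ} (Γ : WeightedGraph 𝕂 V) (lf : LocallyFinite Γ)
  (twoElements : HasTwoElements V) (connected : Connected Γ) where

  open WeightedGraph Γ
  open Network em 𝕂 ℝ Γ lf
  open NetworkProperties em 𝕂 ℝ Γ lf twoElements connected
  open RealPart 𝕂 ℝ
  open Comparison 𝕂
  private
    module K = OrderedFieldProperties 𝕂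
    module R = CompleteOrderedFieldProperties ℝ

  ≃⇒≍ : ∀ {x y} → K.0# K.< y → x ≃ y → x ≍ y
  ≃⇒≍ {x} {y} 0<y (c₁ , c₂ , 0<c₁ , _ , c₁<x/y , x/y<c₂) =
    bound (1≤n*fromℚ c₁ (fromℚ-pos c₁ 0<c₁)) (fromℚ-≤-fromℕ c₂)
    where
    open K.≤-Reasoning
    open K.Solver
    0≤x : K.0# K.≤ x
    0≤x = K.≤-trans (K.*-nonNeg (K.<⇒≤ 0<y) (K.<⇒≤ (K.<-trans (fromℚ-pos c₁ 0<c₁) c₁<x/y))) (K.≤-reflexive (K.*⁻¹-cancel x 0<y))
    bound : (∃ λ m → K.1# K.≤ K.fromℕ m K.* K.fromℚ c₁) → (∃ λ n → K.fromℚ c₂ K.≤ K.fromℕ n) → x ≍ y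
    bound (m , 1≤mc₁) (n , c₂≤n) = m ℕ.+ n , (begin
      x                            ≈⟨ K.*⁻¹-cancel x 0<y ⟨
      y K.* (x K.* y K.⁻¹)         ≤⟨ K.*-monoˡ-≤ (K.<⇒≤ 0<y) (K.≤-trans (K.<⇒≤ x/y<c₂) c₂≤n) ⟩
      y K.* K.fromℕ n              ≤⟨ K.*-monoˡ-≤ (K.<⇒≤ 0<y) (K.fromℕ-mono (ℕ.m≤n+m n m)) ⟩
      y K.* K.fromℕ (m ℕ.+ n)      ≈⟨ K.*-comm _ _ ⟩
      K.fromℕ (m ℕ.+ n) K.* y      ∎) , (begin
      y                                            ≈⟨ K.*-identityʳ y ⟨
      y K.* K.1#                                   ≤⟨ K.*-monoˡ-≤ (K.<⇒≤ 0<y) 1≤mc₁ ⟩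
      y K.* (K.fromℕ m K.* K.fromℚ c₁)             ≤⟨ K.*-monoˡ-≤ (K.<⇒≤ 0<y) (K.*-monoˡ-≤ (K.fromℕ-nonNeg m) (K.<⇒≤ c₁<x/y)) ⟩
      y K.* (K.fromℕ m K.* (x K.* y K.⁻¹))         ≈⟨ solve 3 (λ y m q → y :* (m :* q) := m :* (y :* q)) K.refl y (K.fromℕ m) (x K.* y K.⁻¹) ⟩
      K.fromℕ m K.* (y K.* (x K.* y K.⁻¹))         ≈⟨ K.*-congˡ (K.*⁻¹-cancel x 0<y) ⟩
      K.fromℕ m K.* x                              ≤⟨ K.*-monoʳ-≤ 0≤x (K.fromℕ-mono (ℕ.m≤m+n m n)) ⟩
      K.fromℕ (m ℕ.+ n) K.* x                      ∎)

  ≍⇒≃ : ∀ {x y} → K.0# K.< x → K.0# K.< y → x ≍ y → x ≃ y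
  ≍⇒≃ {x} {y} 0<x 0<y (n , x≤ny , y≤nx) = between (unit-fraction n) (fromℕ-rational (suc n))
    where
    open K.≤-Reasoning
    n<1+n : K.fromℕ n K.< K.fromℕ (suc n)
    n<1+n = K.<-respˡ (K.+-identityˡ _) (K.+-monoˡ-< _ K.0<1)
    between : (∃ λ q → K.fromℕ (suc n) K.* K.fromℚ q K.≈ K.1#) → (∃ λ q → K.fromℚ q K.≈ K.fromℕ (suc n)) → x ≃ y
    -- The rationals are 1 / (n + 1) and n + 1; passing from n to n + 1 makes the inequalities
    -- strict.
    between (c₁ , nc₁≈1) (c₂ , c₂≈1+n) = c₁ , c₂ ,
        fromℚ-cancel-pos c₁ 0<c₁ , fromℚ-cancel-pos c₂ 0<c₂ , c₁<x/y , x/y<c₂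
      where
      0<c₁ : K.0# K.< K.fromℚ c₁
      0<c₁ = K.*-cancelˡ-< (K.fromℕ-pos n) (K.<-respˡ (K.sym (K.zeroʳ _)) (K.<-respʳ (K.sym nc₁≈1) K.0<1))
      0<c₂ : K.0# K.< K.fromℚ c₂
      0<c₂ = K.<-respʳ (K.sym c₂≈1+n) (K.fromℕ-pos n)
      c₁<x/y : K.fromℚ c₁ K.< x K.* y K.⁻¹
      c₁<x/y = K.*-cancelˡ-< (K.*-pos (K.fromℕ-pos n) 0<y) (begin-strict
        K.fromℕ (suc n) K.* y K.* K.fromℚ c₁     ≈⟨ solve 3 (λ n y c → n :* y :* c := y :* (n :* c)) K.refl (K.fromℕ (suc n)) y (K.fromℚ c₁) ⟩
        y K.* (K.fromℕ (suc n) K.* K.fromℚ c₁)   ≈⟨ K.*-congˡ nc₁≈1 ⟩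
        y K.* K.1#                               ≈⟨ K.*-identityʳ y ⟩
        y                                        ≤⟨ y≤nx ⟩
        K.fromℕ n K.* x                          ≈⟨ K.*-comm _ _ ⟩
        x K.* K.fromℕ n                          <⟨ K.*-monoˡ-< 0<x n<1+n ⟩
        x K.* K.fromℕ (suc n)                    ≈⟨ K.*-comm _ _ ⟩
        K.fromℕ (suc n) K.* x                    ≈⟨ K.*-congˡ (K.*⁻¹-cancel x 0<y) ⟨
        K.fromℕ (suc n) K.* (y K.* (x K.* y K.⁻¹)) ≈⟨ K.*-assoc _ _ _ ⟨
        K.fromℕ (suc n) K.* y K.* (x K.* y K.⁻¹) ∎)
        where open K.Solver
      x/y<c₂ : x K.* y K.⁻¹ K.< K.fromℚ c₂
      x/y<c₂ = K.*-cancelˡ-< 0<y (begin-strict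
        y K.* (x K.* y K.⁻¹)      ≈⟨ K.*⁻¹-cancel x 0<y ⟩
        x                         ≤⟨ x≤ny ⟩
        K.fromℕ n K.* y           ≈⟨ K.*-comm _ _ ⟩
        y K.* K.fromℕ n           <⟨ K.*-monoˡ-< 0<y n<1+n ⟩
        y K.* K.fromℕ (suc n)     ≈⟨ K.*-congˡ c₂≈1+n ⟨
        y K.* K.fromℚ c₂          ∎)

  ≃-sym : ∀ {x y} → K.0# K.< x → K.0# K.< y → x ≃ y → y ≃ x
  ≃-sym 0<x 0<y x≃y = ≍⇒≃ 0<y 0<x (≍-sym (≃⇒≍ 0<y x≃y))

  ≃-trans : ∀ {x y z} → K.0# K.< x → K.0# K.< y → K.0# K.< z → x ≃ y → y ≃ z → x ≃ z
  ≃-trans 0<x 0<y 0<z x≃y y≃z = ≍⇒≃ 0<x 0<z (≍-trans (≃⇒≍ 0<y x≃y) (≃⇒≍ 0<z y≃z))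

  ≃-respˡ : ∀ {x x′ y} → x K.≈ x′ → x ≃ y → x′ ≃ y
  ≃-respˡ x≈x′ (c₁ , c₂ , 0<c₁ , 0<c₂ , lo , hi) =
    c₁ , c₂ , 0<c₁ , 0<c₂ , K.<-respʳ (K.*-congʳ x≈x′) lo , K.<-respˡ (K.*-congʳ x≈x′) hi

  edge⇒∼ : ∀ {x y} → Edge x y → x ∼ y
  edge⇒∼ (y∈ , _) = ∈neighbours⇒∼ y∈

  -- If no natural multiple of `p x y` exceeded 1, its real part would be at most 0. A multiple that
  -- does exceed 1 bounds `deg x` by a multiple of `b x y`. With `≃⇒edge` this translates steps of
  -- positive real probability into the relation used by components.
  edge⇒≃ : ∀ {x y} → Edge x y → b x y ≃ deg x
  edge⇒≃ {x} {y} e@(y∈ , 0<π) = ≍⇒≃ (edge⇒∼ e) (deg-pos x) (suc n ,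
      K.≤-trans (b≤deg x y) (K.≤-trans (K.≤-reflexive (K.sym (K.*-identityˡ _)))
        (K.*-monoʳ-≤ (K.<⇒≤ (deg-pos x)) (K.x≤x+y (K.fromℕ-nonNeg n)))) ,
      (begin
        deg x                                     ≈⟨ K.*-identityʳ _ ⟨
        deg x K.* K.1#                            ≤⟨ K.*-monoˡ-≤ (K.<⇒≤ (deg-pos x)) (K.<⇒≤ (proj₂ finite)) ⟩
        deg x K.* (K.fromℕ (suc n) K.* p x y)     ≈⟨ solve 3 (λ d n p → d :* (n :* p) := n :* (d :* p)) K.refl (deg x) (K.fromℕ (suc n)) (p x y) ⟩
        K.fromℕ (suc n) K.* (deg x K.* p x y)     ≈⟨ K.*-congˡ (deg*p x y) ⟩
        K.fromℕ (suc n) K.* b x y                 ∎))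
    where
    open K.≤-Reasoning
    open K.Solver
    finite : ∃ λ n → K.1# K.< K.fromℕ (suc n) K.* p x y
    finite = em⇒dne em λ ¬finite → R.<⇒≱ 0<π
      (⇝-infinitesimal (λ n → K.≮⇒≥ λ 1<np → ¬finite (n , 1<np)) (ρ-⇝ (p-unit x y)))
    n = proj₁ finite

  ≃⇒edge : ∀ {x y} → x ∼ y → b x y ≃ deg x → Edge x y
  ≃⇒edge {x} {y} x∼y b≃deg = ∼⇒∈neighbours x∼y , positive (≃⇒≍ (deg-pos x) b≃deg)
    where
    open K.≤-Reasoning
    open K.Solver
    positive : b x y ≍ deg x → R.0# R.< π x y
    positive (n , _ , deg≤nb) = ⇝-pos n (K.*-cancelˡ-≤ (deg-pos x) (begin
      deg x K.* K.1#                            ≈⟨ K.*-identityʳ _ ⟩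
      deg x                                     ≤⟨ deg≤nb ⟩
      K.fromℕ n K.* b x y                       ≤⟨ K.*-monoʳ-≤ (nonNegative x y) (K.fromℕ-mono (ℕ.n≤1+n n)) ⟩
      K.fromℕ (suc n) K.* b x y                 ≈⟨ K.*-congˡ (deg*p x y) ⟨
      K.fromℕ (suc n) K.* (deg x K.* p x y)     ≈⟨ solve 3 (λ d n p → d :* (n :* p) := n :* (d :* p)) K.refl (deg x) (K.fromℕ (suc n)) (p x y) ⟨
      deg x K.* (K.fromℕ (suc n) K.* p x y)     ∎)) (ρ-⇝ (p-unit x y))

  private
    Strong : V → V → V → V → Set ℓ
    Strong x y u w = u ∼ w × deg x ≃ b u w × b u w ≃ deg y

  -- A singleton is strongly connected by the trivial path, so maximality excludes the empty set.
  component-nonempty : ∀ {C} → IsStronglyConnectedComponent C → ∃ C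
  component-nonempty {C} (_ , maximal) = em⇒dne em λ ¬∃ → ¬∃ (x ,
    maximal (_≡ x) (λ { _ _ ≡.refl ≡.refl → ε }) (λ {z} z∈C → contradiction (z , z∈C) ¬∃) ≡.refl)
    where
    x : V
    x = proj₁ twoElements

  module _ {C : Pred V ℓ} (component : IsStronglyConnectedComponent C) (essential : IsEssential C) where

    private
      -- The endpoints named in a strong path enter only through their degrees up to `≃`, so they
      -- may be exchanged for vertices of comparable degree.
      reroute : ∀ {x y x′ y′ u v} → deg x′ ≃ deg x → deg y ≃ deg y′ → Star (Strong x y) u v → Star (Strong x′ y′) u v
      reroute x′≃x y≃y′ ε = ε
      reroute {x} {y} {x′} {y′} x′≃x y≃y′ ((u∼w , x≃b , b≃y) ◅ es) = (u∼w ,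
        ≃-trans (deg-pos x′) (deg-pos x) u∼w x′≃x x≃b ,
        ≃-trans u∼w (deg-pos y) (deg-pos y′) b≃y y≃y′) ◅ reroute x′≃x y≃y′ es

      ≃-refl : ∀ x → deg x ≃ deg x
      ≃-refl x = ≍⇒≃ (deg-pos x) (deg-pos x) (1 , le , le)
        where
        le : deg x K.≤ K.fromℕ 1 K.* deg x
        le = K.≤-reflexive (K.sym (K.trans (K.*-congʳ (K.+-identityʳ _)) (K.*-identityˡ _)))

    edge-deg : ∀ {x y} → x ∈ C → Edge x y → deg x ≃ deg y
    edge-deg {x} {y} x∈C e = essential x y x∈C ((edge⇒∼ e , edge⇒≃ e) ◅ ε)

    -- Adjoining y to C keeps it strongly connected, so maximality puts y into C. Essentiality makes
    -- deg y comparable with deg x; as b is symmetric, the edge can then also be used backwards, and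
    -- every path to or from y goes through x.
    component-closed : ∀ {x y} → x ∈ C → Edge x y → y ∈ C
    component-closed {x} {y} x∈C e = proj₂ component D strong inj₁ (inj₂ ≡.refl)
      where
      D : Pred V ℓ
      D z = z ∈ C ⊎ z ≡ y
      x∼y = edge⇒∼ e
      x≃y = edge-deg x∈C e
      b≃x = edge⇒≃ e
      y≃x = ≃-sym (deg-pos x) (deg-pos y) x≃y
      x≃b = ≃-sym x∼y (deg-pos x) b≃x
      b≃y = ≃-trans x∼y (deg-pos x) (deg-pos y) b≃x x≃y
      y∼x : y ∼ x
      y∼x = K.<-respʳ (symmetric x y) x∼y
      append : ∀ {z u} → deg z ≃ deg x → Star (Strong z y) u x → Star (Strong z y) u y
      append {z} z≃x ε        = (x∼y , ≃-trans (deg-pos z) (deg-pos x) x∼y z≃x x≃b , b≃y) ◅ ε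
      append     z≃x (s ◅ es) = s ◅ append z≃x es
      -- The first edge of a nontrivial strong path is comparable with the degrees of both its ends.
      deg-≃ : ∀ z → z ∈ C → deg z ≃ deg x
      deg-≃ z z∈C = ends (proj₁ component z x z∈C x∈C)
        where
        ends : ∀ {z} → Star (Strong z x) z x → deg z ≃ deg x
        ends         ε                      = ≃-refl x
        ends {z = z} ((u∼w , z≃b , b≃x) ◅ _) = ≃-trans (deg-pos z) u∼w (deg-pos x) z≃b b≃x
      strong : StronglyConnected D
      strong u v (inj₁ u∈C)    (inj₁ v∈C)    = proj₁ component u v u∈C v∈C
      strong u _ (inj₁ u∈C)    (inj₂ ≡.refl) = append (deg-≃ u u∈C) (reroute (≃-refl u) x≃y (proj₁ component u x u∈C x∈C))
      strong _ v (inj₂ ≡.refl) (inj₁ v∈C)    = (y∼x ,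
        ≃-sym y∼x (deg-pos y) (≃-respˡ (symmetric x y) b≃y) ,
        ≃-trans y∼x (deg-pos x) (deg-pos v) (≃-respˡ (symmetric x y) b≃x)
          (≃-sym (deg-pos v) (deg-pos x) (deg-≃ v v∈C))) ◅ reroute y≃x (≃-refl v) (proj₁ component x v x∈C v∈C)
      strong _ _ (inj₂ ≡.refl) (inj₂ ≡.refl) = ε

    -- A strong path compares its edges with the degrees of the endpoints, while `Edge` compares
    -- them with the degree of the current vertex. `walk` carries along that the current vertex lies
    -- in C and has degree comparable with deg x, which turns one condition into the other.
    component-irreducible : ∀ x y → x ∈ C → y ∈ C → Star Edge x y
    component-irreducible x y x∈C y∈C = walk x∈C (≃-refl x) (proj₁ component x y x∈C y∈C)
      where
      walk : ∀ {u} → u ∈ C → deg x ≃ deg u → Star (Strong x y) u y → Star Edge u y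
      walk     u∈C x≃u ε = ε
      walk {u} u∈C x≃u ((u∼w , x≃b , _) ◅ es) = e ◅ walk (component-closed u∈C e)
        (≃-trans (deg-pos x) (deg-pos u) (deg-pos _) x≃u (edge-deg u∈C e)) es
        where
        e = ≃⇒edge u∼w (≃-trans u∼w (deg-pos x) (deg-pos u) (≃-sym (deg-pos x) u∼w x≃b) x≃u)

-- Potentials over the ordered field and their real parts

module Potentials
  {ℓ : Level} (em : ExcludedMiddle ℓ) (𝕂 : OrderedField ℓ) (ℝ : CompleteOrderedField ℓ)
  {V : Set ℓ} (Γ : WeightedGraph 𝕂 V) (lf : LocallyFinite Γ)
  (twoElements : HasTwoElements V) (connected : Connected Γ) where

  open WeightedGraph Γ
  open Network em 𝕂 ℝ Γ lf
  open NetworkProperties em 𝕂 ℝ Γ lf twoElements connected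
  open RealPart 𝕂 ℝ using (UnitK)
  private
    module K = OrderedFieldProperties 𝕂
    module R = CompleteOrderedFieldProperties ℝ
    module FK = FiniteSystems em 𝕂

  private
    _≟ⱽ_ : (x y : V) → Dec (x ≡ y)
    x ≟ⱽ y = em

  ≈mean⇒Δ≈0 : ∀ {f x} → f x K.≈ mean x f → Δ f x K.≈ K.0#
  ≈mean⇒Δ≈0 {f} {x} h = K.trans (Δ-mean f x) (K.trans (K.+-congʳ h) (K.-‿inverseʳ _))

  Δ≈0⇒≈mean : ∀ {f x} → Δ f x K.≈ K.0# → f x K.≈ mean x f
  Δ≈0⇒≈mean {f} {x} h = begin-equality
    f x                            ≈⟨ solve 2 (λ f m → f := (f :- m) :+ m) K.refl (f x) (mean x f) ⟩
    f x K.- mean x f K.+ mean x f  ≈⟨ K.+-congʳ (K.trans (K.sym (Δ-mean f x)) h) ⟩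
    K.0# K.+ mean x f              ≈⟨ K.+-identityˡ _ ⟩
    mean x f                       ∎
    where
    open K.≤-Reasoning
    open K.Solver

  -- The unknowns are the values on S without o. The value 1 at o becomes the right-hand side
  -- `p x o`, and the value 0 outside S drops the remaining weights, which leaves a substochastic
  -- system.
  potential-exists : ∀ {S o} → FiniteSubset S → o ∈ S → ∃ (IsPotential S o)
  potential-exists {S} {o} (xs , S⊆xs) o∈S = potential (FK.solve-substochastic interior-unique p (λ x → p x o)
      p-nonNeg (λ x → p-nonNeg x o) rows)
    where
    inner? : ∀ x → Dec (x ∈ S × o ≢ x)
    inner? x = em
    interior : List V
    interior = filter inner? (deduplicate _≟ⱽ_ xs)
    interior-unique : Unique interior
    interior-unique = filter⁺ inner? (DecUnique.deduplicate-! _≟ⱽ_ xs)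
    ∈interior : ∀ {x} → x ∈ S → o ≢ x → x ∈ˡ interior
    ∈interior {x} x∈S o≢x = ∈-filter⁺ inner? (∈-deduplicate⁺ _≟ⱽ_ (S⊆xs x x∈S)) (x∈S , o≢x)
    interior⁻ : ∀ {x} → x ∈ˡ interior → x ∈ S × o ≢ x
    interior⁻ {x} x∈ = proj₂ (∈-filter⁻ inner? {xs = deduplicate _≟ⱽ_ xs} x∈)
    unique′ : Unique (o ∷ interior)
    unique′ = All.tabulate (λ x∈ → proj₂ (interior⁻ x∈)) ∷ interior-unique
    rows : ∀ x → K.∑ interior (p x) K.+ p x o K.≤ K.1#
    rows x = begin
      K.∑ interior (p x) K.+ p x o   ≈⟨ K.+-comm _ _ ⟩
      K.∑ (o ∷ interior) (p x)       ≤⟨ FK.∑-⊆ unique′ (p-nonNeg x) (λ y _ p≉0 → ∼⇒∈neighbours (p≉0⇒∼ p≉0)) ⟩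
      K.∑ (neighbours x) (p x)       ≈⟨ ∑p x ⟩
      K.1#                           ∎
      where open K.≤-Reasoning
    potential : FK.Solution interior p (λ x → p x o) → ∃ (IsPotential S o)
    potential (v , 0≤v , _ , v-solves) = w , (λ x x∈S x≢o → ≈mean⇒Δ≈0 (w-harmonic x x∈S λ o≡x → x≢o (≡.sym o≡x))) , w-o , w-outside
      where
      w : V → K.Carrier
      w x with em {o ≡ x} | em {x ∈ S}
      ... | yes _ | _     = K.1#
      ... | no  _ | yes _ = v x
      ... | no  _ | no  _ = K.0#
      w-o : w o K.≈ K.1#
      w-o with em {o ≡ o} | em {o ∈ S}
      ... | yes _   | _ = K.refl
      ... | no  o≢o | _ = contradiction ≡.refl o≢o
      w-outside : ∀ x → x ∉ S → w x K.≈ K.0#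
      w-outside x x∉S with em {o ≡ x} | em {x ∈ S}
      ... | yes ≡.refl | _       = contradiction o∈S x∉S
      ... | no  _      | yes x∈S = contradiction x∈S x∉S
      ... | no  _      | no  _   = K.refl
      w-inner : ∀ x → x ∈ S → o ≢ x → w x K.≈ v x
      w-inner x x∈S o≢x with em {o ≡ x} | em {x ∈ S}
      ... | yes o≡x | _       = contradiction o≡x o≢x
      ... | no  _   | yes _   = K.refl
      ... | no  _   | no  x∉S = contradiction x∈S x∉S
      0≤w : ∀ x → K.0# K.≤ w x
      0≤w x with em {o ≡ x} | em {x ∈ S}
      ... | yes _ | _     = K.0≤1
      ... | no  _ | yes _ = 0≤v x
      ... | no  _ | no  _ = K.≤-refl
      support : ∀ {y} → ¬ w y K.≈ K.0# → y ∈ˡ o ∷ interior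
      support {y} w≉0 = locate (o ≟ⱽ y)
        where
        locate : Dec (o ≡ y) → y ∈ˡ o ∷ interior
        locate (yes ≡.refl) = here ≡.refl
        locate (no o≢y)     = there (∈interior (em⇒dne em λ y∉S → w≉0 (w-outside y y∉S)) o≢y)
      -- Both lists are free of duplicates and contain every y where the product of `p x y` and
      -- `w y` is nonzero.
      mean-w : ∀ x → mean x w K.≈ K.∑ (o ∷ interior) (λ y → p x y K.* w y)
      mean-w x = K.≤-antisym
        (FK.∑-⊆ (neighbours-unique x) 0≤pw λ y _ pw≉0 → support λ w≈0 → pw≉0 (K.trans (K.*-congˡ w≈0) (K.zeroʳ _)))
        (FK.∑-⊆ unique′ 0≤pw λ y _ pw≉0 → ∼⇒∈neighbours (p≉0⇒∼ λ p≈0 → pw≉0 (K.trans (K.*-congʳ p≈0) (K.zeroˡ _))))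
        where
        0≤pw : ∀ y → K.0# K.≤ p x y K.* w y
        0≤pw y = K.*-nonNeg (p-nonNeg x y) (0≤w y)
      w-harmonic : ∀ x → x ∈ S → o ≢ x → w x K.≈ mean x w
      w-harmonic x x∈S o≢x = begin-equality
        w x                                                       ≈⟨ w-inner x x∈S o≢x ⟩
        v x                                                       ≈⟨ v-solves x (∈interior x∈S o≢x) ⟩
        K.∑ interior (λ y → p x y K.* v y) K.+ p x o              ≈⟨ K.+-comm _ _ ⟩
        p x o K.+ K.∑ interior (λ y → p x y K.* v y)              ≈⟨ K.+-cong (K.trans (K.*-congˡ w-o) (K.*-identityʳ _))
                                                                       (K.∑-cong interior λ y y∈ → K.*-congˡ (w-inner y (proj₁ (interior⁻ y∈)) (proj₂ (interior⁻ y∈)))) ⟨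
        K.∑ (o ∷ interior) (λ y → p x y K.* w y)                  ≈⟨ mean-w x ⟨
        mean x w                                                  ∎
        where open K.≤-Reasoning

  module _ {S : Pred V ℓ} {o : V} (finite : FiniteSubset S) (S-connected : ConnectedSubset Γ S) (o∈S : o ∈ S)
           {v : V → K.Carrier} (potential : IsPotential S o v) where

    private
      v-harmonic : ∀ x → x ∈ S → x ≢ o → v x K.≈ mean x v
      v-harmonic x x∈S x≢o = Δ≈0⇒≈mean (proj₁ potential x x∈S x≢o)

      v-o : v o K.≈ K.1#
      v-o = proj₁ (proj₂ potential)

      v-outside : ∀ x → x ∉ S → v x K.≈ K.0#
      v-outside = proj₂ (proj₂ potential)

      -- Over 𝕂 every edge has positive weight, even an infinitesimal one, so connectedness of S
      -- yields the exit path to o and the maximum principle can be run on all of V. It is applied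
      -- to v at level 1 and to - v at level 0.
      bound : ∀ (g : V → K.Carrier) c → g o K.≤ c → (∀ x → x ∉ S → g x K.≤ c) →
              (∀ x → x ∈ S → x ≢ o → g x K.≈ mean x g) → ∀ x → g x K.≤ c
      bound g c go≤c outside harmonic x = FK.maximum-principle neighbours p p-nonNeg (λ _ → ⊤) _ g c (proj₁ finite)
        (λ y _ c<gy → proj₂ finite y (inside y c<gy)) subharmonic (λ y _ c<gy → o , go≤c , path (S-connected y o (inside y c<gy) o∈S)) x _
        where
        inside : ∀ y → c K.< g y → y ∈ S
        inside y c<gy = em⇒dne em λ y∉S → K.<⇒≱ c<gy (outside y y∉S)
        path : ∀ {y z} → Star (λ u w → u ∈ S × w ∈ S × u ∼ w) y z → Star (FK.PositiveEdge neighbours p p-nonNeg) y z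
        path ε                      = ε
        path ((_ , _ , u∼w) ◅ es)   = (∼⇒∈neighbours u∼w , p-pos u∼w) ◅ path es
        subharmonic : ∀ y → y ∈ (λ _ → ⊤) → c K.< g y → K.∑ (neighbours y) (λ z → p y z K.* (g y K.- g z)) K.≤ K.0#
        subharmonic y _ c<gy = begin
          K.∑ (neighbours y) (λ z → p y z K.* (g y K.- g z))
            ≈⟨ K.∑-cong (neighbours y) (λ z _ → solve 3 (λ p c g → p :* (c :- g) := p :* c :- p :* g) K.refl (p y z) (g y) (g z)) ⟩
          K.∑ (neighbours y) (λ z → p y z K.* g y K.- p y z K.* g z)
            ≈⟨ K.∑-minus (neighbours y) _ _ ⟩
          K.∑ (neighbours y) (λ z → p y z K.* g y) K.- mean y g
            ≈⟨ K.+-congʳ (K.trans (K.∑-*ʳ (neighbours y) (g y) (p y)) (K.trans (K.*-congʳ (∑p y)) (K.*-identityˡ _))) ⟩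
          g y K.- mean y g
            ≈⟨ K.+-congʳ (harmonic y (inside y c<gy) λ { ≡.refl → K.<⇒≱ c<gy go≤c }) ⟩
          mean y g K.- mean y g
            ≈⟨ K.-‿inverseʳ _ ⟩
          K.0# ∎
          where
          open K.≤-Reasoning
          open K.Solver

    potential-unit : ∀ x → UnitK (v x)
    potential-unit x = 0≤v , bound v K.1# (K.≤-reflexive v-o) (λ y y∉S → K.≤-trans (K.≤-reflexive (v-outside y y∉S)) K.0≤1) v-harmonic x
      where
      open K.≤-Reasoning
      neg-mean : ∀ y → mean y (λ z → K.- v z) K.≈ K.- mean y v
      neg-mean y = K.trans (K.∑-cong (neighbours y) λ z _ → K.sym (K.-‿distribʳ-* _ _)) (K.∑-neg (neighbours y) _)
      -v≤0 : K.- v x K.≤ K.0#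
      -v≤0 = bound (λ y → K.- v y) K.0#
        (K.≤-trans (K.neg-mono-≤ (K.≤-trans K.0≤1 (K.≤-reflexive (K.sym v-o)))) (K.≤-reflexive K.-0#≈0#))
        (λ y y∉S → K.≤-reflexive (K.trans (K.-‿cong (v-outside y y∉S)) K.-0#≈0#))
        (λ y y∈S y≢o → K.trans (K.-‿cong (v-harmonic y y∈S y≢o)) (K.sym (neg-mean y))) x
      0≤v : K.0# K.≤ v x
      0≤v = begin
        K.0#              ≈⟨ K.-0#≈0# ⟨
        K.- K.0#          ≤⟨ K.neg-mono-≤ -v≤0 ⟩
        K.- (K.- v x)     ≈⟨ K.-‿involutive _ ⟩
        v x               ∎

    ρ-potential-o : ρ (v o) R.≈ R.1#
    ρ-potential-o = R.trans (ρ-cong (potential-unit o) 1-unit v-o) ρ-1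

    ρ-potential-harmonic : ∀ x → x ∈ S → x ≢ o → ρ (v x) R.≈ average x (λ y → ρ (v y))
    ρ-potential-harmonic x x∈S x≢o = R.trans
      (ρ-cong (potential-unit x) (mean-unit x potential-unit) (v-harmonic x x∈S x≢o)) (ρ-mean x potential-unit)

    ρ-potential-outside : ∀ x → x ∉ S → ρ (v x) R.≈ R.0#
    ρ-potential-outside x x∉S = R.trans (ρ-cong (potential-unit x) 0-unit (v-outside x x∉S)) ρ-0

    -- The normalised capacity and the mean of v at o are nonnegative and add up to 1 in 𝕂, so
    -- additivity of `ρ` on the unit interval yields the difference in ℝ.
    escape : ρ (deg o K.* Δ v o K.* deg o K.⁻¹) R.≈ R.1# R.- average o (λ y → ρ (v y))
    escape = begin-equality
      ρ q                                          ≈⟨ solve 2 (λ q m → q := (q :+ m) :- m) R.refl (ρ q) (ρ m) ⟩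
      (ρ q R.+ ρ m) R.- ρ m                        ≈⟨ R.+-congʳ (ρ-+ q-unit m-unit sum-unit) ⟨
      ρ (q K.+ m) R.- ρ m                          ≈⟨ R.+-cong (R.trans (ρ-cong sum-unit 1-unit q+m≈1) ρ-1)
                                                        (R.-‿cong (ρ-mean o potential-unit)) ⟩
      R.1# R.- average o (λ y → ρ (v y))           ∎
      where
      open R.≤-Reasoning
      open R.Solver
      q m : K.Carrier
      q = deg o K.* Δ v o K.* deg o K.⁻¹
      m = mean o v
      m-unit : UnitK m
      m-unit = mean-unit o potential-unit
      q≈1-m : q K.≈ K.1# K.- m
      q≈1-m = K.trans (K.trans (K.*-assoc _ _ _) (K.*⁻¹-cancel (Δ v o) (deg-pos o))) (K.trans (Δ-mean v o) (K.+-congʳ v-o))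
      q+m≈1 : q K.+ m K.≈ K.1#
      q+m≈1 = K.trans (K.+-congʳ q≈1-m) (K.trans (K.+-assoc _ _ _) (K.trans (K.+-congˡ (K.-‿inverseˡ m)) (K.+-identityʳ _)))
      0≤q : K.0# K.≤ q
      0≤q = K.≤-trans (K.x≤y⇒0≤y-x (proj₂ m-unit)) (K.≤-reflexive (K.sym q≈1-m))
      q-unit : UnitK q
      q-unit = 0≤q , K.≤-trans (K.x≤x+y (proj₁ m-unit)) (K.≤-reflexive q+m≈1)
      sum-unit : UnitK (q K.+ m)
      sum-unit = K.≤-trans K.0≤1 (K.≤-reflexive (K.sym q+m≈1)) , K.≤-reflexive q+m≈1

-- Capacities and certainty of hitting on an essential component

module EssentialRecurrence
  {ℓ : Level} (em : ExcludedMiddle ℓ) (𝕂 : OrderedField ℓ) (ℝ : CompleteOrderedField ℓ)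
  {V : Set ℓ} (Γ : WeightedGraph 𝕂 V) (lf : LocallyFinite Γ)
  (twoElements : HasTwoElements V) (connected : Connected Γ) where

  open Network em 𝕂 ℝ Γ lf
  open NetworkProperties em 𝕂 ℝ Γ lf twoElements connected
  open EssentialComponents em 𝕂 ℝ Γ lf twoElements connected
  open Potentials em 𝕂 ℝ Γ lf twoElements connected
  open LimitSuperior em 𝕂 ℝ Γ lf
  private
    module K = OrderedFieldProperties 𝕂
    module R = CompleteOrderedFieldProperties ℝ

  module _ {C : Pred V ℓ} (component : IsStronglyConnectedComponent C) (essential : IsEssential C) where

    open Class C (component-closed component essential) (component-irreducible component essential) public

    module _ {o : V} (E : Exhaustion Γ o) where
      open Exhaustion E renaming (connected to set-connected)

      private
        o∈set : ∀ n → o ∈ set n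
        o∈set zero    = base
        o∈set (suc n) = increasing n (o∈set n)

        v : ℕ → V → K.Carrier
        v n = the em (λ _ → K.0#) (IsPotential (set n) o)

        potential : ∀ n → IsPotential (set n) o (v n)
        potential n = the-satisfies em _ (IsPotential (set n) o) (potential-exists (finite n) (o∈set n))

        u : ℕ → V → R.Carrier
        u n x = ρ (v n x)

        e : ℕ → R.Carrier
        e n = ρ (cap (set n) o K.* deg o K.⁻¹)

        e≈ : ∀ n → e n R.≈ R.1# R.- average o (u n)
        e≈ n = escape (finite n) (set-connected n) (o∈set n) (potential n)

        equilibrium : ∀ n → IsEquilibrium (set n) o (u n)
        equilibrium n = record
          { nonNeg   = λ x → ρ-nonNeg (unit n x)
          ; base     = ρ-potential-o (finite n) (set-connected n) (o∈set n) (potential n)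
          ; harmonic = ρ-potential-harmonic (finite n) (set-connected n) (o∈set n) (potential n)
          ; outside  = ρ-potential-outside (finite n) (set-connected n) (o∈set n) (potential n)
          }
          where
          unit = λ n → potential-unit (finite n) (set-connected n) (o∈set n) (potential n)

      module _ (o∈C : o ∈ C) where

        private
          -- The probability of never returning to o. Equilibrium functions underestimate `hit∞ o`
          -- on C, so every normalised capacity is at least this large.
          missed : R.Carrier
          missed = R.1# R.- average o (hit∞ o)

          missed≤e : ∀ n → missed R.≤ e n
          missed≤e n = R.≤-trans
            (R.minus-monoʳ-≤ R.1# (average-mono o λ y edge →
              equilibrium≤hit∞ (finite n) o∈C (equilibrium n) y (component-closed component essential o∈C edge)))
            (R.≤-reflexive (R.sym (e≈ n)))

          0≤missed : R.0# R.≤ missed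
          0≤missed = R.x≤y⇒0≤y-x (R.≤-trans (average-mono o λ y _ → hit∞-≤1 o y) (R.≤-reflexive (average-const o R.1#)))

        certainHit⇒G≡∞ : CertainHit o → G∞ o E ≡ ∞
        certainHit⇒G≡∞ certain = limsup-∞ (λ n → R.≤-trans 0≤missed (missed≤e n)) λ 0<δ →
          let N , small = escape-vanishes set increasing covers u equilibrium o∈C certain 0<δ
          in N , λ n N≤n → R.≤-trans (R.≤-reflexive (e≈ n)) (small n N≤n)

        -- Were the return to o not certain, `missed` would be a positive lower bound for all
        -- normalised capacities, and the limit superior of their reciprocals would be finite.
        G≡∞⇒certainHit : G∞ o E ≡ ∞ → CertainHit o
        G≡∞⇒certainHit G≡∞ = certainReturn⇒certainHit o∈C (R.≮⇒≥ λ average<1 →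
          limsup-≢∞ (R.x<y⇒0<y-x average<1) missed≤e G≡∞)

theorem5p4 : ∀ {ℓ : Level} (em : ExcludedMiddle ℓ)
    (𝕂 : OrderedField ℓ) (ℝ : CompleteOrderedField ℓ)
    {V : Set ℓ} → AtMostCountable V → HasTwoElements V →
    (Γ : WeightedGraph 𝕂 V) → Connected Γ → (lf : LocallyFinite Γ) →
    let open Network em 𝕂 ℝ Γ lf in
    (chain : ∀ x → MarkovChain ℝ π x)
    (E : ∀ o → Exhaustion Γ o) →
    let G = λ o → G∞ o (E o) in
    (C : Pred V ℓ) → IsStronglyConnectedComponent C → IsEssential C →
    ((Recurrent chain C ⇔ (∃ λ o → o ∈ C × G o ≡ ∞)) ×
    (Recurrent chain C ⇔ (∀ o → o ∈ C → G o ≡ ∞))) ×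
    ((Transient chain C ⇔ (∃ λ o → o ∈ C × G o <∞ ∞)) ×
    (Transient chain C ⇔ (∀ o → o ∈ C → G o <∞ ∞)))
theorem5p4 {ℓ} em 𝕂 ℝ {V} _ twoElements Γ connected lf chain E C component essential =
  (mk⇔ recurrent⇒∃G≡∞ ∃G≡∞⇒recurrent , mk⇔ recurrent⇒∀G≡∞ ∀G≡∞⇒recurrent) ,
  (mk⇔ transient⇒∃G<∞ ∃G<∞⇒transient , mk⇔ transient⇒∀G<∞ ∀G<∞⇒transient)
  where
  open Network em 𝕂 ℝ Γ lf
  open NetworkProperties em 𝕂 ℝ Γ lf twoElements connected
  open EssentialComponents em 𝕂 ℝ Γ lf twoElements connected
  open LimitSuperior em 𝕂 ℝ Γ lf
  open EssentialRecurrence em 𝕂 ℝ Γ lf twoElements connected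
  open Recurrence em ℝ neighbours neighbours-unique π π-nonNeg ∑π

  Certain : V → Set ℓ
  Certain = CertainHit component essential

  a : V
  a = proj₁ (component-nonempty component)

  a∈C : a ∈ C
  a∈C = proj₂ (component-nonempty component)

  recurrent⇒certain : ∀ {o} → o ∈ C → RecurrentVertex chain o → Certain o
  recurrent⇒certain {o} = recurrent⇒certainHit (chain o) C
    (component-closed component essential) (component-irreducible component essential)

  certain⇒recurrent : ∀ {o} → o ∈ C → Certain o → RecurrentVertex chain o
  certain⇒recurrent {o} = certainHit⇒recurrent (chain o) C
    (component-closed component essential) (component-irreducible component essential)

  certain⇒G : ∀ {o} → o ∈ C → Certain o → G∞ o (E o) ≡ ∞
  certain⇒G {o} = certainHit⇒G≡∞ component essential (E o)

  G⇒certain : ∀ {o} → o ∈ C → G∞ o (E o) ≡ ∞ → Certain o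
  G⇒certain {o} = G≡∞⇒certainHit component essential (E o)

  all-recurrent : ∀ {o} → o ∈ C → Certain o → Recurrent chain C
  all-recurrent o∈C certain x x∈C = certain⇒recurrent x∈C (certainHit-transfer component essential o∈C x∈C certain)

  transient⇒G : ∀ {o} → o ∈ C → TransientVertex chain o → G∞ o (E o) <∞ ∞
  transient⇒G o∈C transient = ≢∞⇒<∞ λ G≡∞ → transient (certain⇒recurrent o∈C (G⇒certain o∈C G≡∞))

  -- `Transient` denies recurrence of each vertex separately. A recurrent x would make hitting x
  -- certain on C; this certainty carries over to o and contradicts the finite value there.
  all-transient : ∀ {o} → o ∈ C → G∞ o (E o) <∞ ∞ → Transient chain C
  all-transient o∈C G<∞ x x∈C recurrent = <∞⇒≢∞ G<∞
    (certain⇒G o∈C (certainHit-transfer component essential x∈C o∈C (recurrent⇒certain x∈C recurrent)))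

  recurrent⇒∀G≡∞ : Recurrent chain C → ∀ o → o ∈ C → G∞ o (E o) ≡ ∞
  recurrent⇒∀G≡∞ recurrent o o∈C = certain⇒G o∈C (recurrent⇒certain o∈C (recurrent o o∈C))

  recurrent⇒∃G≡∞ : Recurrent chain C → ∃ λ o → o ∈ C × G∞ o (E o) ≡ ∞
  recurrent⇒∃G≡∞ recurrent = a , a∈C , recurrent⇒∀G≡∞ recurrent a a∈C

  ∃G≡∞⇒recurrent : (∃ λ o → o ∈ C × G∞ o (E o) ≡ ∞) → Recurrent chain C
  ∃G≡∞⇒recurrent (o , o∈C , G≡∞) = all-recurrent o∈C (G⇒certain o∈C G≡∞)

  ∀G≡∞⇒recurrent : (∀ o → o ∈ C → G∞ o (E o) ≡ ∞) → Recurrent chain C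
  ∀G≡∞⇒recurrent G≡∞ = ∃G≡∞⇒recurrent (a , a∈C , G≡∞ a a∈C)

  transient⇒∀G<∞ : Transient chain C → ∀ o → o ∈ C → G∞ o (E o) <∞ ∞
  transient⇒∀G<∞ transient o o∈C = transient⇒G o∈C (transient o o∈C)

  transient⇒∃G<∞ : Transient chain C → ∃ λ o → o ∈ C × G∞ o (E o) <∞ ∞
  transient⇒∃G<∞ transient = a , a∈C , transient⇒∀G<∞ transient a a∈C

  ∃G<∞⇒transient : (∃ λ o → o ∈ C × G∞ o (E o) <∞ ∞) → Transient chain C
  ∃G<∞⇒transient (o , o∈C , G<∞) = all-transient o∈C G<∞

  ∀G<∞⇒transient : (∀ o → o ∈ C → G∞ o (E o) <∞ ∞) → Transient chain C
  ∀G<∞⇒transient G<∞ = all-transient a∈C (G<∞ a a∈C)
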